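{- Let $k$ and $n$ be positive integers such that $2k\leqslant n<(k+1)^3$. Then the polynomial $P_{n,k}(x)=\sum_{j=0}^{k}\binom{n}{j}x^j$ is irreducible over $\mathbb{Q}$.
   Context: $P_{n,k}(x)$ is the truncation at degree $k$ of the binomial expansion of $(1+x)^n$. -}

module Defs where

open import Data.Nat using (ℕ; zero; suc)
open import Data.Nat.Combinatorics using (_C_)
open import Data.Integer using (+_)
open import Data.Rational using (ℚ; 0ℚ; 1ℚ; _+_; _*_; _/_)
open import Data.List using (List; []; _∷_; map; upTo)
open import Data.Product using (Σ; ∃; _×_)
open import Data.Sum using (_⊎_)
open import Relation.Binary.PropositionalEquality using (_≡_)
open import Relation.Nullary using (¬_)

-- Univariate polynomials over ℚ, as coefficient lists (constant term first).
-- Trailing zeros are allowed; equality of polynomials is coefficientwise.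
Poly : Set
Poly = List ℚ

coeff : Poly → ℕ → ℚ
coeff []      _       = 0ℚ
coeff (a ∷ p) zero    = a
coeff (a ∷ p) (suc m) = coeff p m

_≈P_ : Poly → Poly → Set
p ≈P q = ∀ m → coeff p m ≡ coeff q m

addP : Poly → Poly → Poly
addP []      q       = q
addP p       []      = p
addP (a ∷ p) (b ∷ q) = (a + b) ∷ addP p q

mulP : Poly → Poly → Poly
mulP []      q = []
mulP (a ∷ p) q = addP (map (a *_) q) (0ℚ ∷ mulP p q)

IsUnit : Poly → Set
IsUnit p = ∃ λ q → mulP p q ≈P (1ℚ ∷ [])

Irreducible : Poly → Set
Irreducible p =
  ¬ (p ≈P []) × ¬ IsUnit p ×
  (∀ f g → p ≈P mulP f g → IsUnit f ⊎ IsUnit g)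

ℕ→ℚ : ℕ → ℚ
ℕ→ℚ m = (+ m) / 1

P : ℕ → ℕ → Poly
P n k = map (λ j → ℕ→ℚ (n C j)) (upTo (suc k))

{-# OPTIONS --safe #-}

-- In powers of y = x + 1 the polynomial P n k has coefficients c_j with
-- (n - j) c_j = ± (n - k) C(n,k) C(k,j). Hence if a prime p > k divides n - i, 0 ≤ i ≤ k,
-- exactly h times, then it divides every other c_j exactly h times and c_i not at all: the
-- Newton polygon at p has its vertices at 0, i and k. For a factorisation over ℤ into
-- degrees d + e = k this forces i = d or i = e if h = 1, and allows few more i if h = 2;
-- h ≥ 3 is excluded by n < (k + 1)³. So almost all of n, …, n - k are products of primes
-- p ≤ k. Erdős's proof of Sylvester's theorem shows that this is impossible if n is at least
-- about k^(4/3). For smaller n it would make C(n,k) too small, by the bound 4^y on the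
-- product of the primes up to y, as soon as k is large; for moderate k there are three
-- primes between n - k and n, and the smallest k are settled by computation.
module Submission where

open import Defs
open import Data.Bool using (Bool; true; false; _∧_; _∨_; not; if_then_else_; T)
open import Data.Empty using (⊥; ⊥-elim)
open import Data.Integer as ℤ using (ℤ; 0ℤ; 1ℤ) renaming (+_ to pos)
import Data.Integer.DivMod as ℤ/
open import Data.Integer.Divisibility.Signed as ℤ∣ using (divides; 0∣⇒≡0) renaming (_∣_ to _∣ℤ_)
import Data.Integer.Properties as ℤP
open import Data.Integer.Tactic.RingSolver using (solve-∀)
open import Data.List
  using (List; []; _∷_; map; _∷ʳ_; _++_; length; upTo; applyUpTo)
open import Data.List.Membership.Propositional using (_∈_)
import Data.List.Membership.Propositional.Properties as ∈P
import Data.List.Properties as ListP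
open import Data.List.Relation.Unary.All using (All; []; _∷_)
open import Data.List.Relation.Unary.Any using (here; there)
open import Data.Nat as ℕ
  using (ℕ; zero; suc; _+_; _*_; _∸_; _^_; _!; _≤_; _<_; z≤n; s≤s; NonZero; _≟_; _≤?_; _<?_)
open import Data.Nat.Combinatorics using (_C_; nCn≡1; nCk+nC[k+1]≡[n+1]C[k+1])
open import Data.Nat.Divisibility as ℕ∣ using (_∣_; _∤_; divides)
open import Data.Nat.DivMod
  using (_%_; m≡m%n+[m/n]*n; m%n<n; m/n*n≤m; [m+kn]%n≡m%n) renaming (_/_ to _/ℕ_)
open import Data.Nat.ListAction using (product)
open import Data.Nat.ListAction.Properties using (∈⇒∣product)
open import Data.Nat.Primality using
  (Prime; prime?; euclidsLemma; prime⇒irreducible; prime⇒nonZero; prime⇒nonTrivial;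
   _Rough_; 2-rough; ∤⇒rough-suc; rough∧square>⇒prime)
open import Data.Nat.Primality.Factorisation using (PrimeFactorisation; factorise)
open import Data.Nat.Properties as ℕP using
  (≤-trans; <⇒≤; ≤-refl; <-≤-trans; ≤-<-trans; ≮⇒≥; ≰⇒>; +-identityʳ; <⇒≢;
   >⇒≢; <⇒≱; m≤m+n; *-monoʳ-≤; *-mono-≤; *-mono-<; +-suc; +-comm; n<1+n; *-monoˡ-≤)
open import Data.Nat.Tactic.RingSolver using () renaming (solve-∀ to solveℕ-∀)
open import Data.Product using (∃; ∃₂; _×_; _,_; proj₁; proj₂)
open import Data.Rational as ℚ using (ℚ; 0ℚ; 1ℚ; 1/_; ↥_; ↧_; ↧ₙ_; toℚᵘ)
import Data.Rational.Properties as ℚP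
import Data.Rational.Solver as ℚ-Solver
open import Data.Rational.Unnormalised as ℚᵘ using (mkℚᵘ; *≡*)
import Data.Rational.Unnormalised.Properties as ℚᵘP
open import Data.Sum using (_⊎_; inj₁; inj₂)
open import Function using (_∘_)
open import Relation.Binary.Definitions using (Tri; tri<; tri≈; tri>)
open import Relation.Binary.PropositionalEquality hiding (J)
open import Relation.Nullary using (¬_; Dec; yes; no; contradiction)

open import Data.List.Membership.DecPropositional _≟_ using (_∈?_)

-- Newton polygons

-- The cases differ in how many indices i Erdős's count has to discard besides one for each prime up
-- to k. If n < (k + 1)², then h = 1 and these are d and e. If n ≥ (k + 1)² and d < e, there are at
-- most four: d, e, 2d and e - d. If d = e, however, h = 2 allows every even i, so only terms with
-- odd i are counted; this is why the count is set up for progressions of any difference δ. Primes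
-- up to k are counted by a wheel: 48 of 210 consecutive numbers are prime to 210, whence π(k) ≤ k/4
-- - 1 from k = 300 on. About 3k/4 terms then remain, and if each is at least k^(4/3), their product
-- beats k! ≤ k^k; this is the origin of the exponent 4/3. For n ≥ (k + 1)² the terms exceed k², and
-- half of them would do. For smaller n, C(n,k) divides a product of few numbers up to n and a
-- primorial: one number for each prime up to s, where n < s², and n - d, n - e for the primes above
-- k. But C(n,k) exceeds the bound on that primorial by a factor of about (3/2)^k.

Seq : Set
Seq = ℕ → ℤ

conv : Seq → Seq → Seq
conv f g zero    = f 0 ℤ.* g 0
conv f g (suc m) = f 0 ℤ.* g (suc m) ℤ.+ conv (f ∘ suc) g m

conv-∣ : ∀ {q} f g m → (∀ a b → a + b ≡ m → q ∣ℤ f a ℤ.* g b) → q ∣ℤ conv f g m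
conv-∣ f g zero    h = h 0 0 refl
conv-∣ f g (suc m) h = ℤ∣.∣m∣n⇒∣m+n (h 0 (suc m) refl)
  (conv-∣ (f ∘ suc) g m λ a b e → h (suc a) b (cong suc e))

-- The tool behind all Newton polygon arguments below: if q divides every other term of the
-- coefficient, then it divides the pivot `f a ℤ.* g b` as soon as it divides the whole.
conv-pivot : ∀ {q} f g m a b → a + b ≡ m →
  (∀ a′ b′ → a′ + b′ ≡ m → a′ ≢ a → q ∣ℤ f a′ ℤ.* g b′) →
  q ∣ℤ conv f g m ℤ.- f a ℤ.* g b
conv-pivot {q} f g zero zero zero refl h =
  subst (q ∣ℤ_) (sym (ℤP.+-inverseʳ (f 0 ℤ.* g 0))) (divides 0ℤ refl)
conv-pivot {q} f g (suc m) zero .(suc m) refl h =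
  subst (q ∣ℤ_) (lem (f 0 ℤ.* g (suc m)) (conv (f ∘ suc) g m))
    (conv-∣ (f ∘ suc) g m λ a b e → h (suc a) b (cong suc e) λ ())
  where
  lem : ∀ x y → y ≡ x ℤ.+ y ℤ.- x
  lem = solve-∀
conv-pivot {q} f g (suc m) (suc a) b e h =
  subst (q ∣ℤ_) (lem (f 0 ℤ.* g (suc m)) (conv (f ∘ suc) g m) (f (suc a) ℤ.* g b))
    (ℤ∣.∣m∣n⇒∣m+n (h 0 (suc m) refl λ ())
      (conv-pivot (f ∘ suc) g m a b (ℕP.suc-injective e)
        λ a′ b′ e′ ne → h (suc a′) b′ (cong suc e′) (ne ∘ ℕP.suc-injective)))
  where
  lem : ∀ x y z → x ℤ.+ (y ℤ.- z) ≡ x ℤ.+ y ℤ.- z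
  lem = solve-∀

∣-pivot : ∀ {q x y} → q ∣ℤ x ℤ.- y → q ∣ℤ x → q ∣ℤ y
∣-pivot {q} {x} {y} h hx = subst (q ∣ℤ_) (lem x y) (ℤ∣.∣m∣n⇒∣m-n hx h)
  where
  lem : ∀ x y → x ℤ.- (x ℤ.- y) ≡ y
  lem = solve-∀

-- Zero counts as prime here, so that degrees (last index not divisible by 0)
-- and p-adic extremal indices are handled by the same lemmas.
Primeℤ : ℤ → Set
Primeℤ q = ∀ x y → q ∣ℤ x ℤ.* y → q ∣ℤ x ⊎ q ∣ℤ y

First Last : ℤ → Seq → ℕ → Set
First q f s = ¬ q ∣ℤ f s × (∀ j → j < s → q ∣ℤ f j)
Last  q f s = ¬ q ∣ℤ f s × (∀ j → s < j → q ∣ℤ f j)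

∣⇒∣*ˡ : ∀ {q} x y → q ∣ℤ x → q ∣ℤ x ℤ.* y
∣⇒∣*ˡ x y = ℤ∣.∣m⇒∣m*n y

∣⇒∣*ʳ : ∀ {q} x y → q ∣ℤ y → q ∣ℤ x ℤ.* y
∣⇒∣*ʳ x y = ℤ∣.∣n⇒∣m*n x

private
  other-< : ∀ {a b s t} → a + b ≡ s + t → s < a → b < t
  other-< {a} {b} {s} {t} e s<a with b <? t
  ... | yes p = p
  ... | no  p = contradiction e (>⇒≢ (ℕP.+-mono-<-≤ s<a (≮⇒≥ p)))

  other-> : ∀ {a b s t} → a + b ≡ s + t → a < s → t < b
  other-> {a} {b} {s} {t} e a<s = other-< {s} {t} {a} {b} (sym e) a<s

-- Any other pair of indices with sum s + t has a < s or b < t. For a prime q this is the core of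
-- Gauss's lemma; together with `last-conv` it also locates the vertex of the product.
first-conv : ∀ {q} f g {s t} → Primeℤ q → First q f s → First q g t →
  ¬ q ∣ℤ conv f g (s + t)
first-conv {q} f g {s} {t} pr (f≠ , f<) (g≠ , g<) h
  with pr _ _ (∣-pivot (conv-pivot f g (s + t) s t refl others) h)
  where
  others : ∀ a b → a + b ≡ s + t → a ≢ s → q ∣ℤ f a ℤ.* g b
  others a b e a≢s with ℕP.<-cmp a s
  ... | tri< a<s _ _ = ∣⇒∣*ˡ _ _ (f< a a<s)
  ... | tri≈ _ a≡s _ = contradiction a≡s a≢s
  ... | tri> _ _ s<a = ∣⇒∣*ʳ (f a) _ (g< b (other-< e s<a))
... | inj₁ x = f≠ x
... | inj₂ y = g≠ y

-- Separate from `last-conv` because for q = 0 it is an equation: the leading coefficient of the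
-- product is the product of the leading coefficients.
last-pivot : ∀ {q} f g {s t} → Last q f s → Last q g t →
  q ∣ℤ conv f g (s + t) ℤ.- f s ℤ.* g t
last-pivot {q} f g {s} {t} (f≠ , f>) (g≠ , g>) = conv-pivot f g (s + t) s t refl others
  where
  others : ∀ a b → a + b ≡ s + t → a ≢ s → q ∣ℤ f a ℤ.* g b
  others a b e a≢s with ℕP.<-cmp a s
  ... | tri< a<s _ _ = ∣⇒∣*ʳ (f a) _ (g> b (other-> e a<s))
  ... | tri≈ _ a≡s _ = contradiction a≡s a≢s
  ... | tri> _ _ s<a = ∣⇒∣*ˡ _ _ (f> a s<a)

last-conv : ∀ {q} f g {s t} → Primeℤ q → Last q f s → Last q g t →
  ¬ q ∣ℤ conv f g (s + t)
last-conv f g pr lf lg h with pr _ _ (∣-pivot (last-pivot f g lf lg) h)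
... | inj₁ x = proj₁ lf x
... | inj₂ y = proj₁ lg y

first-search : ∀ q (f : Seq) D → (∀ j → D ≤ j → f j ≡ 0ℤ) → ∃ (First q f) ⊎ (∀ j → q ∣ℤ f j)
first-search q f D z = go D
  (λ j D≤j → subst (q ∣ℤ_) (sym (z j D≤j)) (divides 0ℤ refl))
  where
  upto : ∀ m → ∃ (First q f) ⊎ (∀ j → j < m → q ∣ℤ f j)
  upto zero = inj₂ λ _ ()
  upto (suc m) with upto m
  ... | inj₁ x = inj₁ x
  ... | inj₂ h with q ℤ∣.∣? f m
  ...   | no ¬d = inj₁ (m , ¬d , h)
  ...   | yes d = inj₂ λ j j<m → case (ℕP.m≤n⇒m<n∨m≡n (ℕP.≤-pred j<m))
    where
    case : ∀ {j} → j < m ⊎ j ≡ m → q ∣ℤ f j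
    case (inj₁ l)    = h _ l
    case (inj₂ refl) = d
  go : ∀ D → (∀ j → D ≤ j → q ∣ℤ f j) → ∃ (First q f) ⊎ (∀ j → q ∣ℤ f j)
  go D hi with upto D
  ... | inj₁ x  = inj₁ x
  ... | inj₂ lo = inj₂ λ j → case j (ℕP.<-≤-connex j D)
    where
    case : ∀ j → j < D ⊎ D ≤ j → q ∣ℤ f j
    case j (inj₁ l) = lo j l
    case j (inj₂ l) = hi j l

last-search : ∀ q (f : Seq) D → (∀ j → D ≤ j → q ∣ℤ f j) → ∃ (Last q f) ⊎ (∀ j → q ∣ℤ f j)
last-search q f zero    hi = inj₂ λ j → hi j z≤n
last-search q f (suc D) hi with q ℤ∣.∣? f D
... | no ¬d = inj₁ (D , ¬d , hi)
... | yes d = last-search q f D λ j D≤j → case (ℕP.m≤n⇒m<n∨m≡n D≤j)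
  where
  case : ∀ {j} → D < j ⊎ D ≡ j → q ∣ℤ f j
  case (inj₁ l)    = hi _ l
  case (inj₂ refl) = d

≡0⇒∣ : ∀ {q x} → x ≡ 0ℤ → q ∣ℤ x
≡0⇒∣ refl = divides 0ℤ refl

Primeℤ-0 : Primeℤ 0ℤ
Primeℤ-0 x y h with ℤP.i*j≡0⇒i≡0∨j≡0 x (0∣⇒≡0 h)
... | inj₁ e = inj₁ (≡0⇒∣ e)
... | inj₂ e = inj₂ (≡0⇒∣ e)

∣-square-cancelˡ : ∀ {q} x y → q ≢ 0ℤ → Primeℤ q → ¬ q ∣ℤ x → q ℤ.* q ∣ℤ x ℤ.* y → q ℤ.* q ∣ℤ y
∣-square-cancelˡ {q} x y q≢0 pr ¬x h@(divides r e) with pr x y (ℤ∣.∣-trans (divides q refl) h)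
... | inj₁ d = contradiction d ¬x
... | inj₂ (divides y′ refl) with pr x y′ (divides r (ℤP.*-cancelʳ-≡ _ _ q ⦃ ℤ.≢-nonZero q≢0 ⦄ lem))
  where
  l₁ : ∀ x y q → x ℤ.* y ℤ.* q ≡ x ℤ.* (y ℤ.* q)
  l₁ = solve-∀
  l₂ : ∀ r q → r ℤ.* (q ℤ.* q) ≡ r ℤ.* q ℤ.* q
  l₂ = solve-∀
  lem : x ℤ.* y′ ℤ.* q ≡ r ℤ.* q ℤ.* q
  lem = trans (l₁ x y′ q) (trans e (l₂ r q))
...   | inj₁ d = contradiction d ¬x
...   | inj₂ (divides y″ refl) = divides y″ (ℤP.*-assoc y″ q q)

∣-square-cancelʳ : ∀ {q} x y → q ≢ 0ℤ → Primeℤ q → ¬ q ∣ℤ y → q ℤ.* q ∣ℤ x ℤ.* y → q ℤ.* q ∣ℤ x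
∣-square-cancelʳ {q} x y q≢0 pr ¬y h =
  ∣-square-cancelˡ y x q≢0 pr ¬y (subst (q ℤ.* q ∣ℤ_) (ℤP.*-comm x y) h)

*-∣-* : ∀ {q r x y} → q ∣ℤ x → r ∣ℤ y → q ℤ.* r ∣ℤ x ℤ.* y
*-∣-* {q} {r} (divides a refl) (divides b refl) = divides (a ℤ.* b) (lem a b q r)
  where
  lem : ∀ a b q r → a ℤ.* q ℤ.* (b ℤ.* r) ≡ a ℤ.* b ℤ.* (q ℤ.* r)
  lem = solve-∀

-- The indices i that a vertex of height 2 leaves possible for factors of degrees d and e.
data Position (d e i : ℕ) : Set where
  at-d   : i ≡ d → Position d e i
  at-e   : i ≡ e → Position d e i
  e-d    : i + d ≡ e → Position d e i
  d-e    : i + e ≡ d → Position d e i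
  double-d : i ≡ d + d → Position d e i
  double-e : i ≡ e + e → Position d e i
  halves : d ≡ e → ∀ s → i ≡ s + s → Position d e i

-- The Newton polygon of F G has vertices at 0, i and k = d + e, with heights 1, 0, 1
-- (respectively 2, 0, 2); only these vertices and the heights above them matter.
module Newton (q : ℤ) (q≢0 : q ≢ 0ℤ) (pr : Primeℤ q) (F G : Seq) {d e i : ℕ}
  (lF : Last 0ℤ F d) (lG : Last 0ℤ G e) (0<d : 0 < d) (0<e : 0 < e)
  (c∣ : ∀ j → j ≢ i → q ∣ℤ conv F G j) (c∤ : ¬ q ∣ℤ conv F G i) where

  private
    vanish : ∀ H {m} → Last 0ℤ H m → ∀ j → suc m ≤ j → H j ≡ 0ℤ
    vanish H l j m<j = 0∣⇒≡0 (proj₂ l j m<j)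

    notallF : ¬ (∀ j → q ∣ℤ F j)
    notallF h = c∤ (conv-∣ F G i λ a b _ → ∣⇒∣*ˡ _ _ (h a))

    notallG : ¬ (∀ j → q ∣ℤ G j)
    notallG h = c∤ (conv-∣ F G i λ a b _ → ∣⇒∣*ʳ (F a) _ (h b))

    fst-of : ∀ H {m} → Last 0ℤ H m → ¬ (∀ j → q ∣ℤ H j) → ∃ (First q H)
    fst-of H {m} l na with first-search q H (suc m) (vanish H l)
    ... | inj₁ x = x
    ... | inj₂ h = contradiction h na

    lst-of : ∀ H {m} → Last 0ℤ H m → ¬ (∀ j → q ∣ℤ H j) → ∃ (Last q H)
    lst-of H {m} l na with last-search q H (suc m) (λ j m<j → ≡0⇒∣ (vanish H l j m<j))
    ... | inj₁ x = x
    ... | inj₂ h = contradiction h na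

    at-i : ∀ m → ¬ q ∣ℤ conv F G m → m ≡ i
    at-i m h with m ≟ i
    ... | yes p = p
    ... | no np = contradiction (c∣ m np) h

    first≤last : ∀ H {m n} → First q H m → Last q H n → m ≤ n
    first≤last H {m} {n} (h , _) (_ , l) with m ≤? n
    ... | yes p = p
    ... | no np = contradiction (l m (≰⇒> np)) h

    Vertex : Set
    Vertex = ∃₂ λ s t → s + t ≡ i × ¬ q ∣ℤ F s × ¬ q ∣ℤ G t ×
      (∀ j → j ≢ s → q ∣ℤ F j) × (∀ j → j ≢ t → q ∣ℤ G j)

  -- The first indices of F and G not divisible by q add up to an index of the product not divisible
  -- by q, and so do the last ones. Since i is the only such index, first and last coincide in each
  -- factor.
  vertex : Vertex
  vertex = go (fst-of F lF notallF) (fst-of G lG notallG) (lst-of F lF notallF) (lst-of G lG notallG)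
   where
   go : ∃ (First q F) → ∃ (First q G) → ∃ (Last q F) → ∃ (Last q G) → Vertex
   go (s , fF) (t , fG) (s′ , lF′) (t′ , lG′) =
    s , t , e₁ , proj₁ fF , proj₁ fG , others F fF lF′ s≡s′ , others G fG lG′ t≡t′
    where
    e₁ : s + t ≡ i
    e₁ = at-i _ (first-conv F G pr fF fG)
    e₂ : s′ + t′ ≡ i
    e₂ = at-i _ (last-conv F G pr lF′ lG′)
    s≤s′ : s ≤ s′
    s≤s′ = first≤last F fF lF′
    t≤t′ : t ≤ t′
    t≤t′ = first≤last G fG lG′
    s≡s′ : s ≡ s′
    s≡s′ with ℕP.m≤n⇒m<n∨m≡n s≤s′
    ... | inj₂ x = x
    ... | inj₁ l = contradiction (trans e₁ (sym e₂)) (<⇒≢ (ℕP.+-mono-<-≤ l t≤t′))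
    t≡t′ : t ≡ t′
    t≡t′ = ℕP.+-cancelˡ-≡ s _ _ (trans e₁ (trans (sym e₂) (cong (_+ t′) (sym s≡s′))))
    others : ∀ H {m n} → First q H m → Last q H n → m ≡ n → ∀ j → j ≢ m → q ∣ℤ H j
    others H {m} f l refl j j≢ with ℕP.<-cmp j m
    ... | tri< a _ _ = proj₂ f j a
    ... | tri≈ _ b _ = contradiction b j≢
    ... | tri> _ _ c = proj₂ l j c

  private
    pos≢ : ∀ {s} → 0 < s → 0 ≢ s
    pos≢ () refl

    top : conv F G (d + e) ≡ F d ℤ.* G e
    top = ℤP.i-j≡0⇒i≡j _ _ (0∣⇒≡0 (last-pivot F G lF lG))

    s≤ : ∀ H {s m} → ¬ q ∣ℤ H s → Last 0ℤ H m → s ≤ m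
    s≤ H {s} {m} ¬h l with s ≤? m
    ... | yes p = p
    ... | no np = contradiction (≡0⇒∣ (vanish H l s (≰⇒> np))) ¬h

    zero-or-pos : ∀ m → m ≡ 0 ⊎ 0 < m
    zero-or-pos zero    = inj₁ refl
    zero-or-pos (suc m) = inj₂ (s≤s z≤n)

    eq-or-lt : ∀ {m n} → m ≤ n → m ≡ n ⊎ m < n
    eq-or-lt m≤n with ℕP.m≤n⇒m<n∨m≡n m≤n
    ... | inj₁ x = inj₂ x
    ... | inj₂ y = inj₁ y

  -- An edge of height 1 cannot be shared: if s and t were both positive, q would divide both
  -- constant terms and q² the constant term of the product. At the other end the leading
  -- coefficients force s = d or t = e in the same way.
  newton₁ : ¬ q ℤ.* q ∣ℤ conv F G 0 → ¬ q ℤ.* q ∣ℤ conv F G (d + e) → i ≡ d ⊎ i ≡ e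
  newton₁ c₀ cₖ = go vertex
    where
    go : Vertex → i ≡ d ⊎ i ≡ e
    go (s , t , st , ¬s , ¬t , oF , oG) = combine bottom top-edge
      where
      bottom : s ≡ 0 ⊎ t ≡ 0
      bottom = case (zero-or-pos s) (zero-or-pos t)
        where
        case : s ≡ 0 ⊎ 0 < s → t ≡ 0 ⊎ 0 < t → s ≡ 0 ⊎ t ≡ 0
        case (inj₁ z) _ = inj₁ z
        case _ (inj₁ z) = inj₂ z
        case (inj₂ 0<s) (inj₂ 0<t) =
          contradiction (*-∣-* (oF 0 (pos≢ 0<s)) (oG 0 (pos≢ 0<t))) c₀
      top-edge : s ≡ d ⊎ t ≡ e
      top-edge = case (eq-or-lt (s≤ F ¬s lF)) (eq-or-lt (s≤ G ¬t lG))
        where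
        case : s ≡ d ⊎ s < d → t ≡ e ⊎ t < e → s ≡ d ⊎ t ≡ e
        case (inj₁ z) _ = inj₁ z
        case _ (inj₁ z) = inj₂ z
        case (inj₂ s<d) (inj₂ t<e) = contradiction (subst (q ℤ.* q ∣ℤ_) (sym top)
          (*-∣-* (oF d (>⇒≢ s<d)) (oG e (>⇒≢ t<e)))) cₖ
      combine : s ≡ 0 ⊎ t ≡ 0 → s ≡ d ⊎ t ≡ e → i ≡ d ⊎ i ≡ e
      combine (inj₁ s0) (inj₁ sd) = contradiction (trans (sym s0) sd) (pos≢ 0<d)
      combine (inj₁ s0) (inj₂ te) = inj₂ (trans (sym st) (cong₂ _+_ s0 te))
      combine (inj₂ t0) (inj₁ sd) =
        inj₁ (trans (sym st) (trans (cong₂ _+_ sd t0) (+-identityʳ d)))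
      combine (inj₂ t0) (inj₂ te) = contradiction (trans (sym t0) te) (pos≢ 0<e)

  -- An edge of height 2 is either left to one factor or shared equally. If 0 < s < t, then modulo
  -- q² the coefficient of index s is `F s ℤ.* G 0`, because in every other term both factors are
  -- divisible by q. Hence q² divides `G 0`, and with q dividing `F 0` the constant term is
  -- divisible by q³. So s = t unless one of them is 0; at the other end, likewise, d - s = e - t
  -- unless one of these is 0.
  newton₂ : (∀ j → j ≢ i → q ℤ.* q ∣ℤ conv F G j) →
    ¬ q ℤ.* (q ℤ.* q) ∣ℤ conv F G 0 → ¬ q ℤ.* (q ℤ.* q) ∣ℤ conv F G (d + e) →
    Position d e i
  newton₂ c² c₀ cₖ = go vertex
    where
    q³ : ∀ {x y} → q ∣ℤ x → q ℤ.* q ∣ℤ y → q ℤ.* (q ℤ.* q) ∣ℤ x ℤ.* y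
    q³ = *-∣-*
    q³′ : ∀ {x y} → q ℤ.* q ∣ℤ x → q ∣ℤ y → q ℤ.* (q ℤ.* q) ∣ℤ x ℤ.* y
    q³′ {x} {y} hx hy = subst (_ ∣ℤ_) (ℤP.*-comm y x) (*-∣-* hy hx)

    go : Vertex → Position d e i
    go (s , t , st , ¬s , ¬t , oF , oG) = combine bottom top-edge
      where
      bottom : s ≡ 0 ⊎ t ≡ 0 ⊎ s ≡ t
      bottom = case (zero-or-pos s) (zero-or-pos t) (ℕP.<-cmp s t)
        where
        case : s ≡ 0 ⊎ 0 < s → t ≡ 0 ⊎ 0 < t → Tri (s < t) (s ≡ t) (t < s) → s ≡ 0 ⊎ t ≡ 0 ⊎ s ≡ t
        case (inj₁ z) _ _ = inj₁ z
        case _ (inj₁ z) _ = inj₂ (inj₁ z)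
        case _ _ (tri≈ _ z _) = inj₂ (inj₂ z)
        case (inj₂ 0<s) (inj₂ 0<t) (tri< s<t _ _) =
          contradiction (q³ (oF 0 (pos≢ 0<s)) G0) c₀
          where
          others : ∀ a b → a + b ≡ s → a ≢ s → q ℤ.* q ∣ℤ F a ℤ.* G b
          others a b a+b a≢ =
            *-∣-* (oF a a≢) (oG b (<⇒≢ (≤-<-trans (subst (b ≤_) a+b (ℕP.m≤n+m b a)) s<t)))
          G0 : q ℤ.* q ∣ℤ G 0
          G0 = ∣-square-cancelˡ (F s) (G 0) q≢0 pr ¬s
            (∣-pivot (conv-pivot F G s s 0 (+-identityʳ s) others)
              (c² s λ s≡i → <⇒≢ (ℕP.m<m+n s 0<t) (trans s≡i (sym st))))
        case (inj₂ 0<s) (inj₂ 0<t) (tri> _ _ t<s) =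
          contradiction (q³′ F0 (oG 0 (pos≢ 0<t))) c₀
          where
          others : ∀ a b → a + b ≡ t → a ≢ 0 → q ℤ.* q ∣ℤ F a ℤ.* G b
          others a b a+b a≢ =
            *-∣-* (oF a (<⇒≢ (≤-<-trans (subst (a ≤_) a+b (m≤m+n a b)) t<s)))
                  (oG b λ b≡t → a≢ (ℕP.+-cancelʳ-≡ b a 0 (trans a+b (sym b≡t))))
          F0 : q ℤ.* q ∣ℤ F 0
          F0 = ∣-square-cancelʳ (F 0) (G t) q≢0 pr ¬t
            (∣-pivot (conv-pivot F G t 0 t refl others)
              (c² t λ t≡i → <⇒≢ (ℕP.m<n+m t 0<s) (trans t≡i (sym st))))

      top-edge : s ≡ d ⊎ t ≡ e ⊎ d + t ≡ s + e
      top-edge = case (eq-or-lt (s≤ F ¬s lF)) (eq-or-lt (s≤ G ¬t lG)) (ℕP.<-cmp (d + t) (s + e))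
        where
        case : s ≡ d ⊎ s < d → t ≡ e ⊎ t < e →
          Tri (d + t < s + e) (d + t ≡ s + e) (s + e < d + t) → s ≡ d ⊎ t ≡ e ⊎ d + t ≡ s + e
        case (inj₁ z) _ _ = inj₁ z
        case _ (inj₁ z) _ = inj₂ (inj₁ z)
        case _ _ (tri≈ _ z _) = inj₂ (inj₂ z)
        case (inj₂ s<d) (inj₂ t<e) (tri< lt _ _) =
          contradiction (subst (_ ∣ℤ_) (sym top) (q³ (oF d (>⇒≢ s<d)) Ge)) cₖ
          where
          others : ∀ a b → a + b ≡ s + e → a ≢ s → q ℤ.* q ∣ℤ F a ℤ.* G b
          -- Beyond the degree d the coefficients vanish; for a ≤ d the index b cannot be t, since d
          -- + t < s + e.
          others a b a+b a≢ with a ≤? d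
          ... | no a≰ = ∣⇒∣*ˡ _ _ (≡0⇒∣ (vanish F lF a (≰⇒> a≰)))
          ... | yes a≤ = *-∣-* (oF a a≢) (oG b λ b≡t →
                  contradiction a+b (<⇒≢ (≤-<-trans (ℕP.+-mono-≤ a≤ (ℕP.≤-reflexive b≡t)) lt)))
          Ge : q ℤ.* q ∣ℤ G e
          Ge = ∣-square-cancelˡ (F s) (G e) q≢0 pr ¬s
            (∣-pivot (conv-pivot F G (s + e) s e refl others)
              (c² (s + e) λ h → >⇒≢ (ℕP.+-monoʳ-< s t<e) (trans h (sym st))))
        case (inj₂ s<d) (inj₂ t<e) (tri> _ _ gt) =
          contradiction (subst (_ ∣ℤ_) (sym top) (q³′ Fd (oG e (>⇒≢ t<e)))) cₖ
          where
          others : ∀ a b → a + b ≡ d + t → a ≢ d → q ℤ.* q ∣ℤ F a ℤ.* G b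
          others a b a+b a≢ with b ≤? e
          ... | no b≰ = ∣⇒∣*ʳ (F a) _ (≡0⇒∣ (vanish G lG b (≰⇒> b≰)))
          ... | yes b≤ = *-∣-*
                  (oF a λ a≡s →
                    contradiction a+b (<⇒≢ (≤-<-trans (ℕP.+-mono-≤ (ℕP.≤-reflexive a≡s) b≤) gt)))
                  (oG b λ b≡t → a≢ (ℕP.+-cancelʳ-≡ b a d (trans a+b (cong (d +_) (sym b≡t)))))
          Fd : q ℤ.* q ∣ℤ F d
          Fd = ∣-square-cancelʳ (F d) (G t) q≢0 pr ¬t
            (∣-pivot (conv-pivot F G (d + t) d t refl others)
              (c² (d + t) λ h → >⇒≢ (ℕP.+-monoˡ-< t s<d) (trans h (sym st))))

      combine : s ≡ 0 ⊎ t ≡ 0 ⊎ s ≡ t → s ≡ d ⊎ t ≡ e ⊎ d + t ≡ s + e → Position d e i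
      combine (inj₁ s0) (inj₁ sd) = contradiction (trans (sym s0) sd) (pos≢ 0<d)
      combine (inj₁ s0) (inj₂ (inj₁ te)) = at-e (trans (sym st) (cong₂ _+_ s0 te))
      combine (inj₁ s0) (inj₂ (inj₂ h)) = e-d (trans (cong (_+ d) (trans (sym st) (cong (_+ t) s0)))
        (trans (+-comm t d) (trans h (cong (_+ e) s0))))
      combine (inj₂ (inj₁ t0)) (inj₁ sd) =
        at-d (trans (sym st) (trans (cong₂ _+_ sd t0) (+-identityʳ d)))
      combine (inj₂ (inj₁ t0)) (inj₂ (inj₁ te)) = contradiction (trans (sym t0) te) (pos≢ 0<e)
      combine (inj₂ (inj₁ t0)) (inj₂ (inj₂ h)) = d-e
        (trans (cong (_+ e) (trans (sym st) (trans (cong (s +_) t0) (+-identityʳ s))))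
          (trans (sym h) (trans (cong (d +_) t0) (+-identityʳ d))))
      combine (inj₂ (inj₂ s≡t)) (inj₁ sd) =
        double-d (trans (sym st) (cong₂ _+_ sd (trans (sym s≡t) sd)))
      combine (inj₂ (inj₂ s≡t)) (inj₂ (inj₁ te)) =
        double-e (trans (sym st) (cong₂ _+_ (trans s≡t te) te))
      combine (inj₂ (inj₂ s≡t)) (inj₂ (inj₂ h)) = halves
        (ℕP.+-cancelʳ-≡ t d e (trans h (trans (+-comm s e) (cong (e +_) s≡t))))
        s (trans (sym st) (cong (s +_) (sym s≡t)))

-- The expansion in powers of x + 1

-- `co`, `addZ` and `mulZ` copy the recursions of `coeff`, `addP` and `mulP`, so that the embedding
-- of ℤ in ℚ carries one triple to the other by plain induction.
co : List ℤ → Seq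
co []      _       = 0ℤ
co (a ∷ p) zero    = a
co (a ∷ p) (suc j) = co p j

addZ : List ℤ → List ℤ → List ℤ
addZ []      q       = q
addZ p       []      = p
addZ (a ∷ p) (b ∷ q) = (a ℤ.+ b) ∷ addZ p q

mulZ : List ℤ → List ℤ → List ℤ
mulZ []      q = []
mulZ (a ∷ p) q = addZ (map (a ℤ.*_) q) (0ℤ ∷ mulZ p q)

co-add : ∀ p q j → co (addZ p q) j ≡ co p j ℤ.+ co q j
co-add []      q       j       = sym (ℤP.+-identityˡ _)
co-add (a ∷ p) []      j       = sym (ℤP.+-identityʳ _)
co-add (a ∷ p) (b ∷ q) zero    = refl
co-add (a ∷ p) (b ∷ q) (suc j) = co-add p q j

co-scale : ∀ a q j → co (map (a ℤ.*_) q) j ≡ a ℤ.* co q j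
co-scale a []      j       = sym (ℤP.*-zeroʳ a)
co-scale a (b ∷ q) zero    = refl
co-scale a (b ∷ q) (suc j) = co-scale a q j

co-length : ∀ p j → length p ≤ j → co p j ≡ 0ℤ
co-length []      j       _       = refl
co-length (a ∷ p) (suc j) (s≤s h) = co-length p j h

conv-0 : ∀ g m → conv (λ _ → 0ℤ) g m ≡ 0ℤ
conv-0 g zero    = refl
conv-0 g (suc m) = trans (ℤP.+-identityˡ _) (conv-0 g m)

conv-sub : ∀ u v w m → conv (λ j → u j ℤ.- v j) w m ≡ conv u w m ℤ.- conv v w m
conv-sub u v w zero    = lem (u 0) (v 0) (w 0)
  where
  lem : ∀ a b c → (a ℤ.- b) ℤ.* c ≡ a ℤ.* c ℤ.- b ℤ.* c
  lem = solve-∀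
conv-sub u v w (suc m) =
  trans (cong (λ z → (u 0 ℤ.- v 0) ℤ.* w (suc m) ℤ.+ z) (conv-sub (u ∘ suc) (v ∘ suc) w m))
    (lem (u 0) (v 0) (w (suc m)) (conv (u ∘ suc) w m) (conv (v ∘ suc) w m))
  where
  lem : ∀ a b c x y → (a ℤ.- b) ℤ.* c ℤ.+ (x ℤ.- y) ≡ a ℤ.* c ℤ.+ x ℤ.- (b ℤ.* c ℤ.+ y)
  lem = solve-∀

conv-co : ∀ p q m → conv (co p) (co q) m ≡ co (mulZ p q) m
conv-co []      q m       = conv-0 (co q) m
conv-co (a ∷ p) q zero    = sym (trans (co-add (map (a ℤ.*_) q) (0ℤ ∷ mulZ p q) 0)
  (trans (ℤP.+-identityʳ _) (co-scale a q 0)))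
conv-co (a ∷ p) q (suc m) = sym (trans (co-add (map (a ℤ.*_) q) (0ℤ ∷ mulZ p q) (suc m))
  (cong₂ ℤ._+_ (co-scale a q (suc m)) (sym (conv-co p q m))))

-- The coefficients of p(x - 1).
shift : List ℤ → Seq
shift []      _       = 0ℤ
shift (a ∷ p) zero    = a ℤ.- shift p 0
shift (a ∷ p) (suc j) = shift p j ℤ.- shift p (suc j)

sub-add : ∀ a b x y → a ℤ.+ b ℤ.- (x ℤ.+ y) ≡ a ℤ.- x ℤ.+ (b ℤ.- y)
sub-add = solve-∀

shift-add : ∀ p q j → shift (addZ p q) j ≡ shift p j ℤ.+ shift q j
shift-add []      q       j       = sym (ℤP.+-identityˡ _)
shift-add (a ∷ p) []      j       = sym (ℤP.+-identityʳ _)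
shift-add (a ∷ p) (b ∷ q) zero    =
  trans (cong (λ z → (a ℤ.+ b) ℤ.- z) (shift-add p q 0)) (sub-add a b (shift p 0) (shift q 0))
shift-add (a ∷ p) (b ∷ q) (suc j) =
  trans (cong₂ ℤ._-_ (shift-add p q j) (shift-add p q (suc j)))
    (sub-add (shift p j) (shift q j) (shift p (suc j)) (shift q (suc j)))

*-sub : ∀ a b x → a ℤ.* b ℤ.- a ℤ.* x ≡ a ℤ.* (b ℤ.- x)
*-sub = solve-∀

shift-scale : ∀ a q j → shift (map (a ℤ.*_) q) j ≡ a ℤ.* shift q j
shift-scale a []      j       = sym (ℤP.*-zeroʳ a)
shift-scale a (b ∷ q) zero    =
  trans (cong (λ z → a ℤ.* b ℤ.- z) (shift-scale a q 0)) (*-sub a b (shift q 0))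
shift-scale a (b ∷ q) (suc j) =
  trans (cong₂ ℤ._-_ (shift-scale a q j) (shift-scale a q (suc j))) (*-sub a (shift q j) (shift q (suc j)))

-- The substitution turns a + x p(x) into a + (x - 1) p(x - 1), which is the recursion of `shift`;
-- the induction distributes the factor x - 1 over the convolution.
conv-shift : ∀ p q m → conv (shift p) (shift q) m ≡ shift (mulZ p q) m
conv-shift []      q m       = conv-0 (shift q) m
conv-shift (a ∷ p) q zero    = sym (begin
  shift (addZ (map (a ℤ.*_) q) (0ℤ ∷ mulZ p q)) 0
    ≡⟨ shift-add (map (a ℤ.*_) q) (0ℤ ∷ mulZ p q) 0 ⟩
  shift (map (a ℤ.*_) q) 0 ℤ.+ (0ℤ ℤ.- shift (mulZ p q) 0)
    ≡⟨ cong₂ (λ x y → x ℤ.+ (0ℤ ℤ.- y)) (shift-scale a q 0) (sym (conv-shift p q 0)) ⟩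
  a ℤ.* shift q 0 ℤ.+ (0ℤ ℤ.- shift p 0 ℤ.* shift q 0)
    ≡⟨ lem a (shift p 0) (shift q 0) ⟩
  (a ℤ.- shift p 0) ℤ.* shift q 0 ∎)
  where
  open ≡-Reasoning
  lem : ∀ a u v → a ℤ.* v ℤ.+ (0ℤ ℤ.- u ℤ.* v) ≡ (a ℤ.- u) ℤ.* v
  lem = solve-∀
conv-shift (a ∷ p) q (suc m) = sym (begin
  shift (addZ (map (a ℤ.*_) q) (0ℤ ∷ mulZ p q)) (suc m)
    ≡⟨ shift-add (map (a ℤ.*_) q) (0ℤ ∷ mulZ p q) (suc m) ⟩
  shift (map (a ℤ.*_) q) (suc m) ℤ.+ (shift (mulZ p q) m ℤ.- shift (mulZ p q) (suc m))
    ≡⟨ cong₂ ℤ._+_ (shift-scale a q (suc m))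
         (sym (cong₂ ℤ._-_ (conv-shift p q m) (conv-shift p q (suc m)))) ⟩
  a ℤ.* v (suc m) ℤ.+ (conv u v m ℤ.- (u 0 ℤ.* v (suc m) ℤ.+ conv (u ∘ suc) v m))
    ≡⟨ lem a (u 0) (v (suc m)) (conv u v m) (conv (u ∘ suc) v m) ⟩
  (a ℤ.- u 0) ℤ.* v (suc m) ℤ.+ (conv u v m ℤ.- conv (u ∘ suc) v m)
    ≡⟨ cong (λ z → (a ℤ.- u 0) ℤ.* v (suc m) ℤ.+ z) (sym (conv-sub u (u ∘ suc) v m)) ⟩
  conv (shift (a ∷ p)) v (suc m) ∎)
  where
  open ≡-Reasoning
  u = shift p
  v = shift q
  lem : ∀ a u v x y → a ℤ.* v ℤ.+ (x ℤ.- (u ℤ.* v ℤ.+ y)) ≡ (a ℤ.- u) ℤ.* v ℤ.+ (x ℤ.- y)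
  lem = solve-∀

shift-vanish : ∀ p j → (∀ m → j ≤ m → co p m ≡ 0ℤ) → ∀ m → j ≤ m → shift p m ≡ 0ℤ
shift-vanish []      j z m       h = refl
shift-vanish (a ∷ p) j z zero    z≤n =
  cong₂ ℤ._-_ (z 0 z≤n) (shift-vanish p 0 (λ m _ → z (suc m) z≤n) 0 z≤n)
shift-vanish (a ∷ p) zero z (suc m) h = cong₂ ℤ._-_ (all m) (all (suc m))
  where
  all : ∀ m → shift p m ≡ 0ℤ
  all m = shift-vanish p 0 (λ m _ → z (suc m) z≤n) m z≤n
shift-vanish (a ∷ p) (suc j) z (suc m) (s≤s h) =
  cong₂ ℤ._-_ (rec m h) (rec (suc m) (ℕP.m≤n⇒m≤1+n h))
  where
  rec : ∀ m → j ≤ m → shift p m ≡ 0ℤ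
  rec = shift-vanish p j λ m h′ → z (suc m) (s≤s h′)

shift-top : ∀ p d → (∀ m → d < m → co p m ≡ 0ℤ) → shift p d ≡ co p d
shift-top []      d       z = refl
shift-top (a ∷ p) zero    z =
  trans (cong (λ z → a ℤ.- z) (shift-vanish p 0 (λ m _ → z (suc m) (s≤s z≤n)) 0 z≤n)) (ℤP.+-identityʳ a)
shift-top (a ∷ p) (suc d) z =
  trans (cong₂ ℤ._-_ (shift-top p d λ m h → z (suc m) (s≤s h))
          (shift-vanish p (suc d) (λ m h → z (suc m) (s≤s h)) (suc d) ≤-refl))
    (ℤP.+-identityʳ _)

shift-last : ∀ p {d} → Last 0ℤ (co p) d → Last 0ℤ (shift p) d
shift-last p {d} (h , l) =
  (λ x → h (subst (0ℤ ∣ℤ_) (shift-top p d z) x)) ,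
  (λ j d<j → ≡0⇒∣ (shift-vanish p (suc d) z j d<j))
  where
  z : ∀ m → d < m → co p m ≡ 0ℤ
  z m d<m = 0∣⇒≡0 (l m d<m)

-- The coefficients of (x - 1)^m.
signedBinomial : ℕ → Seq
signedBinomial zero    zero    = 1ℤ
signedBinomial zero    (suc j) = 0ℤ
signedBinomial (suc m) zero    = ℤ.- signedBinomial m 0
signedBinomial (suc m) (suc j) = signedBinomial m j ℤ.- signedBinomial m (suc j)

shift-∷ʳ : ∀ p c j → shift (p ∷ʳ c) j ≡ shift p j ℤ.+ c ℤ.* signedBinomial (length p) j
shift-∷ʳ []      c zero    = lem c
  where
  lem : ∀ c → c ℤ.- 0ℤ ≡ 0ℤ ℤ.+ c ℤ.* 1ℤ
  lem = solve-∀
shift-∷ʳ []      c (suc j) = sym (trans (ℤP.+-identityˡ _) (ℤP.*-zeroʳ c))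
shift-∷ʳ (a ∷ p) c zero    =
  trans (cong (λ z → a ℤ.- z) (shift-∷ʳ p c 0)) (lem a (shift p 0) c (signedBinomial (length p) 0))
  where
  lem : ∀ a u c b → a ℤ.- (u ℤ.+ c ℤ.* b) ≡ a ℤ.- u ℤ.+ c ℤ.* ℤ.- b
  lem = solve-∀
shift-∷ʳ (a ∷ p) c (suc j) =
  trans (cong₂ ℤ._-_ (shift-∷ʳ p c j) (shift-∷ʳ p c (suc j)))
    (lem (shift p j) (shift p (suc j)) c (signedBinomial (length p) j) (signedBinomial (length p) (suc j)))
  where
  lem : ∀ u v c x y → u ℤ.+ c ℤ.* x ℤ.- (v ℤ.+ c ℤ.* y) ≡ u ℤ.- v ℤ.+ c ℤ.* (x ℤ.- y)
  lem = solve-∀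

signedBinomial-absorb : ∀ m j →
  (pos (suc m) ℤ.- pos j) ℤ.* signedBinomial (suc m) j ≡ ℤ.- (pos (suc m) ℤ.* signedBinomial m j)
signedBinomial-absorb m zero = lem (pos (suc m)) (signedBinomial m 0)
  where
  lem : ∀ a b → (a ℤ.- 0ℤ) ℤ.* ℤ.- b ≡ ℤ.- (a ℤ.* b)
  lem = solve-∀
signedBinomial-absorb zero (suc zero)    = refl
signedBinomial-absorb zero (suc (suc j)) = ℤP.*-zeroʳ (pos 1 ℤ.- pos (suc (suc j)))
signedBinomial-absorb (suc m) (suc j) = begin
  (pos (suc (suc m)) ℤ.- pos (suc j)) ℤ.* (u ℤ.- v)
    ≡⟨ lem₁ (pos (suc m)) (pos j) u v ⟩
  (pos (suc m) ℤ.- pos j) ℤ.* u ℤ.- (pos (suc m) ℤ.- pos (suc j)) ℤ.* v ℤ.- v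
    ≡⟨ cong₂ (λ x y → x ℤ.- y ℤ.- v) (signedBinomial-absorb m j) (signedBinomial-absorb m (suc j)) ⟩
  ℤ.- (pos (suc m) ℤ.* s) ℤ.- ℤ.- (pos (suc m) ℤ.* t) ℤ.- (s ℤ.- t)
    ≡⟨ lem₂ (pos (suc m)) s t ⟩
  ℤ.- (pos (suc (suc m)) ℤ.* (s ℤ.- t)) ∎
  where
  open ≡-Reasoning
  u = signedBinomial (suc m) j
  v = signedBinomial (suc m) (suc j)
  s = signedBinomial m j
  t = signedBinomial m (suc j)
  lem₁ : ∀ a b u v → (1ℤ ℤ.+ a ℤ.- (1ℤ ℤ.+ b)) ℤ.* (u ℤ.- v) ≡
    (a ℤ.- b) ℤ.* u ℤ.- (a ℤ.- (1ℤ ℤ.+ b)) ℤ.* v ℤ.- v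
  lem₁ = solve-∀
  lem₂ : ∀ a s t → ℤ.- (a ℤ.* s) ℤ.- ℤ.- (a ℤ.* t) ℤ.- (s ℤ.- t) ≡ ℤ.- ((1ℤ ℤ.+ a) ℤ.* (s ℤ.- t))
  lem₂ = solve-∀

signedBinomial-top : ∀ m → signedBinomial m m ≡ 1ℤ
signedBinomial-high : ∀ m j → m < j → signedBinomial m j ≡ 0ℤ
signedBinomial-top zero    = refl
signedBinomial-top (suc m) =
  cong₂ ℤ._-_ (signedBinomial-top m) (signedBinomial-high m (suc m) ≤-refl)
signedBinomial-high zero    (suc j) _       = refl
signedBinomial-high (suc m) (suc j) (s≤s h) =
  cong₂ ℤ._-_ (signedBinomial-high m j h) (signedBinomial-high m (suc j) (ℕP.m≤n⇒m≤1+n h))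

-- This is (k + 1) C(n,k+1) = (n - k) C(n,k), written as a sum so that truncated subtraction does
-- not get in the way when k > n.
C-absorb : ∀ n k → suc k * (n C suc k) + k * (n C k) ≡ n * (n C k)
C-absorb zero zero       = refl
C-absorb zero (suc k)    = trans (cong₂ _+_ (ℕP.*-zeroʳ k) (ℕP.*-zeroʳ k)) refl
C-absorb (suc n) zero    = begin
  1 * (suc n C 1) + 0 ≡⟨ cong (λ x → 1 * x + 0) (sym (nCk+nC[k+1]≡[n+1]C[k+1] n 0)) ⟩
  1 * (1 + n C 1) + 0 ≡⟨ lem (n C 1) ⟩
  1 + (1 * (n C 1) + 0 * 1) ≡⟨ cong suc (C-absorb n 0) ⟩
  suc n * 1 ∎
  where
  open ≡-Reasoning
  lem : ∀ x → 1 * (1 + x) + 0 ≡ 1 + (1 * x + 0 * 1)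
  lem = solveℕ-∀
C-absorb (suc n) (suc k) = begin
  suc (suc k) * (suc n C suc (suc k)) + suc k * (suc n C suc k)
    ≡⟨ sym (cong₂ (λ u v → suc (suc k) * u + suc k * v)
         (nCk+nC[k+1]≡[n+1]C[k+1] n (suc k)) (nCk+nC[k+1]≡[n+1]C[k+1] n k)) ⟩
  suc (suc k) * (y + z) + suc k * (x + y)
    ≡⟨ lem₁ k x y z ⟩
  (suc (suc k) * z + suc k * y) + (suc k * y + k * x) + (x + y)
    ≡⟨ cong₂ (λ u v → u + v + (x + y)) (C-absorb n (suc k)) (C-absorb n k) ⟩
  n * y + n * x + (x + y)
    ≡⟨ lem₂ n x y ⟩
  suc n * (x + y)
    ≡⟨ cong (suc n *_) (nCk+nC[k+1]≡[n+1]C[k+1] n k) ⟩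
  suc n * (suc n C suc k) ∎
  where
  open ≡-Reasoning
  x = n C k
  y = n C suc k
  z = n C suc (suc k)
  lem₁ : ∀ k x y z → suc (suc k) * (y + z) + suc k * (x + y) ≡
    (suc (suc k) * z + suc k * y) + (suc k * y + k * x) + (x + y)
  lem₁ = solveℕ-∀
  lem₂ : ∀ n x y → n * y + n * x + (x + y) ≡ suc n * (x + y)
  lem₂ = solveℕ-∀

C-absorbℤ : ∀ n k → pos (suc k) ℤ.* pos (n C suc k) ≡ (pos n ℤ.- pos k) ℤ.* pos (n C k)
C-absorbℤ n k = trans (lem₁ (pos (suc k) ℤ.* pos (n C suc k)) (pos k ℤ.* pos (n C k)))
  (trans (cong (λ z → z ℤ.- pos k ℤ.* pos (n C k)) eq) (lem₂ (pos n) (pos k) (pos (n C k))))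
  where
  eq : pos (suc k) ℤ.* pos (n C suc k) ℤ.+ pos k ℤ.* pos (n C k) ≡ pos n ℤ.* pos (n C k)
  eq = trans (cong₂ ℤ._+_ (sym (ℤP.pos-* (suc k) (n C suc k))) (sym (ℤP.pos-* k (n C k))))
    (trans (sym (ℤP.pos-+ (suc k * (n C suc k)) (k * (n C k))))
      (trans (cong pos (C-absorb n k)) (ℤP.pos-* n (n C k))))
  lem₁ : ∀ x y → x ≡ x ℤ.+ y ℤ.- y
  lem₁ = solve-∀
  lem₂ : ∀ n k c → n ℤ.* c ℤ.- k ℤ.* c ≡ (n ℤ.- k) ℤ.* c
  lem₂ = solve-∀

truncated : ℕ → ℕ → List ℤ
truncated n k = map (λ j → pos (n C j)) (upTo (suc k))

truncated-suc : ∀ n k → truncated n (suc k) ≡ truncated n k ∷ʳ pos (n C suc k)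
truncated-suc n k =
  trans (cong (map _) (sym (ListP.upTo-∷ʳ (suc k)))) (ListP.map-++ _ (upTo (suc k)) (suc k ∷ []))

truncated-length : ∀ n k → length (truncated n k) ≡ suc k
truncated-length n k = trans (ListP.length-map _ (upTo (suc k))) (ListP.length-upTo (suc k))

-- With y = x + 1 the identity (1 + x) P′ = n P - (n - k) C(n,k) x^k turns into
-- y Q′ = n Q - (n - k) C(n,k) (y - 1)^k, i.e. a formula for each coefficient of Q.
shift-truncated : ∀ n k j → (pos n ℤ.- pos j) ℤ.* shift (truncated n k) j ≡
  (pos n ℤ.- pos k) ℤ.* pos (n C k) ℤ.* signedBinomial k j
shift-truncated n zero zero    = sym (ℤP.*-identityʳ _)
shift-truncated n zero (suc j) =
  trans (ℤP.*-zeroʳ (pos n ℤ.- pos (suc j))) (sym (ℤP.*-zeroʳ ((pos n ℤ.- 0ℤ) ℤ.* 1ℤ)))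
shift-truncated n (suc k) j = begin
  (N ℤ.- J) ℤ.* shift (truncated n (suc k)) j
    ≡⟨ cong (λ p → (N ℤ.- J) ℤ.* shift p j) (truncated-suc n k) ⟩
  (N ℤ.- J) ℤ.* shift (truncated n k ∷ʳ c) j
    ≡⟨ cong ((N ℤ.- J) ℤ.*_) (shift-∷ʳ (truncated n k) c j) ⟩
  (N ℤ.- J) ℤ.* (shift (truncated n k) j ℤ.+ c ℤ.* signedBinomial (length (truncated n k)) j)
    ≡⟨ cong (λ l → (N ℤ.- J) ℤ.* (shift (truncated n k) j ℤ.+ c ℤ.* signedBinomial l j)) (truncated-length n k) ⟩
  (N ℤ.- J) ℤ.* (shift (truncated n k) j ℤ.+ c ℤ.* b)
    ≡⟨ lem₁ (N ℤ.- J) (shift (truncated n k) j) c b ⟩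
  (N ℤ.- J) ℤ.* shift (truncated n k) j ℤ.+ (N ℤ.- J) ℤ.* (c ℤ.* b)
    ≡⟨ cong (λ z → z ℤ.+ (N ℤ.- J) ℤ.* (c ℤ.* b)) (shift-truncated n k j) ⟩
  (N ℤ.- K) ℤ.* pos (n C k) ℤ.* a ℤ.+ (N ℤ.- J) ℤ.* (c ℤ.* b)
    ≡⟨ cong (λ x → x ℤ.* a ℤ.+ (N ℤ.- J) ℤ.* (c ℤ.* b)) (sym (C-absorbℤ n k)) ⟩
  pos (suc k) ℤ.* c ℤ.* a ℤ.+ (N ℤ.- J) ℤ.* (c ℤ.* b)
    ≡⟨ lem₂ (pos (suc k)) c a ((N ℤ.- J) ℤ.* (c ℤ.* b)) ⟩
  (N ℤ.- J) ℤ.* (c ℤ.* b) ℤ.- c ℤ.* ℤ.- (pos (suc k) ℤ.* a)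
    ≡⟨ cong (λ x → (N ℤ.- J) ℤ.* (c ℤ.* b) ℤ.- c ℤ.* x) (sym (signedBinomial-absorb k j)) ⟩
  (N ℤ.- J) ℤ.* (c ℤ.* b) ℤ.- c ℤ.* ((pos (suc k) ℤ.- J) ℤ.* b)
    ≡⟨ lem₃ N J (pos (suc k)) b c ⟩
  (N ℤ.- pos (suc k)) ℤ.* c ℤ.* b ∎
  where
  open ≡-Reasoning
  N = pos n
  J = pos j
  K = pos k
  c = pos (n C suc k)
  a = signedBinomial k j
  b = signedBinomial (suc k) j
  lem₁ : ∀ d s c b → d ℤ.* (s ℤ.+ c ℤ.* b) ≡ d ℤ.* s ℤ.+ d ℤ.* (c ℤ.* b)
  lem₁ = solve-∀
  lem₂ : ∀ k c a t → k ℤ.* c ℤ.* a ℤ.+ t ≡ t ℤ.- c ℤ.* ℤ.- (k ℤ.* a)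
  lem₂ = solve-∀
  lem₃ : ∀ n j k b c → (n ℤ.- j) ℤ.* (c ℤ.* b) ℤ.- c ℤ.* ((k ℤ.- j) ℤ.* b) ≡ (n ℤ.- k) ℤ.* c ℤ.* b
  lem₃ = solve-∀

shift-cong : ∀ p q → (∀ j → co p j ≡ co q j) → ∀ j → shift p j ≡ shift q j
shift-cong []      q       h j =
  sym (shift-vanish q 0 (λ m _ → sym (h m)) j z≤n)
shift-cong (a ∷ p) []      h j = shift-vanish (a ∷ p) 0 (λ m _ → h m) j z≤n
shift-cong (a ∷ p) (b ∷ q) h zero    =
  cong₂ ℤ._-_ (h 0) (shift-cong p q (λ j → h (suc j)) 0)
shift-cong (a ∷ p) (b ∷ q) h (suc j) =
  cong₂ ℤ._-_ (shift-cong p q (λ j → h (suc j)) j) (shift-cong p q (λ j → h (suc j)) (suc j))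

pos-∣ : ∀ {m n} → m ∣ n → pos m ∣ℤ pos n
pos-∣ = ℤ∣.∣ᵤ⇒∣

pos-∣⁻¹ : ∀ {m n} → pos m ∣ℤ pos n → m ∣ n
pos-∣⁻¹ = ℤ∣.∣⇒∣ᵤ

prime⇒primeℤ : ∀ {p} → Prime p → Primeℤ (pos p)
prime⇒primeℤ {p} pr x y h with
  euclidsLemma ℤ.∣ x ∣ ℤ.∣ y ∣ pr (subst (p ∣_) (ℤP.abs-* x y) (ℤ∣.∣⇒∣ᵤ h))
... | inj₁ d = inj₁ (ℤ∣.∣ᵤ⇒∣ d)
... | inj₂ d = inj₂ (ℤ∣.∣ᵤ⇒∣ d)

prime≢0 : ∀ {p} → Prime p → p ≢ 0
prime≢0 pr refl = ℕ.≢-nonZero⁻¹ 0 ⦃ prime⇒nonZero pr ⦄ refl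

prime>1 : ∀ {p} → Prime p → 1 < p
prime>1 {p} pr = ℕ.nonTrivial⇒n>1 p ⦃ prime⇒nonTrivial pr ⦄

-- Holds when r is a power of the prime q.
Cancels : ℤ → ℤ → Set
Cancels q r = ∀ x y → ¬ q ∣ℤ x → r ∣ℤ x ℤ.* y → r ∣ℤ y

cancels-prime : ∀ {q} → Primeℤ q → Cancels q q
cancels-prime pr x y ¬x h with pr x y h
... | inj₁ d = contradiction d ¬x
... | inj₂ d = d

cancels-suc : ∀ {q r} → q ≢ 0ℤ → Primeℤ q → Cancels q r → Cancels q (q ℤ.* r)
cancels-suc {q} {r} q≢0 pr c x y ¬x h
  with cancels-prime pr x y ¬x (ℤ∣.∣-trans (∣⇒∣*ˡ q r (ℤ∣.∣-refl)) h)
... | divides y′ refl = subst (q ℤ.* r ∣ℤ_) (ℤP.*-comm q y′) (ℤ∣.*-monoʳ-∣ q (c x y′ ¬x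
  (ℤ∣.*-cancelˡ-∣ q ⦃ ℤ.≢-nonZero q≢0 ⦄ (subst (q ℤ.* r ∣ℤ_) (lem x y′ q) h))))
  where
  lem : ∀ x y q → x ℤ.* (y ℤ.* q) ≡ q ℤ.* (x ℤ.* y)
  lem = solve-∀

module Valuation {n k i p : ℕ} (k≤n : k ≤ n) (i≤k : i ≤ k) (pr : Prime p) (k<p : k < p)
  (p∣ : p ∣ n ∸ i) where

  q : ℤ
  q = pos p

  q≢0 : q ≢ 0ℤ
  q≢0 e = prime≢0 pr (ℤP.+-injective e)

  qpr : Primeℤ q
  qpr = prime⇒primeℤ pr

  diff : ∀ j → j ≤ k → pos n ℤ.- pos j ≡ pos (n ∸ j)
  diff j j≤k = trans (ℤP.m-n≡m⊖n n j) (ℤP.⊖-≥ (≤-trans j≤k k≤n))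

  small∤ : ∀ {m} → 0 < m → m ≤ k → p ∤ m
  small∤ 0<m m≤k h = <⇒≱ (≤-<-trans m≤k k<p) (ℕ∣.∣⇒≤ ⦃ ℕ.>-nonZero 0<m ⦄ h)

  -- Two of the terms n, ..., n - k differ by at most k < p, so only one of them can be a multiple
  -- of p.
  gap : ∀ {a b} → a < b → b ≤ k → p ∣ n ∸ a → p ∤ n ∸ b
  gap {a} {b} a<b b≤k pa pb = small∤ (ℕP.m<n⇒0<n∸m a<b) (≤-trans (ℕP.m∸n≤m b a) b≤k)
    (ℕ∣.∣m+n∣m⇒∣n (subst (p ∣_) split pa) pb)
    where
    split : n ∸ a ≡ n ∸ b + (b ∸ a)
    split = trans (cong (_∸ a) (sym (ℕP.m∸n+n≡m (≤-trans b≤k k≤n))))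
      (ℕP.+-∸-assoc (n ∸ b) (<⇒≤ a<b))

  unit : ∀ j → j ≤ k → j ≢ i → ¬ q ∣ℤ pos n ℤ.- pos j
  unit j j≤k j≢i h with pos-∣⁻¹ (subst (q ∣ℤ_) (diff j j≤k) h) | ℕP.<-cmp i j
  ... | pj | tri< i<j _ _ = gap i<j j≤k p∣ pj
  ... | pj | tri≈ _ e _   = j≢i (sym e)
  ... | pj | tri> _ _ j<i = gap j<i i≤k pj p∣

  -- Up to sign these are binomial coefficients of numbers m ≤ k < p. Absorption lowers m to j at
  -- the cost of factors between 1 and k, all prime to p, and ends at the leading coefficient 1.
  signedBinomial∤ : ∀ m j → m ≤ k → j ≤ m → ¬ q ∣ℤ signedBinomial m j
  signedBinomial∤ m j m≤k j≤m with ℕP.m≤n⇒m<n∨m≡n j≤m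
  ... | inj₂ refl = λ h → <⇒≱ (prime>1 pr)
    (ℕ∣.∣⇒≤ (pos-∣⁻¹ (subst (q ∣ℤ_) (signedBinomial-top m) h)))
  signedBinomial∤ (suc m) j m<k _ | inj₁ (s≤s j≤m) = λ h →
    signedBinomial∤ m j (<⇒≤ m<k) j≤m
      (cancels-prime qpr (pos (suc m)) _ (λ h′ → small∤ (s≤s z≤n) m<k (pos-∣⁻¹ h′))
        (subst (q ∣ℤ_) (ℤP.neg-involutive _)
          (ℤ∣.∣m⇒∣-m (subst (q ∣ℤ_) (signedBinomial-absorb m j)
            (∣⇒∣*ʳ (pos (suc m) ℤ.- pos j) _ h)))))

  K : ℕ → ℤ
  K m = (pos n ℤ.- pos m) ℤ.* pos (n C m)

  -- The numerator n (n - 1) ⋯ (n - m + 1) stops before the term n - i, and its factors are prime to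
  -- p.
  C∤ : ∀ m → m ≤ i → ¬ q ∣ℤ pos (n C m)
  C∤ zero    _   h = <⇒≱ (prime>1 pr) (ℕ∣.∣⇒≤ (pos-∣⁻¹ h))
  C∤ (suc m) m<i h with qpr _ _ (subst (q ∣ℤ_) (C-absorbℤ n m) (∣⇒∣*ʳ (pos (suc m)) _ h))
  ... | inj₁ d = unit m (≤-trans (<⇒≤ m<i) i≤k) (<⇒≢ m<i) d
  ... | inj₂ d = C∤ m (<⇒≤ m<i) d

  -- `K k` is the constant in the formula for the coefficients. It is reached from `K i`, which is n
  -- - i times a number prime to p: passing from m to m + 1 multiplies by (n - m - 1) / (m + 1), and
  -- from m = i on both of these are prime to p.
  K∤ : ∀ {r} → Cancels q r → ¬ r ∣ℤ pos (n ∸ i) → ∀ m → i ≤ m → m ≤ k → ¬ r ∣ℤ K m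
  K∤ {r} c ¬r m i≤m m≤k h with ℕP.m≤n⇒m<n∨m≡n i≤m
  ... | inj₂ refl = ¬r (subst (r ∣ℤ_) (diff i i≤k)
    (c (pos (n C i)) _ (C∤ i ≤-refl) (subst (r ∣ℤ_) (ℤP.*-comm (pos n ℤ.- pos i) _) h)))
  K∤ {r} c ¬r (suc m) _ m<k h | inj₁ (s≤s i≤m) =
    K∤ c ¬r m i≤m (<⇒≤ m<k) (subst (r ∣ℤ_) (C-absorbℤ n m)
      (∣⇒∣*ʳ (pos (suc m)) _ (c _ _ (unit (suc m) m<k (>⇒≢ (s≤s i≤m))) h)))

  private
    c : Seq
    c = shift (truncated n k)

  c-high : ∀ j → k < j → c j ≡ 0ℤ
  c-high j k<j = shift-vanish (truncated n k) (suc k)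
    (λ m k<m → co-length (truncated n k) m (subst (_≤ m) (sym (truncated-length n k)) k<m)) j k<j

  -- The coefficient formula is read twice: at index i the factor n - i brings r into `K k`, and at
  -- j ≠ i the factor n - j is prime to p and leaves r to `c j`.
  c-∣ : ∀ {r} → Cancels q r → r ∣ℤ pos (n ∸ i) → ∀ j → j ≢ i → r ∣ℤ c j
  c-∣ {r} cr h j j≢i with j ≤? k
  ... | no j≰k = ≡0⇒∣ (c-high j (≰⇒> j≰k))
  ... | yes j≤k = cr _ _ (unit j j≤k j≢i)
    (subst (r ∣ℤ_) (sym (shift-truncated n k j)) (∣⇒∣*ˡ _ _ r∣K))
    where
    r∣K : r ∣ℤ K k
    r∣K = cr (signedBinomial k i) _ (signedBinomial∤ k i ≤-refl i≤k)
      (subst (r ∣ℤ_) (trans (shift-truncated n k i) (ℤP.*-comm (K k) _))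
        (∣⇒∣*ˡ _ (c i) (subst (r ∣ℤ_) (sym (diff i i≤k)) h)))

  -- Used with r the first power of p that does not divide n - i, to cap the heights at the two ends
  -- of the polygon.
  c-∤ : ∀ {r} → Cancels q r → ¬ r ∣ℤ pos (n ∸ i) → ∀ j → j ≤ k → ¬ r ∣ℤ c j
  c-∤ {r} cr ¬r j j≤k h = K∤ cr ¬r k i≤k ≤-refl
    (cr (signedBinomial k j) _ (signedBinomial∤ k j ≤-refl j≤k)
      (subst (r ∣ℤ_) (trans (shift-truncated n k j) (ℤP.*-comm (K k) _)) (∣⇒∣*ʳ (pos n ℤ.- pos j) _ h)))

  -- Otherwise (n - i) `c i` would contain one factor p more than `K k` does.
  c-∤-self : ∀ {r} → Cancels q r → r ∣ℤ pos (n ∸ i) → ¬ q ℤ.* r ∣ℤ pos (n ∸ i) → ¬ q ∣ℤ c i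
  c-∤-self {r} cr h ¬h qc = K∤ cqr ¬h k i≤k ≤-refl
    (cqr (signedBinomial k i) _ (signedBinomial∤ k i ≤-refl i≤k)
      (subst (q ℤ.* r ∣ℤ_) (trans (ℤP.*-comm (c i) (pos n ℤ.- pos i))
        (trans (shift-truncated n k i) (ℤP.*-comm (K k) _)))
        (*-∣-* qc (subst (r ∣ℤ_) (sym (diff i i≤k)) h))))
    where
    cqr : Cancels q (q ℤ.* r)
    cqr = cancels-suc q≢0 qpr cr

-- All that the rest of the proof remembers of a factorisation into degrees d and e, except for the
-- finitely many pairs that are refuted modulo r.
record Degrees (n k d e : ℕ) : Set where
  field
    0<d : 0 < d
    0<e : 0 < e
    d+e : d + e ≡ k
    once : ∀ p i → Prime p → k < p → i ≤ k → p ∣ n ∸ i → p * p ∤ n ∸ i → i ≡ d ⊎ i ≡ e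
    twice : ∀ p i → Prime p → k < p → i ≤ k → p * p ∣ n ∸ i → p * (p * p) ∤ n ∸ i → Position d e i

degrees : ∀ {n k d e} F G → k ≤ n → 0 < d → 0 < e → d + e ≡ k →
  Last 0ℤ (co F) d → Last 0ℤ (co G) e →
  (∀ m → conv (co F) (co G) m ≡ co (truncated n k) m) → Degrees n k d e
degrees {n} {k} {d} {e} F G k≤n 0<d 0<e d+e lF lG FG = record
  { 0<d = 0<d ; 0<e = 0<e ; d+e = d+e ; once = once ; twice = twice }
  where
  cs : ∀ m → shift (truncated n k) m ≡ conv (shift F) (shift G) m
  cs m = sym (trans (conv-shift F G m) (shift-cong (mulZ F G) (truncated n k)
    (λ j → trans (sym (conv-co F G j)) (FG j)) m))
  once : ∀ p i → Prime p → k < p → i ≤ k → p ∣ n ∸ i → p * p ∤ n ∸ i → i ≡ d ⊎ i ≡ e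
  once p i pr k<p i≤k p∣ p²∤ = newton₁
    (subst (λ x → ¬ _ ∣ℤ x) (cs 0) (V.c-∤ c² ¬p² 0 z≤n))
    (subst (λ x → ¬ _ ∣ℤ x) (cs (d + e)) (V.c-∤ c² ¬p² (d + e) (ℕP.≤-reflexive d+e)))
    where
    module V = Valuation k≤n i≤k pr k<p p∣
    c¹ = cancels-prime V.qpr
    c² = cancels-suc V.q≢0 V.qpr c¹
    ¬p² : ¬ pos p ℤ.* pos p ∣ℤ pos (n ∸ i)
    ¬p² h = p²∤ (pos-∣⁻¹ (subst (_∣ℤ _) (sym (ℤP.pos-* p p)) h))
    open Newton V.q V.q≢0 V.qpr (shift F) (shift G) (shift-last F lF) (shift-last G lG) 0<d 0<e
      (λ j j≢i → subst (_ ∣ℤ_) (cs j) (V.c-∣ c¹ (pos-∣ p∣) j j≢i))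
      (subst (λ x → ¬ _ ∣ℤ x) (cs i) (V.c-∤-self c¹ (pos-∣ p∣) ¬p²))
  twice : ∀ p i → Prime p → k < p → i ≤ k → p * p ∣ n ∸ i → p * (p * p) ∤ n ∸ i → Position d e i
  twice p i pr k<p i≤k p²∣ p³∤ = newton₂
    (λ j j≢i → subst (_ ∣ℤ_) (cs j) (V.c-∣ c² p² j j≢i))
    (subst (λ x → ¬ V.q ℤ.* (V.q ℤ.* V.q) ∣ℤ x) (cs 0) (V.c-∤ c³ ¬p³ 0 z≤n))
    (subst (λ x → ¬ V.q ℤ.* (V.q ℤ.* V.q) ∣ℤ x) (cs (d + e)) (V.c-∤ c³ ¬p³ (d + e) (ℕP.≤-reflexive d+e)))
    where
    p∣ : p ∣ n ∸ i
    p∣ = ℕ∣.∣-trans (ℕ∣.m∣m*n p) p²∣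
    module V = Valuation k≤n i≤k pr k<p p∣
    c¹ = cancels-prime V.qpr
    c² = cancels-suc V.q≢0 V.qpr c¹
    c³ = cancels-suc V.q≢0 V.qpr c²
    p² : pos p ℤ.* pos p ∣ℤ pos (n ∸ i)
    p² = subst (_∣ℤ _) (ℤP.pos-* p p) (pos-∣ p²∣)
    ¬p³ : ¬ pos p ℤ.* (pos p ℤ.* pos p) ∣ℤ pos (n ∸ i)
    ¬p³ h = p³∤ (pos-∣⁻¹ (subst (_∣ℤ _)
      (sym (trans (ℤP.pos-* p (p * p)) (cong (pos p ℤ.*_) (ℤP.pos-* p p)))) h))
    open Newton V.q V.q≢0 V.qpr (shift F) (shift G) (shift-last F lF) (shift-last G lG) 0<d 0<e
      (λ j j≢i → subst (_ ∣ℤ_) (cs j) (V.c-∣ c¹ (pos-∣ p∣) j j≢i))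
      (subst (λ x → ¬ _ ∣ℤ x) (cs i) (V.c-∤-self c² p² ¬p³))

-- Gauss's lemma

ι : ℤ → ℚ
ι z = z ℚ./ 1

toℚᵘ-ι : ∀ z → toℚᵘ (ι z) ℚᵘ.≃ mkℚᵘ z 0
toℚᵘ-ι z = ℚP.toℚᵘ-fromℚᵘ (mkℚᵘ z 0)

ι-injective : ∀ {x y} → ι x ≡ ι y → x ≡ y
ι-injective {x} {y} e with ℚᵘP.≃-trans (ℚᵘP.≃-sym (toℚᵘ-ι x))
  (ℚᵘP.≃-trans (ℚᵘP.≃-reflexive (cong toℚᵘ e)) (toℚᵘ-ι y))
... | *≡* h = trans (sym (ℤP.*-identityʳ x)) (trans h (ℤP.*-identityʳ y))

ι-+ : ∀ x y → ι (x ℤ.+ y) ≡ ι x ℚ.+ ι y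
ι-+ x y = ℚP.toℚᵘ-injective (ℚᵘP.≃-trans (toℚᵘ-ι (x ℤ.+ y)) (ℚᵘP.≃-sym
  (ℚᵘP.≃-trans (ℚP.toℚᵘ-homo-+ (ι x) (ι y)) (ℚᵘP.≃-trans (ℚᵘP.+-cong (toℚᵘ-ι x) (toℚᵘ-ι y))
    (*≡* (lem x y))))))
  where
  lem : ∀ x y → (x ℤ.* 1ℤ ℤ.+ y ℤ.* 1ℤ) ℤ.* 1ℤ ≡ (x ℤ.+ y) ℤ.* 1ℤ
  lem = solve-∀

ι-* : ∀ x y → ι (x ℤ.* y) ≡ ι x ℚ.* ι y
ι-* x y = ℚP.toℚᵘ-injective (ℚᵘP.≃-trans (toℚᵘ-ι (x ℤ.* y)) (ℚᵘP.≃-sym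
  (ℚᵘP.≃-trans (ℚP.toℚᵘ-homo-* (ι x) (ι y)) (ℚᵘP.*-cong (toℚᵘ-ι x) (toℚᵘ-ι y)))))

ι-numerator : ∀ q → ι (↧ q) ℚ.* q ≡ ι (↥ q)
ι-numerator q@record{} = ℚP.toℚᵘ-injective (ℚᵘP.≃-trans (ℚP.toℚᵘ-homo-* (ι (↧ q)) q)
  (ℚᵘP.≃-trans (ℚᵘP.*-congʳ {toℚᵘ q} (toℚᵘ-ι (↧ q))) (ℚᵘP.≃-trans
    (*≡* (lem (↧ q) (↥ q))) (ℚᵘP.≃-sym (toℚᵘ-ι (↥ q))))))
  where
  lem : ∀ d n → d ℤ.* n ℤ.* 1ℤ ≡ n ℤ.* (1ℤ ℤ.* d)
  lem = solve-∀

addP-ι : ∀ p q → addP (map ι p) (map ι q) ≡ map ι (addZ p q)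
addP-ι []      q       = refl
addP-ι (a ∷ p) []      = refl
addP-ι (a ∷ p) (b ∷ q) = cong₂ _∷_ (sym (ι-+ a b)) (addP-ι p q)

scale-ι : ∀ a q → map (ι a ℚ.*_) (map ι q) ≡ map ι (map (a ℤ.*_) q)
scale-ι a []      = refl
scale-ι a (b ∷ q) = cong₂ _∷_ (sym (ι-* a b)) (scale-ι a q)

mulP-ι : ∀ p q → mulP (map ι p) (map ι q) ≡ map ι (mulZ p q)
mulP-ι []      q = refl
mulP-ι (a ∷ p) q =
  trans (cong₂ (λ x y → addP x (0ℚ ∷ y)) (scale-ι a q) (mulP-ι p q))
    (addP-ι (map (a ℤ.*_) q) (0ℤ ∷ mulZ p q))

coeff-ι : ∀ p j → coeff (map ι p) j ≡ ι (co p j)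
coeff-ι []      j       = refl
coeff-ι (a ∷ p) zero    = refl
coeff-ι (a ∷ p) (suc j) = coeff-ι p j

coeff-scale : ∀ a p j → coeff (map (a ℚ.*_) p) j ≡ a ℚ.* coeff p j
coeff-scale a []      j       = sym (ℚP.*-zeroʳ a)
coeff-scale a (b ∷ p) zero    = refl
coeff-scale a (b ∷ p) (suc j) = coeff-scale a p j

addP-scale : ∀ a p q → addP (map (a ℚ.*_) p) (map (a ℚ.*_) q) ≡ map (a ℚ.*_) (addP p q)
addP-scale a []      q       = refl
addP-scale a (x ∷ p) []      = refl
addP-scale a (x ∷ p) (y ∷ q) = cong₂ _∷_ (sym (ℚP.*-distribˡ-+ a x y)) (addP-scale a p q)

mulP-scale : ∀ a b p q → mulP (map (a ℚ.*_) p) (map (b ℚ.*_) q) ≡ map ((a ℚ.* b) ℚ.*_) (mulP p q)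
mulP-scale a b []      q = refl
mulP-scale a b (x ∷ p) q =
  trans (cong₂ addP (head q) (cong₂ _∷_ (sym (ℚP.*-zeroʳ (a ℚ.* b))) (mulP-scale a b p q)))
    (addP-scale (a ℚ.* b) (map (x ℚ.*_) q) (0ℚ ∷ mulP p q))
  where
  lem : ∀ a x b y → a ℚ.* x ℚ.* (b ℚ.* y) ≡ a ℚ.* b ℚ.* (x ℚ.* y)
  lem = solve 4 (λ a x b y → a :* x :* (b :* y) := a :* b :* (x :* y)) refl
    where open ℚ-Solver.+-*-Solver
  head : ∀ q → map (a ℚ.* x ℚ.*_) (map (b ℚ.*_) q) ≡ map (a ℚ.* b ℚ.*_) (map (x ℚ.*_) q)
  head []      = refl
  head (y ∷ q) = cong₂ _∷_ (lem a x b y) (head q)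

clear-denominators : ∀ f → ∃₂ λ u F → u ≢ 0 × map ι F ≡ map (ι (pos u) ℚ.*_) f
clear-denominators []      = 1 , [] , (λ ()) , refl
clear-denominators (q ∷ f) with clear-denominators f
... | u , F , u≢0 , e = ↧ₙ q * u , (↥ q ℤ.* pos u) ∷ map (↧ q ℤ.*_) F , nz , cong₂ _∷_ hd tl
  where
  nz : ↧ₙ q * u ≢ 0
  nz h with ℕP.m*n≡0⇒m≡0∨n≡0 (↧ₙ q) h
  ... | inj₂ u≡0 = u≢0 u≡0
  split : ι (pos (↧ₙ q * u)) ≡ ι (↧ q) ℚ.* ι (pos u)
  split = trans (cong ι (ℤP.pos-* (↧ₙ q) u)) (ι-* (↧ q) (pos u))
  lem : ∀ d u q → d ℚ.* q ℚ.* u ≡ d ℚ.* u ℚ.* q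
  lem = solve 3 (λ d u q → d :* q :* u := d :* u :* q) refl
    where open ℚ-Solver.+-*-Solver
  hd : ι (↥ q ℤ.* pos u) ≡ ι (pos (↧ₙ q * u)) ℚ.* q
  hd = trans (ι-* (↥ q) (pos u)) (trans (cong (ℚ._* ι (pos u)) (sym (ι-numerator q)))
    (trans (lem (ι (↧ q)) (ι (pos u)) q) (cong (ℚ._* q) (sym split))))
  tl : map ι (map (↧ q ℤ.*_) F) ≡ map (ι (pos (↧ₙ q * u)) ℚ.*_) f
  tl = trans (sym (scale-ι (↧ q) F)) (trans (cong (map (ι (↧ q) ℚ.*_)) e)
    (trans (sym (ListP.map-∘ f)) (ListP.map-cong
      (λ x → trans (sym (ℚP.*-assoc (ι (↧ q)) (ι (pos u)) x)) (cong (ℚ._* x) (sym split))) f)))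

record Cleared (f : Poly) : Set where
  field
    scale   : ℕ
    scale≢0 : scale ≢ 0
    poly    : List ℤ
    cleared : map ι poly ≡ map (ι (pos scale) ℚ.*_) f

  cleared-co : ∀ j → ι (co poly j) ≡ ι (pos scale) ℚ.* coeff f j
  cleared-co j = trans (sym (coeff-ι poly j))
    (trans (cong (λ p → coeff p j) cleared) (coeff-scale (ι (pos scale)) f j))

  co≡0⇒coeff≡0 : ∀ j → co poly j ≡ 0ℤ → coeff f j ≡ 0ℚ
  co≡0⇒coeff≡0 j h with coeff f j ℚ.≟ 0ℚ
  ... | yes z = z
  ... | no nz = contradiction (ι-injective zero-scale) λ e → scale≢0 (ℤP.+-injective e)
    where
    x = coeff f j
    instance
      x≢0 : ℚ.NonZero x
      x≢0 = ℚ.≢-nonZero nz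
    zero-scale : ι (pos scale) ≡ ι 0ℤ
    zero-scale = begin
      ι (pos scale) ≡⟨ sym (ℚP.*-identityʳ _) ⟩
      ι (pos scale) ℚ.* 1ℚ ≡⟨ cong (ι (pos scale) ℚ.*_) (sym (ℚP.*-inverseʳ x)) ⟩
      ι (pos scale) ℚ.* (x ℚ.* 1/ x) ≡⟨ sym (ℚP.*-assoc (ι (pos scale)) x (1/ x)) ⟩
      ι (pos scale) ℚ.* x ℚ.* 1/ x ≡⟨ cong (ℚ._* 1/ x) (trans (sym (cleared-co j)) (cong ι h)) ⟩
      0ℚ ℚ.* 1/ x ≡⟨ ℚP.*-zeroˡ (1/ x) ⟩
      0ℚ ∎
      where open ≡-Reasoning

clear : ∀ f → Cleared f
clear f with clear-denominators f
... | u , F , u≢0 , e = record { scale = u ; scale≢0 = u≢0 ; poly = F ; cleared = e }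

clear-conv : ∀ {f g} (cf : Cleared f) (cg : Cleared g) h → mulP f g ≈P map ι h →
  ∀ m → conv (co (Cleared.poly cf)) (co (Cleared.poly cg)) m ≡
    pos (Cleared.scale cf * Cleared.scale cg) ℤ.* co h m
clear-conv {f} {g} cf cg h eq m = ι-injective (begin
  ι (conv (co F) (co G) m) ≡⟨ cong ι (conv-co F G m) ⟩
  ι (co (mulZ F G) m) ≡⟨ sym (coeff-ι (mulZ F G) m) ⟩
  coeff (map ι (mulZ F G)) m ≡⟨ cong (λ p → coeff p m) (sym (mulP-ι F G)) ⟩
  coeff (mulP (map ι F) (map ι G)) m ≡⟨ cong₂ (λ p q → coeff (mulP p q) m) (cleared cf) (cleared cg) ⟩
  coeff (mulP (map (ι u ℚ.*_) f) (map (ι v ℚ.*_) g)) m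
                                              ≡⟨ cong (λ p → coeff p m) (mulP-scale (ι u) (ι v) f g) ⟩
  coeff (map (ι u ℚ.* ι v ℚ.*_) (mulP f g)) m ≡⟨ coeff-scale (ι u ℚ.* ι v) (mulP f g) m ⟩
  ι u ℚ.* ι v ℚ.* coeff (mulP f g) m ≡⟨ cong (ι u ℚ.* ι v ℚ.*_) (trans (eq m) (coeff-ι h m)) ⟩
  ι u ℚ.* ι v ℚ.* ι (co h m) ≡⟨ cong (ℚ._* ι (co h m)) (sym (ι-* u v)) ⟩
  ι (u ℤ.* v) ℚ.* ι (co h m) ≡⟨ sym (ι-* (u ℤ.* v) (co h m)) ⟩
  ι (u ℤ.* v ℤ.* co h m) ≡⟨ cong (λ w → ι (w ℤ.* co h m)) (sym (ℤP.pos-* (scale cf) (scale cg))) ⟩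
  ι (pos (scale cf * scale cg) ℤ.* co h m) ∎)
  where
  open ≡-Reasoning
  open Cleared
  F = poly cf
  G = poly cg
  u = pos (scale cf)
  v = pos (scale cg)

conv-scaleˡ : ∀ a (f g : Seq) m → conv (λ j → a ℤ.* f j) g m ≡ a ℤ.* conv f g m
conv-scaleˡ a f g zero    = ℤP.*-assoc a (f 0) (g 0)
conv-scaleˡ a f g (suc m) = trans (cong₂ ℤ._+_ (ℤP.*-assoc a (f 0) (g (suc m)))
  (conv-scaleˡ a (f ∘ suc) g m)) (sym (ℤP.*-distribˡ-+ a _ _))

conv-scaleʳ : ∀ a (f g : Seq) m → conv f (λ j → a ℤ.* g j) m ≡ a ℤ.* conv f g m
conv-scaleʳ a f g zero    = lem a (f 0) (g 0)
  where
  lem : ∀ a x y → x ℤ.* (a ℤ.* y) ≡ a ℤ.* (x ℤ.* y)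
  lem = solve-∀
conv-scaleʳ a f g (suc m) =
  trans (cong (λ z → f 0 ℤ.* (a ℤ.* g (suc m)) ℤ.+ z) (conv-scaleʳ a (f ∘ suc) g m))
    (lem a (f 0) (g (suc m)) (conv (f ∘ suc) g m))
  where
  lem : ∀ a x y z → x ℤ.* (a ℤ.* y) ℤ.+ a ℤ.* z ≡ a ℤ.* (x ℤ.* y ℤ.+ z)
  lem = solve-∀

conv-cong : ∀ {f f′ g g′ : Seq} → (∀ j → f j ≡ f′ j) → (∀ j → g j ≡ g′ j) → ∀ m → conv f g m ≡ conv f′ g′ m
conv-cong ef eg zero    = cong₂ ℤ._*_ (ef 0) (eg 0)
conv-cong ef eg (suc m) = cong₂ ℤ._+_ (cong₂ ℤ._*_ (ef 0) (eg (suc m))) (conv-cong (ef ∘ suc) eg m)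

quotient-poly : ∀ q F → (∀ j → q ∣ℤ co F j) → ∃ λ F′ → ∀ j → co F j ≡ q ℤ.* co F′ j
quotient-poly q []      h = [] , λ j → sym (ℤP.*-zeroʳ q)
quotient-poly q (a ∷ F) h with h 0 | quotient-poly q F (λ j → h (suc j))
... | divides b e | F′ , eF = b ∷ F′ , λ { zero → trans e (ℤP.*-comm b q) ; (suc j) → eF j }

-- Each prime of the constant divides all coefficients of F or all of G, as otherwise `first-conv`
-- yields a coefficient of the product that it does not divide; so the primes are divided out one by
-- one. Of F and G only the vanishing of coefficients is tracked, since this decides whether a
-- rational factor is constant.
gauss : ∀ ps → All Prime ps → ∀ F G (c : Seq) →
  (∀ m → conv (co F) (co G) m ≡ pos (product ps) ℤ.* c m) →
  ∃₂ λ F′ G′ → (∀ m → conv (co F′) (co G′) m ≡ c m) ×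
    (∀ j → co F′ j ≡ 0ℤ → co F j ≡ 0ℤ) × (∀ j → co G′ j ≡ 0ℤ → co G j ≡ 0ℤ)
gauss []       []         F G c h =
  F , G , (λ m → trans (h m) (ℤP.*-identityˡ (c m))) , (λ _ z → z) , (λ _ z → z)
gauss (p ∷ ps) (pr ∷ prs) F G c h =
  cases (first-search q (co F) (length F) (co-length F)) (first-search q (co G) (length G) (co-length G))
  where
  q = pos p
  w = pos (product ps)
  q≢0 : q ≢ 0ℤ
  q≢0 e = ℕ.≢-nonZero⁻¹ p ⦃ prime⇒nonZero pr ⦄ (ℤP.+-injective e)
  h′ : ∀ m → conv (co F) (co G) m ≡ q ℤ.* (w ℤ.* c m)
  h′ m = trans (h m) (trans (cong (ℤ._* c m) (ℤP.pos-* p (product ps))) (ℤP.*-assoc q w (c m)))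
  q∣ : ∀ m → q ∣ℤ conv (co F) (co G) m
  q∣ m = subst (q ∣ℤ_) (sym (h′ m)) (∣⇒∣*ˡ q _ ℤ∣.∣-refl)
  cancel : ∀ x y → q ℤ.* x ≡ q ℤ.* y → x ≡ y
  cancel x y = ℤP.*-cancelˡ-≡ q x y ⦃ ℤ.≢-nonZero q≢0 ⦄
  zero-up : ∀ H H′ → (∀ j → co H j ≡ q ℤ.* co H′ j) → ∀ j → co H′ j ≡ 0ℤ → co H j ≡ 0ℤ
  zero-up H H′ e j z = trans (e j) (trans (cong (q ℤ.*_) z) (ℤP.*-zeroʳ q))
  Goal : Set
  Goal = ∃₂ λ F′ G′ → (∀ m → conv (co F′) (co G′) m ≡ c m) ×
    (∀ j → co F′ j ≡ 0ℤ → co F j ≡ 0ℤ) × (∀ j → co G′ j ≡ 0ℤ → co G j ≡ 0ℤ)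
  divF : (∃ λ F₁ → ∀ j → co F j ≡ q ℤ.* co F₁ j) → Goal
  divF (F₁ , e) with gauss ps prs F₁ G c (λ m → cancel _ _
    (trans (sym (conv-scaleˡ q (co F₁) (co G) m))
      (trans (conv-cong (λ j → sym (e j)) (λ _ → refl) m) (h′ m))))
  ... | F′ , G′ , r , zF , zG = F′ , G′ , r , (λ j z → zero-up F F₁ e j (zF j z)) , zG
  divG : (∃ λ G₁ → ∀ j → co G j ≡ q ℤ.* co G₁ j) → Goal
  divG (G₁ , e) with gauss ps prs F G₁ c (λ m → cancel _ _
    (trans (sym (conv-scaleʳ q (co F) (co G₁) m))
      (trans (conv-cong {co F} (λ _ → refl) (λ j → sym (e j)) m) (h′ m))))
  ... | F′ , G′ , r , zF , zG = F′ , G′ , r , zF , (λ j z → zero-up G G₁ e j (zG j z))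
  cases : ∃ (First q (co F)) ⊎ (∀ j → q ∣ℤ co F j) → ∃ (First q (co G)) ⊎ (∀ j → q ∣ℤ co G j) → Goal
  cases (inj₂ a) _ = divF (quotient-poly q F a)
  cases _ (inj₂ a) = divG (quotient-poly q G a)
  cases (inj₁ (s , fF)) (inj₁ (t , fG)) =
    contradiction (q∣ (s + t)) (first-conv (co F) (co G) (prime⇒primeℤ pr) fF fG)

P-ι : ∀ n k → P n k ≡ map ι (truncated n k)
P-ι n k = ListP.map-∘ (upTo (suc k))

integral-factors : ∀ n k f g → P n k ≈P mulP f g →
  ∃₂ λ F G → (∀ m → conv (co F) (co G) m ≡ co (truncated n k) m) ×
    (∀ j → co F j ≡ 0ℤ → coeff f j ≡ 0ℚ) × (∀ j → co G j ≡ 0ℤ → coeff g j ≡ 0ℚ)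
integral-factors n k f g h = result
  where
  open Cleared
  cf = clear f
  cg = clear g
  w = scale cf * scale cg
  w≢0 : w ≢ 0
  w≢0 e with ℕP.m*n≡0⇒m≡0∨n≡0 (scale cf) e
  ... | inj₁ z = scale≢0 cf z
  ... | inj₂ z = scale≢0 cg z
  open PrimeFactorisation (factorise w ⦃ ℕ.≢-nonZero w≢0 ⦄)
  result : ∃₂ λ F G → (∀ m → conv (co F) (co G) m ≡ co (truncated n k) m) ×
    (∀ j → co F j ≡ 0ℤ → coeff f j ≡ 0ℚ) × (∀ j → co G j ≡ 0ℤ → coeff g j ≡ 0ℚ)
  result with gauss factors factorsPrime (poly cf) (poly cg) (co (truncated n k))
    (λ m → trans (clear-conv cf cg (truncated n k)
        (λ j → trans (sym (h j)) (cong (λ p → coeff p j) (P-ι n k))) m)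
      (cong (λ x → pos x ℤ.* co (truncated n k) m) isFactorisation))
  ... | F , G , r , zF , zG =
    F , G , r , (λ j z → co≡0⇒coeff≡0 cf j (zF j z)) , (λ j z → co≡0⇒coeff≡0 cg j (zG j z))

coeff-constant : ∀ p c j → coeff (mulP p (c ∷ [])) j ≡ coeff p j ℚ.* c
coeff-constant []      c j       = sym (ℚP.*-zeroˡ c)
coeff-constant (a ∷ p) c zero    = ℚP.+-identityʳ (a ℚ.* c)
coeff-constant (a ∷ p) c (suc j) = coeff-constant p c j

constant-unit : ∀ f → coeff f 0 ≢ 0ℚ → (∀ j → coeff f (suc j) ≡ 0ℚ) → IsUnit f
constant-unit f nz z = (1/ x) ∷ [] , eq
  where
  x = coeff f 0
  instance
    x≢0 : ℚ.NonZero x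
    x≢0 = ℚ.≢-nonZero nz
  eq : mulP f ((1/ x) ∷ []) ≈P (1ℚ ∷ [])
  eq zero    = trans (coeff-constant f (1/ x) 0) (ℚP.*-inverseʳ x)
  eq (suc j) = trans (coeff-constant f (1/ x) (suc j))
    (trans (cong (ℚ._* 1/ x) (z j)) (ℚP.*-zeroˡ (1/ x)))

co-truncated : ∀ n k j → j ≤ k → co (truncated n k) j ≡ pos (n C j)
co-truncated n k j j≤k = go (suc k) j (λ i → i) (s≤s j≤k)
  where
  go : ∀ m j (φ : ℕ → ℕ) → j < m → co (map (λ i → pos (n C i)) (applyUpTo φ m)) j ≡ pos (n C φ j)
  go (suc m) zero    φ _         = refl
  go (suc m) (suc j) φ (s≤s j<m) = go m j (φ ∘ suc) j<m

-- Excluding factors modulo r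

∧-true : ∀ a b → a ∧ b ≡ true → a ≡ true × b ≡ true
∧-true true true _ = refl , refl

≡ᵇ-true : ∀ m n → (m ℕ.≡ᵇ n) ≡ true → m ≡ n
≡ᵇ-true m n e = ℕP.≡ᵇ⇒≡ m n (subst T (sym e) _)

-- A factor 1 - h₁x - … - h_d x^d of a polynomial with constant term 1 determines its
-- cofactor as a power series; modulo r, each of the r^d candidates is refuted by a
-- coefficient of that series in degree above k - d which does not vanish.
dot : List ℕ → List ℕ → ℕ
dot (h ∷ hs) (g ∷ gs) = h * g + dot hs gs
dot _        _        = 0

cofactor : (r : ℕ) .⦃ _ : NonZero r ⦄ → List ℕ → List ℕ → List ℕ → List ℕ
cofactor r hs gs []       = gs
cofactor r hs gs (c ∷ cs) = cofactor r hs (((c + dot hs gs) % r) ∷ gs) cs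

zeros : (r : ℕ) .⦃ _ : NonZero r ⦄ → ℕ → List ℕ → Bool
zeros r zero    _        = true
zeros r (suc d) []       = true
zeros r (suc d) (g ∷ gs) = (g % r ℕ.≡ᵇ 0) ∧ zeros r d gs

every : ℕ → (ℕ → Bool) → Bool
every zero    f = true
every (suc n) f = f n ∧ every n f

every-true : ∀ n f → every n f ≡ true → ∀ j → j < n → f j ≡ true
every-true (suc n) f h j (s≤s j≤n) with ∧-true (f n) _ h | ℕP.m≤n⇒m<n∨m≡n j≤n
... | _ , h′ | inj₁ j<n  = every-true n f h′ j j<n
... | fn , _ | inj₂ refl = fn

everyTuple : ℕ → ℕ → (List ℕ → Bool) → Bool
everyTuple r zero    f = f []
everyTuple r (suc d) f = every r λ h → everyTuple r d λ hs → f (h ∷ hs)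

everyTuple-true : ∀ r d f → everyTuple r d f ≡ true → ∀ (φ : ℕ → ℕ) → (∀ j → φ j < r) →
  f (applyUpTo φ d) ≡ true
everyTuple-true r zero    f h φ b = h
everyTuple-true r (suc d) f h φ b =
  everyTuple-true r d (λ hs → f (φ 0 ∷ hs)) (every-true r _ h (φ 0) (b 0)) (φ ∘ suc) (λ j → b (suc j))

noFactor : (r : ℕ) .⦃ _ : NonZero r ⦄ → ℕ → ℕ → ℕ → Bool
noFactor r n k d = everyTuple r d λ hs →
  not (zeros r d (cofactor r hs (1 ∷ []) (applyUpTo (λ j → n C suc j) k)))

module Congruence (r : ℕ) .⦃ _ : NonZero r ⦄ (G : Seq) where

  infix 4 _≈_
  record _≈_ (g : ℕ) (x : ℤ) : Set where
    constructor mod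
    field r∣ : pos r ∣ℤ pos g ℤ.- x

  ≈-refl : ∀ {g} → g ≈ pos g
  ≈-refl {g} = mod (≡0⇒∣ (ℤP.+-inverseʳ (pos g)))

  ≈-+ : ∀ {a b x y} → a ≈ x → b ≈ y → a + b ≈ x ℤ.+ y
  ≈-+ {a} {b} {x} {y} (mod p) (mod q) = mod (subst (pos r ∣ℤ_) (trans (lem (pos a) (pos b) x y)
      (cong (λ z → z ℤ.- (x ℤ.+ y)) (sym (ℤP.pos-+ a b)))) (ℤ∣.∣m∣n⇒∣m+n p q))
    where
    lem : ∀ a b x y → (a ℤ.- x) ℤ.+ (b ℤ.- y) ≡ a ℤ.+ b ℤ.- (x ℤ.+ y)
    lem = solve-∀

  ≈-* : ∀ {a b x y} → a ≈ x → b ≈ y → a * b ≈ x ℤ.* y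
  ≈-* {a} {b} {x} {y} (mod p) (mod q) = mod (subst (pos r ∣ℤ_) (trans (lem (pos a) (pos b) x y)
      (cong (λ z → z ℤ.- x ℤ.* y) (sym (ℤP.pos-* a b))))
      (ℤ∣.∣m∣n⇒∣m+n (∣⇒∣*ˡ _ (pos b) p) (∣⇒∣*ʳ x _ q)))
    where
    lem : ∀ a b x y → (a ℤ.- x) ℤ.* b ℤ.+ x ℤ.* (b ℤ.- y) ≡ a ℤ.* b ℤ.- x ℤ.* y
    lem = solve-∀

  ≈-% : ∀ {a x} → a ≈ x → a % r ≈ x
  ≈-% {a} {x} (mod p) = mod (subst (pos r ∣ℤ_) eq (ℤ∣.∣m∣n⇒∣m-n p (divides (pos (a /ℕ r)) refl)))
    where
    lem : ∀ b x c → b ℤ.+ c ℤ.- x ℤ.- c ≡ b ℤ.- x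
    lem = solve-∀
    eq : pos a ℤ.- x ℤ.- pos (a /ℕ r) ℤ.* pos r ≡ pos (a % r) ℤ.- x
    eq = trans (cong (λ z → z ℤ.- x ℤ.- pos (a /ℕ r) ℤ.* pos r)
      (trans (cong pos (m≡m%n+[m/n]*n a r)) (trans (ℤP.pos-+ (a % r) _)
        (cong (λ z → pos (a % r) ℤ.+ z) (ℤP.pos-* (a /ℕ r) r)))))
      (lem (pos (a % r)) x (pos (a /ℕ r) ℤ.* pos r))

  ≈-residue : ∀ x → x ℤ/.%ℕ r ≈ x
  ≈-residue x = mod (subst (λ z → pos r ∣ℤ pos (x ℤ/.%ℕ r) ℤ.- z) (sym (ℤ/.a≡a%ℕn+[a/ℕn]*n x r))
    (subst (pos r ∣ℤ_) (lem (pos (x ℤ/.%ℕ r)) (x ℤ/./ℕ r) (pos r)) (divides (ℤ.- (x ℤ/./ℕ r)) refl)))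
    where
    lem : ∀ a b c → (ℤ.- b) ℤ.* c ≡ a ℤ.- (a ℤ.+ b ℤ.* c)
    lem = solve-∀

  -- Residues of G m, ..., G 0 with the highest index first, so that `dot` pairs them as a
  -- convolution does.
  data Residues : List ℕ → ℕ → Set where
    base : ∀ {g} → g ≈ G 0 → Residues (g ∷ []) 0
    step : ∀ {g gs m} → g ≈ G (suc m) → Residues gs m → Residues (g ∷ gs) (suc m)

  dot-conv : ∀ d (H : Seq) → (∀ j → d ≤ j → H j ≡ 0ℤ) → ∀ {gs m} → Residues gs m →
    dot (applyUpTo (λ j → H j ℤ/.%ℕ r) d) gs ≈ conv H G m
  dot-conv zero    H z {gs} {m} _ = mod (≡0⇒∣ (cong (λ x → 0ℤ ℤ.- x)
    (trans (conv-cong (λ j → z j z≤n) (λ _ → refl) m) (conv-0 G m))))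
  dot-conv (suc d) H z (base {g} p) =
    subst (_≈ H 0 ℤ.* G 0) (sym (trans (cong (_ +_) (dot-[] (applyUpTo _ d))) (+-identityʳ _)))
      (≈-* (≈-residue (H 0)) p)
    where
    dot-[] : ∀ hs → dot hs [] ≡ 0
    dot-[] []      = refl
    dot-[] (_ ∷ _) = refl
  dot-conv (suc d) H z (step p rs) =
    ≈-+ (≈-* (≈-residue (H 0)) p) (dot-conv d (H ∘ suc) (λ j d≤j → z (suc j) (s≤s d≤j)) rs)

  zeros-true : ∀ d {gs m} → Residues gs m → (∀ j → m < j + d → G j ≡ 0ℤ) → zeros r d gs ≡ true
  zeros-true zero    rs z = refl
  zeros-true (suc d) {m = m} rs z = go rs z
    where
    residue-0 : ∀ {g x} → g ≈ x → x ≡ 0ℤ → (g % r ℕ.≡ᵇ 0) ≡ true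
    residue-0 {g} (mod p) refl = cong (ℕ._≡ᵇ 0) (ℕ∣.n∣m⇒m%n≡0 g r
      (pos-∣⁻¹ (subst (pos r ∣ℤ_) (ℤP.+-identityʳ (pos g)) p)))
    go : ∀ {gs m} → Residues gs m → (∀ j → m < j + suc d → G j ≡ 0ℤ) → zeros r (suc d) gs ≡ true
    go (base p) z = cong₂ _∧_ (residue-0 p (z 0 (s≤s z≤n))) (zeros-[] d)
      where
      zeros-[] : ∀ d → zeros r d [] ≡ true
      zeros-[] zero    = refl
      zeros-[] (suc d) = refl
    go {m = suc m} (step p rs) z = cong₂ _∧_
      (residue-0 p (z (suc m) (s≤s (ℕP.m<m+n m (s≤s z≤n)))))
      (zeros-true d rs λ j h → z j (subst (suc m <_) (sym (+-suc j d)) (s≤s h)))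

-- Write F = 1 - x H. Then G = F G + x H G, so `G (suc m)` is `n C suc m` plus a convolution of H
-- with the earlier coefficients of G; `cofactor` runs this recursion modulo r. The coefficients of
-- G in degrees e + 1, ..., k vanish, whereas `check` says that for every choice of H modulo r one
-- of them does not.
no-monic-factor : (r : ℕ) .⦃ _ : NonZero r ⦄ → ∀ n k d e (F G : Seq) → d + e ≡ k →
  F 0 ≡ 1ℤ → G 0 ≡ 1ℤ → (∀ j → d < j → F j ≡ 0ℤ) → (∀ j → e < j → G j ≡ 0ℤ) →
  (∀ m → m ≤ k → conv F G m ≡ pos (n C m)) → noFactor r n k d ≡ true → ¬ 0 < r
no-monic-factor r n k d e F G d+e F0 G0 zF zG FG check 0<r =
  contradiction (trans (cong not (sym all-zero)) (everyTuple-true r d _ check φ bound)) λ ()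
  where
  open Congruence r G
  H : Seq
  H j = ℤ.-1ℤ ℤ.* F (suc j)
  φ : ℕ → ℕ
  φ j = H j ℤ/.%ℕ r
  bound : ∀ j → φ j < r
  bound j = ℤ/.n%ℕd<d (H j) r
  H0 : ∀ j → d ≤ j → H j ≡ 0ℤ
  H0 j d≤j = trans (cong (ℤ.-1ℤ ℤ.*_) (zF (suc j) (s≤s d≤j))) refl
  hs = applyUpTo φ d
  G-suc : ∀ m → suc m ≤ k → G (suc m) ≡ pos (n C suc m) ℤ.+ conv H G m
  G-suc m m<k = begin
    G (suc m) ≡⟨ lem (G (suc m)) (conv (F ∘ suc) G m) ⟩
    1ℤ ℤ.* G (suc m) ℤ.+ X ℤ.+ ℤ.-1ℤ ℤ.* X ≡⟨ cong (λ z → z ℤ.* G (suc m) ℤ.+ X ℤ.+ ℤ.-1ℤ ℤ.* X) (sym F0) ⟩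
    conv F G (suc m) ℤ.+ ℤ.-1ℤ ℤ.* X ≡⟨ cong₂ ℤ._+_ (FG (suc m) m<k) (sym (conv-scaleˡ ℤ.-1ℤ (F ∘ suc) G m)) ⟩
    pos (n C suc m) ℤ.+ conv H G m ∎
    where
    open ≡-Reasoning
    X = conv (F ∘ suc) G m
    lem : ∀ g x → g ≡ 1ℤ ℤ.* g ℤ.+ x ℤ.+ ℤ.-1ℤ ℤ.* x
    lem = solve-∀
  run : ∀ l m {gs} → m + l ≡ k → ∀ (γ : ℕ → ℕ) → (∀ j → γ j ≡ n C suc (m + j)) → Residues gs m →
    Residues (cofactor r hs gs (applyUpTo γ l)) k
  run zero    m e γ eγ rs = subst (Residues _) (trans (sym (+-identityʳ m)) e) rs
  run (suc l) m e γ eγ rs = run l (suc m) (trans (sym (+-suc m l)) e) (γ ∘ suc)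
    (λ j → trans (eγ (suc j)) (cong (λ i → n C suc i) (+-suc m j)))
    (step (≈-% (subst (λ x → γ 0 + dot hs _ ≈ x)
        (sym (G-suc m (subst (suc m ≤_) e (subst (_≤ m + suc l) (+-comm m 1) (ℕP.+-monoʳ-≤ m (s≤s z≤n))))))
        (≈-+ (subst (λ c → γ 0 ≈ pos c) (trans (eγ 0) (cong (λ i → n C suc i) (+-identityʳ m))) ≈-refl)
          (dot-conv d H H0 rs)))) rs)
  all-zero : zeros r d (cofactor r hs (1 ∷ []) (applyUpTo (λ j → n C suc j) k)) ≡ true
  all-zero = zeros-true d
    (run k 0 refl _ (λ _ → refl) (base (subst (1 ≈_) (sym G0) ≈-refl)))
    λ j h → zG j (ℕP.+-cancelʳ-< d e j (subst (_< j + d) (trans (sym d+e) (+-comm d e)) h))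

-- Irreducibility as the absence of integral factorisations

C>0 : ∀ n k → k ≤ n → 0 < n C k
C>0 n       zero    _         = s≤s z≤n
C>0 (suc n) (suc k) (s≤s k≤n) = subst (0 <_) (nCk+nC[k+1]≡[n+1]C[k+1] n k)
  (<-≤-trans (C>0 n k k≤n) (m≤m+n (n C k) (n C suc k)))

truncated-last : ∀ n k → k ≤ n → Last 0ℤ (co (truncated n k)) k
truncated-last n k k≤n =
  (λ h → <⇒≢ (C>0 n k k≤n)
    (sym (ℤP.+-injective (trans (sym (co-truncated n k k ≤-refl)) (0∣⇒≡0 h))))) ,
  (λ j k<j → ≡0⇒∣ (co-length (truncated n k) j (subst (_≤ j) (sym (truncated-length n k)) k<j)))

record Factorisation (n k d e : ℕ) : Set where
  field
    F G   : List ℤ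
    lastF : Last 0ℤ (co F) d
    lastG : Last 0ℤ (co G) e
    FG    : ∀ m → conv (co F) (co G) m ≡ co (truncated n k) m

-- The degree formula, obtained by taking 0 for the prime: the coefficient of index d + e is a
-- product of nonzero leading coefficients, and all terms of higher index vanish.
degrees-add : ∀ {n k d e} → k ≤ n → (F G : List ℤ) → Last 0ℤ (co F) d → Last 0ℤ (co G) e →
  (∀ m → conv (co F) (co G) m ≡ co (truncated n k) m) → d + e ≡ k
degrees-add {n} {k} {d} {e} k≤n F G lF lG FG with ℕP.<-cmp (d + e) k
... | tri≈ _ eq _ = eq
... | tri> _ _ k<d+e = contradiction
  (subst (0ℤ ∣ℤ_) (sym (FG (d + e))) (proj₂ (truncated-last n k k≤n) (d + e) k<d+e))
  (last-conv (co F) (co G) Primeℤ-0 lF lG)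
... | tri< d+e<k _ _ = contradiction
  (subst (0ℤ ∣ℤ_) (FG k) (conv-∣ (co F) (co G) k high)) (proj₁ (truncated-last n k k≤n))
  where
  high : ∀ a b → a + b ≡ k → 0ℤ ∣ℤ co F a ℤ.* co G b
  high a b a+b with a ≤? d
  ... | no a≰d = ∣⇒∣*ˡ (co F a) _ (proj₂ lF a (≰⇒> a≰d))
  ... | yes a≤d = ∣⇒∣*ʳ (co F a) _ (proj₂ lG b (ℕP.+-cancelˡ-< d e b
          (<-≤-trans d+e<k (subst (_≤ d + b) a+b (ℕP.+-monoˡ-≤ b a≤d)))))

mulP-constantˡ : ∀ f g → coeff (mulP f g) 0 ≡ 1ℚ → coeff f 0 ≢ 0ℚ
mulP-constantˡ [] g () _
mulP-constantˡ (.0ℚ ∷ f) [] () refl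
mulP-constantˡ (.0ℚ ∷ f) (b ∷ g) e refl = contradiction
  (trans (sym e) (trans (ℚP.+-identityʳ (0ℚ ℚ.* b)) (ℚP.*-zeroˡ b))) λ ()

mulP-constantʳ : ∀ f g → coeff (mulP f g) 0 ≡ 1ℚ → coeff g 0 ≢ 0ℚ
mulP-constantʳ [] g () _
mulP-constantʳ (a ∷ f) [] () _
mulP-constantʳ (a ∷ f) (.0ℚ ∷ g) e refl = contradiction
  (trans (sym e) (trans (ℚP.+-identityʳ (a ℚ.* 0ℚ)) (ℚP.*-zeroʳ a))) λ ()

irreducible : ∀ n k → 1 ≤ k → k ≤ n →
  (∀ d e → 0 < d → 0 < e → d + e ≡ k → ¬ Factorisation n k d e) → Irreducible (P n k)
irreducible n k 1≤k k≤n impossible = nonzero , nonunit , factors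
  where
  nonzero : ¬ (P n k ≈P [])
  nonzero h = contradiction (ι-injective {1ℤ} {0ℤ} (h 0)) λ ()

  -- A product of P n k with a polynomial of degree e has degree k + e ≥ 1 and cannot be a constant.
  nonunit : ¬ IsUnit (P n k)
  nonunit (g , h) = cases (last-search 0ℤ (co G) (length G) λ j l → ≡0⇒∣ (co-length G j l))
    where
    open Cleared
    cf : Cleared (P n k)
    cf = record { scale = 1 ; scale≢0 = λ () ; poly = truncated n k
      ; cleared = trans (sym (P-ι n k)) (sym (trans (ListP.map-cong ℚP.*-identityˡ (P n k)) (ListP.map-id (P n k)))) }
    cg = clear g
    G = poly cg
    v = pos (1 * scale cg)
    eq : ∀ m → conv (co (truncated n k)) (co G) m ≡ v ℤ.* co (1ℤ ∷ []) m
    eq = clear-conv cf cg (1ℤ ∷ []) h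
    v≢0 : v ≢ 0ℤ
    v≢0 z = scale≢0 cg (trans (sym (+-identityʳ (scale cg))) (ℤP.+-injective z))
    cases : ∃ (Last 0ℤ (co G)) ⊎ (∀ j → 0ℤ ∣ℤ co G j) → ⊥
    cases (inj₂ all) = v≢0 (trans (sym (ℤP.*-identityʳ v)) (trans (sym (eq 0))
      (0∣⇒≡0 (conv-∣ (co (truncated n k)) (co G) 0 λ a b _ → ∣⇒∣*ʳ (co (truncated n k) a) _ (all b)))))
    cases (inj₁ (e , lG)) =
      last-conv (co (truncated n k)) (co G) Primeℤ-0 (truncated-last n k k≤n) lG
        (≡0⇒∣ (trans (eq (k + e)) (trans (cong (v ℤ.*_)
          (co-length (1ℤ ∷ []) (k + e) (≤-trans 1≤k (m≤m+n k e)))) (ℤP.*-zeroʳ v))))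

  factors : ∀ f g → P n k ≈P mulP f g → IsUnit f ⊎ IsUnit g
  factors f g h = go (integral-factors n k f g h)
   where
   P₀ : coeff (mulP f g) 0 ≡ 1ℚ
   P₀ = sym (h 0)
   go : (∃₂ λ F G → (∀ m → conv (co F) (co G) m ≡ co (truncated n k) m) ×
     (∀ j → co F j ≡ 0ℤ → coeff f j ≡ 0ℚ) × (∀ j → co G j ≡ 0ℤ → coeff g j ≡ 0ℚ)) → IsUnit f ⊎ IsUnit g
   go (F , G , FG , zF , zG) = cases
    (last-search 0ℤ (co F) (length F) λ j l → ≡0⇒∣ (co-length F j l))
    (last-search 0ℤ (co G) (length G) λ j l → ≡0⇒∣ (co-length G j l))
    where
    c₀ : conv (co F) (co G) 0 ≡ 1ℤ
    c₀ = FG 0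
    unit : ∀ H f′ → Last 0ℤ (co H) 0 → (∀ j → co H j ≡ 0ℤ → coeff f′ j ≡ 0ℚ) →
      coeff f′ 0 ≢ 0ℚ → IsUnit f′
    unit H f′ l z nz = constant-unit f′ nz λ j → z (suc j) (0∣⇒≡0 (proj₂ l (suc j) (s≤s z≤n)))
    f₀≢0 : coeff f 0 ≢ 0ℚ
    f₀≢0 = mulP-constantˡ f g P₀
    g₀≢0 : coeff g 0 ≢ 0ℚ
    g₀≢0 = mulP-constantʳ f g P₀
    nontrivial : ∀ d e → Last 0ℤ (co F) (suc d) → Last 0ℤ (co G) (suc e) → ⊥
    nontrivial d e lF lG = impossible (suc d) (suc e) (s≤s z≤n) (s≤s z≤n)
      (degrees-add k≤n F G lF lG FG)
      record { F = F ; G = G ; lastF = lF ; lastG = lG ; FG = FG }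
    cases : ∃ (Last 0ℤ (co F)) ⊎ (∀ j → 0ℤ ∣ℤ co F j) → ∃ (Last 0ℤ (co G)) ⊎ (∀ j → 0ℤ ∣ℤ co G j) →
      IsUnit f ⊎ IsUnit g
    cases (inj₂ all) _ = contradiction (trans (sym c₀) (cong (ℤ._* co G 0) (0∣⇒≡0 (all 0)))) λ ()
    cases _ (inj₂ all) = contradiction
      (trans (sym c₀) (trans (cong (co F 0 ℤ.*_) (0∣⇒≡0 (all 0))) (ℤP.*-zeroʳ (co F 0)))) λ ()
    cases (inj₁ (zero , lF)) _ = inj₁ (unit F f lF zF f₀≢0)
    cases _ (inj₁ (zero , lG)) = inj₂ (unit G g lG zG g₀≢0)
    cases (inj₁ (suc d , lF)) (inj₁ (suc e , lG)) = ⊥-elim (nontrivial d e lF lG)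

conv-sucʳ : ∀ (f g : Seq) m → conv f g (suc m) ≡ f (suc m) ℤ.* g 0 ℤ.+ conv f (g ∘ suc) m
conv-sucʳ f g zero    = ℤP.+-comm (f 0 ℤ.* g 1) (f 1 ℤ.* g 0)
conv-sucʳ f g (suc m) =
  trans (cong (λ z → f 0 ℤ.* g (suc (suc m)) ℤ.+ z) (conv-sucʳ (f ∘ suc) g m))
    (lem (f 0 ℤ.* g (suc (suc m))) (f (suc (suc m)) ℤ.* g 0) (conv (f ∘ suc) (g ∘ suc) m))
  where
  lem : ∀ x y z → x ℤ.+ (y ℤ.+ z) ≡ y ℤ.+ (x ℤ.+ z)
  lem = solve-∀

conv-comm : ∀ (f g : Seq) m → conv f g m ≡ conv g f m
conv-comm f g zero    = ℤP.*-comm (f 0) (g 0)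
conv-comm f g (suc m) = trans (cong₂ ℤ._+_ (ℤP.*-comm (f 0) (g (suc m))) (conv-comm (f ∘ suc) g m))
  (sym (conv-sucʳ g f m))

swap : ∀ {n k d e} → Factorisation n k d e → Factorisation n k e d
swap φ = record { F = G ; G = F ; lastF = lastG ; lastG = lastF
  ; FG = λ m → trans (conv-comm (co G) (co F) m) (FG m) }
  where open Factorisation φ

unit-square : ∀ x y → x ℤ.* y ≡ 1ℤ → x ≡ y × x ℤ.* x ≡ 1ℤ
unit-square x y h = x≡y , trans (cong (x ℤ.*_) x≡y) h
  where
  one : ℤ.∣ x ∣ ≡ 1
  one = ℕP.m*n≡1⇒m≡1 ℤ.∣ x ∣ ℤ.∣ y ∣ (trans (sym (ℤP.abs-* x y)) (cong ℤ.∣_∣ h))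
  sq : x ℤ.* x ≡ 1ℤ
  sq = go x one
    where
    go : ∀ x → ℤ.∣ x ∣ ≡ 1 → x ℤ.* x ≡ 1ℤ
    go (pos 1)        refl = refl
    go (ℤ.-[1+ 0 ]) refl = refl
  x≡y : x ≡ y
  x≡y = begin
    x ≡⟨ sym (ℤP.*-identityʳ x) ⟩
    x ℤ.* 1ℤ ≡⟨ cong (x ℤ.*_) (sym h) ⟩
    x ℤ.* (x ℤ.* y) ≡⟨ sym (ℤP.*-assoc x x y) ⟩
    x ℤ.* x ℤ.* y ≡⟨ cong (ℤ._* y) sq ⟩
    1ℤ ℤ.* y ≡⟨ ℤP.*-identityˡ y ⟩
    y ∎
    where open ≡-Reasoning

-- The constant terms of F and G have product 1, so both are 1 or both are -1; multiplying both
-- factors by F(0) makes them 1 and leaves the product unchanged.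
noFactor-sound : ∀ r n k d e → d + e ≡ k → noFactor (suc r) n k d ≡ true → ¬ Factorisation n k d e
noFactor-sound r n k d e d+e check φ =
  no-monic-factor (suc r) n k d e (λ j → a ℤ.* co F j) (λ j → a ℤ.* co G j) d+e
    (proj₂ u) (trans (cong (ℤ._* co G 0) (proj₁ u)) (proj₂ u′))
    (λ j l → zero* (0∣⇒≡0 (proj₂ lastF j l))) (λ j l → zero* (0∣⇒≡0 (proj₂ lastG j l)))
    coefficients check (s≤s z≤n)
  where
  open Factorisation φ
  a = co F 0
  u = unit-square a (co G 0) (FG 0)
  u′ = unit-square (co G 0) a (trans (ℤP.*-comm (co G 0) a) (FG 0))
  zero* : ∀ {x} → x ≡ 0ℤ → a ℤ.* x ≡ 0ℤ
  zero* refl = ℤP.*-zeroʳ a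
  coefficients : ∀ m → m ≤ k → conv (λ j → a ℤ.* co F j) (λ j → a ℤ.* co G j) m ≡ pos (n C m)
  coefficients m m≤k = begin
    conv (λ j → a ℤ.* co F j) (λ j → a ℤ.* co G j) m ≡⟨ conv-scaleˡ a (co F) _ m ⟩
    a ℤ.* conv (co F) (λ j → a ℤ.* co G j) m ≡⟨ cong (a ℤ.*_) (conv-scaleʳ a (co F) (co G) m) ⟩
    a ℤ.* (a ℤ.* conv (co F) (co G) m) ≡⟨ sym (ℤP.*-assoc a a _) ⟩
    a ℤ.* a ℤ.* conv (co F) (co G) m ≡⟨ cong₂ ℤ._*_ (proj₂ u) (FG m) ⟩
    1ℤ ℤ.* co (truncated n k) m ≡⟨ ℤP.*-identityˡ _ ⟩
    co (truncated n k) m ≡⟨ co-truncated n k m m≤k ⟩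
    pos (n C m) ∎
    where open ≡-Reasoning

∨-true : ∀ a b → a ∨ b ≡ true → a ≡ true ⊎ b ≡ true
∨-true true  b _ = inj₁ refl
∨-true false b h = inj₂ h

not-true : ∀ a → not a ≡ true → a ≢ true
not-true false _ ()

-- The entries of the list serve the degrees d, d + 1, ... in turn, and the list may end only beyond
-- k/2, where the smaller of two degrees cannot lie. An entry r stands for the modulus `suc r`,
-- which is visibly nonzero.
refutes : ℕ → ℕ → ℕ → List ℕ → Bool
refutes n k d []       = k ℕ.<ᵇ d + d
refutes n k d (r ∷ rs) = noFactor (suc r) n k d ∧ refutes n k (suc d) rs

refutes-sound : ∀ n k d rs → refutes n k d rs ≡ true → ∀ d′ e → d ≤ d′ → d′ ≤ e → d′ + e ≡ k →
  ¬ Factorisation n k d′ e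
refutes-sound n k d [] h d′ e d≤d′ d′≤e refl =
  contradiction (ℕP.<ᵇ⇒< k (d + d) (subst T (sym h) _))
    (ℕP.≤⇒≯ (ℕP.+-mono-≤ d≤d′ (≤-trans d≤d′ d′≤e)))
refutes-sound n k d (r ∷ rs) h d′ e d≤d′ d′≤e d′+e with ∧-true (noFactor (suc r) n k d) _ h | ℕP.m≤n⇒m<n∨m≡n d≤d′
... | hd , tl | inj₁ d<d′ = refutes-sound n k (suc d) rs tl d′ e d<d′ d′≤e d′+e
... | hd , tl | inj₂ refl = noFactor-sound r n k d e d′+e hd

-- Pairs (k, n) for which primes above k do not suffice, with for each d ≤ k/2 one less
-- than a modulus that excludes a factor of degree d.
Exceptions : Set
Exceptions = List (ℕ × ℕ × List ℕ)

exceptions : Exceptions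
exceptions =
  (2 , 4 , 3 ∷ []) ∷ (2 , 18 , 4 ∷ []) ∷
  (3 , 6 , 8 ∷ []) ∷ (3 , 9 , 8 ∷ []) ∷ (3 , 12 , 8 ∷ []) ∷ (3 , 27 , 10 ∷ []) ∷
  (4 , 8 , 2 ∷ 2 ∷ []) ∷ (4 , 100 , 12 ∷ 8 ∷ []) ∷ (5 , 10 , 12 ∷ 24 ∷ []) ∷
  (6 , 12 , 8 ∷ 8 ∷ 3 ∷ []) ∷ (8 , 16 , 3 ∷ 3 ∷ 3 ∷ 3 ∷ []) ∷ []

valid : Exceptions → Bool
valid []                  = true
valid ((k , n , rs) ∷ xs) = refutes n k 1 rs ∧ valid xs

exceptional : ℕ → ℕ → Exceptions → Bool
exceptional k n []                   = false
exceptional k n ((k′ , n′ , rs) ∷ xs) = ((k ℕ.≡ᵇ k′) ∧ (n ℕ.≡ᵇ n′)) ∨ exceptional k n xs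

exceptional-sound : ∀ k n xs → valid xs ≡ true → exceptional k n xs ≡ true →
  ∀ d e → 0 < d → d ≤ e → d + e ≡ k → ¬ Factorisation n k d e
exceptional-sound k n ((k′ , n′ , rs) ∷ xs) v h d e 0<d d≤e d+e
  with ∧-true (refutes n′ k′ 1 rs) _ v | ∨-true ((k ℕ.≡ᵇ k′) ∧ (n ℕ.≡ᵇ n′)) _ h
... | _  , v′ | inj₂ h′ = exceptional-sound k n xs v′ h′ d e 0<d d≤e d+e
... | v₀ , _  | inj₁ h₀ with ∧-true (k ℕ.≡ᵇ k′) _ h₀
...   | hk , hn = subst₂ (λ k n → d + e ≡ k → ¬ Factorisation n k d e)
        (sym (≡ᵇ-true k k′ hk)) (sym (≡ᵇ-true n n′ hn)) (refutes-sound n′ k′ 1 rs v₀ d e 0<d d≤e) d+e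

exceptions-valid : valid exceptions ≡ true
exceptions-valid = refl

-- Small k

-- The first argument is fuel. No divisor of n from 2 to m has turned up so far, and n is prime once
-- n < (m + 1)².
trial : ℕ → ℕ → ℕ → Bool
trial zero    n m = false
trial (suc l) n m = (n ℕ.<ᵇ suc m * suc m) ∨ (not (n % suc m ℕ.≡ᵇ 0) ∧ trial l n (suc m))

trial-sound : ∀ l n m → 1 < n → suc m Rough n → trial l n m ≡ true → Prime n
trial-sound (suc l) n m 1<n rough h with ∨-true (n ℕ.<ᵇ suc m * suc m) _ h
... | inj₁ h₁ = rough∧square>⇒prime ⦃ ℕ.n>1⇒nonTrivial 1<n ⦄ rough
  (ℕP.<ᵇ⇒< n (suc m * suc m) (subst T (sym h₁) _))
... | inj₂ h₂ with ∧-true (not (n % suc m ℕ.≡ᵇ 0)) _ h₂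
...   | h₃ , h₄ = trial-sound l n (suc m) 1<n (∤⇒rough-suc m∤n rough) h₄
  where
  m∤n : suc m ∤ n
  m∤n d = not-true _ h₃ (cong (ℕ._≡ᵇ 0) (ℕ∣.n∣m⇒m%n≡0 n (suc m) d))

-- The fuel admits trial divisors far above the square root of 69833, the largest number tested.
primeᵇ : ℕ → Bool
primeᵇ n = (1 ℕ.<ᵇ n) ∧ trial 1000 n 1

primeᵇ-sound : ∀ n → primeᵇ n ≡ true → Prime n
primeᵇ-sound n h with ∧-true (1 ℕ.<ᵇ n) _ h
... | h₁ , h₂ = trial-sound 1000 n 1 (ℕP.<ᵇ⇒< 1 n (subst T (sym h₁) _)) 2-rough h₂

allPrimeᵇ : List ℕ → Bool
allPrimeᵇ []       = true
allPrimeᵇ (p ∷ ps) = primeᵇ p ∧ allPrimeᵇ ps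

allPrimeᵇ-sound : ∀ ps → allPrimeᵇ ps ≡ true → All Prime ps
allPrimeᵇ-sound []       _ = []
allPrimeᵇ-sound (p ∷ ps) h with ∧-true (primeᵇ p) _ h
... | h₁ , h₂ = primeᵇ-sound p h₁ ∷ allPrimeᵇ-sound ps h₂

-- The stock from which `one` and `two` draw their witnesses; up to 397 it decides every pair of the
-- table outside `exceptions`.
smallPrimes : List ℕ
smallPrimes =
  2 ∷ 3 ∷ 5 ∷ 7 ∷ 11 ∷ 13 ∷ 17 ∷ 19 ∷ 23 ∷ 29 ∷ 31 ∷ 37 ∷ 41 ∷ 43 ∷ 47 ∷ 53 ∷ 59 ∷ 61 ∷ 67 ∷
  71 ∷ 73 ∷ 79 ∷ 83 ∷ 89 ∷ 97 ∷ 101 ∷ 103 ∷ 107 ∷ 109 ∷ 113 ∷ 127 ∷ 131 ∷ 137 ∷ 139 ∷ 149 ∷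
  151 ∷ 157 ∷ 163 ∷ 167 ∷ 173 ∷ 179 ∷ 181 ∷ 191 ∷ 193 ∷ 197 ∷ 199 ∷ 211 ∷ 223 ∷ 227 ∷ 229 ∷
  233 ∷ 239 ∷ 241 ∷ 251 ∷ 257 ∷ 263 ∷ 269 ∷ 271 ∷ 277 ∷ 281 ∷ 283 ∷ 293 ∷ 307 ∷ 311 ∷ 313 ∷
  317 ∷ 331 ∷ 337 ∷ 347 ∷ 349 ∷ 353 ∷ 359 ∷ 367 ∷ 373 ∷ 379 ∷ 383 ∷ 389 ∷ 397 ∷ []

smallPrimes-prime : All Prime smallPrimes
smallPrimes-prime = allPrimeᵇ-sound smallPrimes refl

-- The only index i < p with p dividing n - i is n mod p; what remains to be tested is k < p, i ≤ k
-- and that p² does not divide n - i.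
simple : ℕ → ℕ → ℕ → Bool
simple k n zero      = false
simple k n p@(suc _) = (k ℕ.<ᵇ p) ∧ ((n % p ℕ.<ᵇ suc k) ∧ not ((n ∸ n % p) %² p ℕ.≡ᵇ 0))
  where
  _%²_ : ℕ → (p : ℕ) .⦃ _ : NonZero p ⦄ → ℕ
  n %² p@(suc _) = n % (p * p)

residue : ℕ → ℕ → ℕ
residue n zero      = 0
residue n p@(suc _) = n % p

two : ℕ → ℕ → ℕ → List ℕ → Bool
two k n i []       = false
two k n i (p ∷ ps) =
  (simple k n p ∧ (not (residue n p ℕ.≡ᵇ i) ∧ not (residue n p + i ℕ.≡ᵇ k))) ∨ two k n i ps

-- The first simple prime puts its index i into the set of d and e. This is absurd if i is 0 or k;
-- otherwise d and e are i and k - i, and `two` looks for a simple prime with yet another index.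
one : ℕ → ℕ → List ℕ → Bool
one k n []       = false
one k n (p ∷ ps) = if simple k n p
  then (residue n p ℕ.≡ᵇ 0) ∨ ((residue n p ℕ.≡ᵇ k) ∨ two k n (residue n p) ps)
  else one k n ps

module _ {n k d e : ℕ} (k≤n : k ≤ n) (D : Degrees n k d e) where
  open Degrees D

  simple-sound : ∀ p → Prime p → simple k n p ≡ true → residue n p ≡ d ⊎ residue n p ≡ e
  simple-sound zero      pr ()
  simple-sound p@(suc _) pr h with ∧-true (k ℕ.<ᵇ p) _ h
  ... | h₁ , h′ with ∧-true (n % p ℕ.<ᵇ suc k) _ h′
  ...   | h₂ , h₃ = once p (n % p) pr (ℕP.<ᵇ⇒< k p (subst T (sym h₁) _))
    (ℕP.≤-pred (ℕP.<ᵇ⇒< (n % p) (suc k) (subst T (sym h₂) _)))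
    (ℕ∣.divides (n /ℕ p) (trans (cong (_∸ n % p) (m≡m%n+[m/n]*n n p)) (ℕP.m+n∸m≡n (n % p) _)))
    λ p² → not-true _ h₃ (cong (ℕ._≡ᵇ 0) (ℕ∣.n∣m⇒m%n≡0 (n ∸ n % p) (p * p) p²))

  other : ∀ {i j} → i ≡ d ⊎ i ≡ e → j ≡ d ⊎ j ≡ e → j ≢ i → j + i ≢ k → ⊥
  other (inj₁ refl) (inj₁ refl) ne _ = ne refl
  other (inj₁ refl) (inj₂ refl) _ ne = ne (trans (+-comm e d) d+e)
  other (inj₂ refl) (inj₁ refl) _ ne = ne d+e
  other (inj₂ refl) (inj₂ refl) ne _ = ne refl

  two-sound : ∀ i ps → All Prime ps → i ≡ d ⊎ i ≡ e → two k n i ps ≢ true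
  two-sound i (p ∷ ps) (pr ∷ prs) i∈ h
    with ∨-true (simple k n p ∧ (not (residue n p ℕ.≡ᵇ i) ∧ not (residue n p + i ℕ.≡ᵇ k))) _ h
  ... | inj₂ h′ = two-sound i ps prs i∈ h′
  ... | inj₁ h′ with ∧-true (simple k n p) _ h′
  ...   | h₁ , h″ with ∧-true (not (residue n p ℕ.≡ᵇ i)) _ h″
  ...     | h₂ , h₃ = other i∈ (simple-sound p pr h₁)
    (λ eq → not-true _ h₂ (≡⇒≡ᵇ-true eq)) (λ eq → not-true _ h₃ (≡⇒≡ᵇ-true eq))
    where
    T-true : ∀ b → T b → b ≡ true
    T-true true _ = refl
    ≡⇒≡ᵇ-true : ∀ {m n} → m ≡ n → (m ℕ.≡ᵇ n) ≡ true
    ≡⇒≡ᵇ-true {m} {n} eq = T-true _ (ℕP.≡⇒≡ᵇ m n eq)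

  inner : ∀ {i} → i ≡ d ⊎ i ≡ e → i ≢ 0 × i ≢ k
  inner (inj₁ refl) = >⇒≢ 0<d , <⇒≢ (subst (d <_) d+e (ℕP.m<m+n d 0<e))
  inner (inj₂ refl) = >⇒≢ 0<e , <⇒≢ (subst (e <_) d+e (ℕP.m<n+m e 0<d))

  one-sound : ∀ ps → All Prime ps → one k n ps ≢ true
  one-sound (p ∷ ps) (pr ∷ prs) h with simple k n p in eq
  ... | false = one-sound ps prs h
  ... | true with simple-sound p pr eq | ∨-true (residue n p ℕ.≡ᵇ 0) _ h
  ...   | i∈ | inj₁ h₀ = proj₁ (inner i∈) (≡ᵇ-true _ 0 h₀)
  ...   | i∈ | inj₂ h′ with ∨-true (residue n p ℕ.≡ᵇ k) _ h′
  ...     | inj₁ hk = proj₂ (inner i∈) (≡ᵇ-true _ k hk)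
  ...     | inj₂ h₂ = two-sound (residue n p) ps prs i∈ h₂

module Table (ps : List ℕ) (xs : Exceptions) where

  range : ℕ → ℕ → ℕ → Bool
  range k n zero    = true
  range k n (suc l) = (one k n ps ∨ exceptional k n xs) ∧ range k (suc n) l

  range-sound : ∀ k n l → range k n l ≡ true → ∀ m → n ≤ m → m < n + l →
    one k m ps ≡ true ⊎ exceptional k m xs ≡ true
  range-sound k n zero    h m n≤m m<n+l =
    contradiction (subst (m <_) (+-identityʳ n) m<n+l) (ℕP.≤⇒≯ n≤m)
  range-sound k n (suc l) h m n≤m m<n+l
    with ∧-true (one k n ps ∨ exceptional k n xs) _ h | ℕP.m≤n⇒m<n∨m≡n n≤m
  ... | _  , h′ | inj₁ n<m  = range-sound k (suc n) l h′ m n<m (subst (m <_) (+-suc n l) m<n+l)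
  ... | h₀ , _  | inj₂ refl = ∨-true _ _ h₀

  rows : (ℕ → ℕ) → ℕ → ℕ → Bool
  rows bound k zero    = true
  rows bound k (suc l) = range k (2 * k) (bound k ∸ 2 * k) ∧ rows bound (suc k) l

  rows-sound : ∀ bound k l → rows bound k l ≡ true → ∀ k′ → k ≤ k′ → k′ < k + l →
    ∀ n → 2 * k′ ≤ n → n < bound k′ → one k′ n ps ≡ true ⊎ exceptional k′ n xs ≡ true
  rows-sound bound k zero    h k′ k≤k′ k′< n _ _ =
    contradiction (subst (k′ <_) (+-identityʳ k) k′<) (ℕP.≤⇒≯ k≤k′)
  rows-sound bound k (suc l) h k′ k≤k′ k′< n lo hi
    with ∧-true (range k (2 * k) (bound k ∸ 2 * k)) _ h | ℕP.m≤n⇒m<n∨m≡n k≤k′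
  ... | _  , h′ | inj₁ k<k′ = rows-sound bound (suc k) l h′ k′ k<k′ (subst (k′ <_) (+-suc k l) k′<) n lo hi
  ... | h₀ , _  | inj₂ refl = range-sound k (2 * k) (bound k ∸ 2 * k) h₀ n lo
    (<-≤-trans hi (ℕP.m≤n+m∸n (bound k) (2 * k)))

-- 17576 = 26³: beyond it the counting argument works for all k that remain, i.e. k ≥ 26.
tableBound : ℕ → ℕ
tableBound k = (k + 1) ^ 3 ℕ.⊓ 17576

table-true : Table.rows smallPrimes exceptions tableBound 2 50 ≡ true
table-true = refl

small-case : ∀ {n k} → 2 ≤ k → k < 52 → 2 * k ≤ n → n < tableBound k →
  ∀ {d e} → d + e ≡ k → Degrees n k d e → ¬ Factorisation n k d e
small-case {n} {k} 2≤k k<52 2k≤n n<b {d} {e} d+e D φ =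
  cases (Table.rows-sound smallPrimes exceptions tableBound 2 50 table-true k 2≤k k<52 n 2k≤n n<b)
  where
  open Degrees D using (0<d; 0<e)
  cases : one k n smallPrimes ≡ true ⊎ exceptional k n exceptions ≡ true → ⊥
  cases (inj₁ h) = one-sound (≤-trans (m≤m+n k (k + 0)) 2k≤n) D smallPrimes smallPrimes-prime h
  cases (inj₂ h) with ℕP.≤-total d e
  ... | inj₁ d≤e = exceptional-sound k n exceptions exceptions-valid h d e 0<d d≤e d+e φ
  ... | inj₂ e≤d = exceptional-sound k n exceptions exceptions-valid h e d 0<e e≤d
    (trans (+-comm e d) d+e) (swap φ)

-- Terms of a progression with small prime factors only

∏ : (ℕ → ℕ) → ℕ → ℕ
∏ f zero    = 1
∏ f (suc m) = ∏ f m * f m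

∏-cong : ∀ {f g} m → (∀ j → f j ≡ g j) → ∏ f m ≡ ∏ g m
∏-cong zero    e = refl
∏-cong (suc m) e = cong₂ _*_ (∏-cong m e) (e m)

∏-head : ∀ f m → ∏ f (suc m) ≡ f 0 * ∏ (f ∘ suc) m
∏-head f zero    = trans (ℕP.*-identityˡ (f 0)) (sym (ℕP.*-identityʳ (f 0)))
∏-head f (suc m) = trans (cong (_* f (suc m)) (∏-head f m)) (ℕP.*-assoc (f 0) _ (f (suc m)))

∏-* : ∀ f g m → ∏ (λ j → f j * g j) m ≡ ∏ f m * ∏ g m
∏-* f g zero    = refl
∏-* f g (suc m) = trans (cong (_* (f m * g m)) (∏-* f g m)) (lem (∏ f m) (∏ g m) (f m) (g m))
  where
  lem : ∀ a b c d → a * b * (c * d) ≡ a * c * (b * d)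
  lem = solveℕ-∀

∣-∏ : ∀ f m j → j < m → f j ∣ ∏ f m
∣-∏ f (suc m) j (s≤s j≤m) with ℕP.m≤n⇒m<n∨m≡n j≤m
... | inj₁ j<m  = ℕ∣.∣m⇒∣m*n (f m) (∣-∏ f m j j<m)
... | inj₂ refl = ℕ∣.∣n⇒∣m*n (∏ f m) ℕ∣.∣-refl

∏>0 : ∀ f m → (∀ j → 0 < f j) → 0 < ∏ f m
∏>0 f zero    h = s≤s z≤n
∏>0 f (suc m) h = *-mono-< (∏>0 f m h) (h m)

-- Two overlapping windows: the product of m + 2 terms from a to c is the product of the first m + 1
-- times c, and also a times the product of the last m + 1. By induction it divides both c M and a M
-- with M = δ^m m! L, hence (c - a) M, and c - a = (m + 1) δ.
window : ∀ δ m a L → (∀ j → j < suc m → a + j * δ ∣ L) →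
  ∏ (λ j → a + j * δ) (suc m) ∣ δ ^ m * m ! * L
window δ zero    a L h = subst₂ _∣_ (sym (trans (ℕP.*-identityˡ _) (+-identityʳ a)))
  (sym (ℕP.*-identityˡ L)) (subst (_∣ L) (+-identityʳ a) (h 0 (s≤s z≤n)))
window δ (suc m) a L h = ℕ∣.∣m+n∣m⇒∣n (subst (full ∣_) split (ℕ∣.*-monoˡ-∣ c front)) whole∣
  where
  M = δ ^ m * m ! * L
  f : ℕ → ℕ
  f j = a + j * δ
  full = ∏ f (suc (suc m))
  c = f (suc m)
  back = ∏ (λ j → a + δ + j * δ) (suc m)
  front : ∏ f (suc m) ∣ M
  front = window δ m a L λ j j<m → h j (ℕP.m<n⇒m<1+n j<m)
  rear : back ∣ M
  rear = window δ m (a + δ) L λ j j<m → subst (_∣ L) (sym (ℕP.+-assoc a δ (j * δ))) (h (suc j) (s≤s j<m))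
  full≡ : full ≡ a * back
  full≡ = trans (∏-head f (suc m)) (cong₂ _*_ (+-identityʳ a)
    (∏-cong (suc m) λ j → sym (ℕP.+-assoc a δ (j * δ))))
  whole∣ : full ∣ a * M
  whole∣ = subst (_∣ a * M) (sym full≡) (ℕ∣.*-monoʳ-∣ a rear)
  lem : ∀ a m δ x y L → x * y * L * (a + (δ + m * δ)) ≡ a * (x * y * L) + δ * x * (y + m * y) * L
  lem = solveℕ-∀
  split : M * c ≡ a * M + δ ^ suc m * (suc m) ! * L
  split = lem a m δ (δ ^ m) (m !) L

-- v is the p-adic valuation of x, and r is the part of x prime to p.
PFree : ℕ → ℕ → Set
PFree p x = ∃₂ λ v r → x ≡ p ^ v * r × p ∤ r

prime>0 : ∀ {p} → Prime p → 0 < p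
prime>0 pr = ℕP.<-trans (s≤s z≤n) (prime>1 pr)

valuation : ∀ {p} → Prime p → ∀ x → 0 < x → PFree p x
valuation {p} pr x 0<x = go x x 0<x ≤-refl
  where
  go : ∀ b x → 0 < x → x ≤ b → PFree p x
  go zero    x 0<x x≤b = contradiction 0<x (ℕP.≤⇒≯ x≤b)
  go (suc b) x 0<x x≤b with p ℕ∣.∣? x
  ... | no  p∤x = 0 , x , sym (+-identityʳ x) , p∤x
  ... | yes (divides zero refl) = contradiction 0<x λ ()
  ... | yes (divides q@(suc _) refl)
    with go b q (s≤s z≤n) (ℕP.≤-pred (<-≤-trans (ℕP.m<m*n q p (prime>1 pr)) x≤b))
  ...   | v , r , e , p∤r = suc v , r , trans (cong (_* p) e) (lem (p ^ v) r p) , p∤r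
    where
    lem : ∀ x r p → x * r * p ≡ p * x * r
    lem = solveℕ-∀

^-cancel : ∀ {p} → Prime p → ∀ a x y → p ∤ x → p ^ a ∣ x * y → p ^ a ∣ y
^-cancel pr zero    x y p∤x h = ℕ∣.1∣ y
^-cancel {p} pr (suc a) x y p∤x h with euclidsLemma x y pr (ℕ∣.∣-trans (ℕ∣.m∣m*n (p ^ a)) h)
... | inj₁ d = contradiction d p∤x
... | inj₂ (divides y′ refl) = subst (p ^ suc a ∣_) (ℕP.*-comm p y′)
  (ℕ∣.*-monoʳ-∣ p (^-cancel pr a x y′ p∤x
    (ℕ∣.*-cancelˡ-∣ p ⦃ prime⇒nonZero pr ⦄ (subst (p ^ suc a ∣_) (lem x y′ p) h))))
  where
  lem : ∀ x y p → x * (y * p) ≡ p * (x * y)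
  lem = solveℕ-∀

^∣⇒≤ : ∀ {p} → Prime p → ∀ a v r → p ∤ r → p ^ a ∣ p ^ v * r → a ≤ v
^∣⇒≤ pr zero    v       r p∤r h = z≤n
^∣⇒≤ {p} pr (suc a) zero    r p∤r h =
  contradiction (ℕ∣.∣-trans (ℕ∣.m∣m*n (p ^ a)) (subst (p ^ suc a ∣_) (+-identityʳ r) h)) p∤r
^∣⇒≤ {p} pr (suc a) (suc v) r p∤r h = s≤s (^∣⇒≤ pr a v r p∤r
  (ℕ∣.*-cancelˡ-∣ p ⦃ prime⇒nonZero pr ⦄ (subst (p ^ suc a ∣_) (ℕP.*-assoc p (p ^ v) r) h)))

^-mono-∣ : ∀ p {a b} → a ≤ b → p ^ a ∣ p ^ b
^-mono-∣ p {a} {b} a≤b = divides (p ^ (b ∸ a))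
  (trans (cong (p ^_) (sym (ℕP.m∸n+n≡m a≤b))) (ℕP.^-distribˡ-+-* p (b ∸ a) a))

-- The p-adic valuation of x is at most that of y, expressed without valuations.
Dominates : ℕ → ℕ → ℕ → Set
Dominates p x y = ∀ a → p ^ a ∣ x → p ^ a ∣ y

dominates-total : ∀ {p} → Prime p → ∀ x y → 0 < x → 0 < y → Dominates p x y ⊎ Dominates p y x
dominates-total {p} pr x y 0<x 0<y with valuation pr x 0<x | valuation pr y 0<y
... | v , r , refl , p∤r | w , s , refl , p∤s with ℕP.≤-total v w
...   | inj₁ v≤w = inj₁ λ a h → ℕ∣.∣m⇒∣m*n s (^-mono-∣ p (≤-trans (^∣⇒≤ pr a v r p∤r h) v≤w))
...   | inj₂ w≤v = inj₂ λ a h → ℕ∣.∣m⇒∣m*n r (^-mono-∣ p (≤-trans (^∣⇒≤ pr a w s p∤s h) w≤v))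

argmax : ∀ {p} → Prime p → (f : ℕ → ℕ) → (∀ j → 0 < f j) → ∀ m →
  ∃ λ i → i < suc m × (∀ j → j < suc m → Dominates p (f j) (f i))
argmax pr f f>0 zero    = 0 , s≤s z≤n , λ { zero _ a h → h ; (suc j) (s≤s ()) }
argmax {p} pr f f>0 (suc m) with argmax pr f f>0 m
... | i , i<m , dom with dominates-total pr (f i) (f (suc m)) (f>0 i) (f>0 (suc m))
...   | inj₁ le = suc m , ≤-refl , λ j → last j ∘ ℕP.m≤n⇒m<n∨m≡n ∘ ℕP.≤-pred
  where
  last : ∀ j → j < suc m ⊎ j ≡ suc m → Dominates p (f j) (f (suc m))
  last j (inj₁ j<m)  = λ a h → le a (dom j j<m a h)
  last j (inj₂ refl) = λ a h → h
...   | inj₂ ge = i , ℕP.m<n⇒m<1+n i<m , λ j → last j ∘ ℕP.m≤n⇒m<n∨m≡n ∘ ℕP.≤-pred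
  where
  last : ∀ j → j < suc m ⊎ j ≡ suc m → Dominates p (f j) (f i)
  last j (inj₁ j<m)  = dom j j<m
  last j (inj₂ refl) = ge

prime-divisor : ∀ m → 1 < m → ∃ λ p → Prime p × p ∣ m
prime-divisor m 1<m with factorise m ⦃ ℕ.>-nonZero (ℕP.<-trans (s≤s z≤n) 1<m) ⦄
... | record { factors = [] ; isFactorisation = refl } = contradiction 1<m λ { (s≤s ()) }
... | record { factors = p ∷ ps ; isFactorisation = refl ; factorsPrime = pr ∷ _ } =
  p , pr , ℕ∣.m∣m*n (product ps)

∣-by-prime-powers : ∀ m L → 0 < m → (∀ p a → Prime p → p ^ a ∣ m → p ^ a ∣ L) → m ∣ L
∣-by-prime-powers m L 0<m = go m m 0<m ≤-refl
  where
  go : ∀ b m → 0 < m → m ≤ b → (∀ p a → Prime p → p ^ a ∣ m → p ^ a ∣ L) → m ∣ L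
  go zero    m 0<m m≤b h = contradiction 0<m (ℕP.≤⇒≯ m≤b)
  go (suc b) 1 _ _ h = ℕ∣.1∣ L
  go (suc b) m@(suc (suc _)) 0<m m≤b h with prime-divisor m (s≤s (s≤s z≤n))
  ... | p , pr , p∣m with valuation pr m 0<m
  ...   | zero , r , e , p∤r =
    contradiction (subst (p ∣_) (trans e (+-identityʳ r)) p∣m) p∤r
  ...   | suc v , zero , e , p∤r = contradiction (p ℕ∣.∣0) p∤r
  ...   | suc v , r@(suc _) , e , p∤r = combine (go b r (s≤s z≤n) r≤b
      λ q a qr d → h q a qr (subst (q ^ a ∣_) (sym e) (ℕ∣.∣n⇒∣m*n (p ^ suc v) d)))
    where
    r≤b : r ≤ b
    r≤b = ℕP.≤-pred (<-≤-trans (subst (r <_) (sym (trans e (ℕP.*-comm (p ^ suc v) r)))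
      (ℕP.m<m*n r (p ^ suc v) (<-≤-trans (prime>1 pr)
        (ℕP.m≤m*n p (p ^ v) ⦃ ℕP.m^n≢0 p v ⦃ prime⇒nonZero pr ⦄ ⦄)))) m≤b)
    combine : r ∣ L → m ∣ L
    combine (divides s eL) = subst₂ _∣_ (sym e) (sym eL) (ℕ∣.*-monoˡ-∣ r
      (^-cancel pr (suc v) r s p∤r (subst (p ^ suc v ∣_) (trans eL (ℕP.*-comm s r))
        (h p (suc v) pr (subst (p ^ suc v ∣_) (sym e) (ℕ∣.m∣m*n r))))))

Smooth : ℕ → ℕ → Set
Smooth k x = ∀ p → Prime p → p ∣ x → p ≤ k

smooth-or-large : ∀ k x → 0 < x → Smooth k x ⊎ ∃ λ p → Prime p × k < p × p ∣ x
smooth-or-large k x 0<x with factorise x ⦃ ℕ.>-nonZero 0<x ⦄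
... | record { factors = ps ; isFactorisation = refl ; factorsPrime = prs } = go ps prs
  where
  go : ∀ ps → All Prime ps → Smooth k (product ps) ⊎ ∃ λ p → Prime p × k < p × p ∣ product ps
  go [] [] = inj₁ λ p pr d → contradiction (ℕ∣.∣⇒≤ d) (<⇒≱ (prime>1 pr))
  go (q ∷ qs) (qr ∷ qrs) with q ≤? k | go qs qrs
  ... | no q≰k  | _ = inj₂ (q , qr , ≰⇒> q≰k , ℕ∣.m∣m*n (product qs))
  ... | yes _   | inj₂ (p , pr , k<p , d) = inj₂ (p , pr , k<p , ℕ∣.∣n⇒∣m*n q d)
  ... | yes q≤k | inj₁ sm = inj₁ λ p pr d → case p (euclidsLemma q (product qs) pr d) pr
    where
    case : ∀ p → p ∣ q ⊎ p ∣ product qs → Prime p → p ≤ k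
    case p (inj₁ d) _  = ≤-trans (ℕ∣.∣⇒≤ ⦃ prime⇒nonZero qr ⦄ d) q≤k
    case p (inj₂ d) pr = sm p pr d

choose : {A : Set} → Dec A → ℕ → ℕ → ℕ
choose (yes _) x y = x
choose (no _)  x y = y

∏-split : ∀ (S : List ℕ) f m →
  ∏ (λ j → choose (j ∈? S) (f j) 1) m * ∏ (λ j → choose (j ∈? S) 1 (f j)) m ≡ ∏ f m
∏-split S f m = trans (sym (∏-* _ _ m)) (∏-cong m λ j → pointwise (j ∈? S) (f j))
  where
  pointwise : ∀ {A : Set} (d : Dec A) x → choose d x 1 * choose d 1 x ≡ x
  pointwise (yes _) x = ℕP.*-identityʳ x
  pointwise (no _)  x = +-identityʳ x

count : List ℕ → ℕ → ℕ
count S zero    = 0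
count S (suc m) = count S m + choose (m ∈? S) 1 0

count-≤ : ∀ S m → count S m ≤ length S
count-≤ []      m = ℕP.≤-reflexive (none m)
  where
  none : ∀ m → count [] m ≡ 0
  none zero    = refl
  none (suc m) = trans (+-identityʳ _) (none m)
count-≤ (x ∷ S) m = ≤-trans (add m) (s≤s (count-≤ S m))
  where
  step : ∀ m → choose (m ∈? (x ∷ S)) 1 0 ≤ choose (m ∈? S) 1 0 ⊎ x ≡ m
  step m = go (m ∈? (x ∷ S)) (m ∈? S)
    where
    go : (d : Dec (m ∈ (x ∷ S))) (d′ : Dec (m ∈ S)) → choose d 1 0 ≤ choose d′ 1 0 ⊎ x ≡ m
    go (no _)          _       = inj₁ z≤n
    go (yes _)         (yes _) = inj₁ ≤-refl
    go (yes (here e))  (no _)  = inj₂ (sym e)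
    go (yes (there h)) (no nh) = contradiction h nh
  choose≤1 : ∀ {A : Set} (d : Dec A) → choose d 1 0 ≤ 1
  choose≤1 (yes _) = s≤s z≤n
  choose≤1 (no _)  = z≤n
  before : ∀ m → m ≤ x → count (x ∷ S) m ≤ count S m
  before zero    _ = z≤n
  before (suc m) m<x with step m
  ... | inj₁ le   = ℕP.+-mono-≤ (before m (<⇒≤ m<x)) le
  ... | inj₂ refl = contradiction m<x (ℕP.<-irrefl refl)
  add : ∀ m → count (x ∷ S) m ≤ suc (count S m)
  add zero    = z≤n
  add (suc m) with step m
  ... | inj₁ le   = ℕP.+-mono-≤ (add m) le
  ... | inj₂ refl = ≤-trans (ℕP.+-mono-≤ (before m ≤-refl) (choose≤1 (m ∈? (x ∷ S))))
    (subst (_≤ suc (count S m + choose (m ∈? S) 1 0)) (+-comm 1 (count S m)) (s≤s (m≤m+n _ _)))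

∏-unmarked : ∀ S a (f : ℕ → ℕ) → (∀ j → a ≤ f j) → ∀ m →
  a ^ (m ∸ count S m) ≤ ∏ (λ j → choose (j ∈? S) 1 (f j)) m
∏-unmarked S a f a≤f = go
  where
  g : ℕ → ℕ
  g j = choose (j ∈? S) 1 (f j)
  count-step : ∀ {A : Set} (d : Dec A) c m → c ≤ m → c + choose d 1 0 ≤ suc m
  count-step (yes _) c m h = subst (_≤ suc m) (+-comm 1 c) (s≤s h)
  count-step (no _)  c m h = subst (_≤ suc m) (sym (+-identityʳ c)) (ℕP.m≤n⇒m≤1+n h)
  count≤ : ∀ m → count S m ≤ m
  count≤ zero    = z≤n
  count≤ (suc m) = count-step (m ∈? S) (count S m) m (count≤ m)
  step : ∀ {A : Set} (d : Dec A) c m y x → c ≤ m → a ^ (m ∸ c) ≤ y → a ≤ x →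
    a ^ (suc m ∸ (c + choose d 1 0)) ≤ y * choose d 1 x
  step (yes _) c m y x c≤m h a≤x =
    subst₂ (λ i z → a ^ (suc m ∸ i) ≤ z) (+-comm 1 c) (sym (ℕP.*-identityʳ y)) h
  step (no _)  c m y x c≤m h a≤x =
    subst (λ i → a ^ (suc m ∸ i) ≤ y * x) (sym (+-identityʳ c))
      (subst (λ i → a ^ i ≤ y * x) (sym (ℕP.+-∸-assoc 1 c≤m))
        (subst (_≤ y * x) (ℕP.*-comm (a ^ (m ∸ c)) a) (*-mono-≤ h a≤x)))
  go : ∀ m → a ^ (m ∸ count S m) ≤ ∏ g m
  go zero    = s≤s z≤n
  go (suc m) = step (m ∈? S) (count S m) m (∏ g m) (f m) (count≤ m) (go m) (a≤f m)

-- Erdős's proof of Sylvester's theorem: all terms divide the product of those in ns and,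
-- for each p ≤ k, one with the largest power of p; by window the other terms have product
-- at most δ^m m!.
erdős : ∀ k δ m a → 0 < δ → 0 < a → (ps ns : List ℕ) →
  (∀ p → Prime p → p ≤ k → p ∈ ps) →
  (∀ j → j < suc m → j ∈ ns ⊎ Smooth k (a + j * δ)) →
  a ^ (suc m ∸ (length ps + length ns)) ≤ δ ^ m * m !
erdős k δ m a 0<δ 0<a ps ns ps-all ns-all = begin
  a ^ (suc m ∸ (length ps + length ns)) ≤⟨ ℕP.^-monoʳ-≤ a ⦃ ℕ.>-nonZero 0<a ⦄ (ℕP.∸-monoʳ-≤ (suc m) count≤) ⟩
  a ^ (suc m ∸ count S (suc m)) ≤⟨ ∏-unmarked S a f (λ j → m≤m+n a (j * δ)) (suc m) ⟩
  rest ≤⟨ rest≤ ⟩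
  δ ^ m * m ! ∎
  where
  open ℕP.≤-Reasoning
  f : ℕ → ℕ
  f j = a + j * δ
  f>0 : ∀ j → 0 < f j
  f>0 j = <-≤-trans 0<a (m≤m+n a (j * δ))
  -- Composite entries of `ps` are tolerated: they mark index 0, and only the length of the list is
  -- charged.
  idx : ℕ → ℕ
  idx p with prime? p
  ... | yes pr = proj₁ (argmax pr f f>0 m)
  ... | no _   = 0
  idx-dom : ∀ p → Prime p → idx p < suc m × (∀ j → j < suc m → Dominates p (f j) (f (idx p)))
  idx-dom p pr with prime? p
  ... | yes pr′ = proj₂ (argmax pr′ f f>0 m)
  ... | no ¬pr  = contradiction pr ¬pr
  S = map idx ps ++ ns
  count≤ : count S (suc m) ≤ length ps + length ns
  count≤ = ≤-trans (count-≤ S (suc m)) (ℕP.≤-reflexive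
    (trans (ListP.length-++ (map idx ps)) (cong (_+ length ns) (ListP.length-map idx ps))))
  L = ∏ (λ j → choose (j ∈? S) (f j) 1) (suc m)
  rest = ∏ (λ j → choose (j ∈? S) 1 (f j)) (suc m)
  marked : ∀ j → j < suc m → j ∈ S → f j ∣ L
  marked j j<m j∈ = subst (_∣ L) (eq (j ∈? S)) (∣-∏ (λ j → choose (j ∈? S) (f j) 1) (suc m) j j<m)
    where
    eq : (d : Dec (j ∈ S)) → choose d (f j) 1 ≡ f j
    eq (yes _) = refl
    eq (no ¬j) = contradiction j∈ ¬j
  all∣ : ∀ j → j < suc m → f j ∣ L
  all∣ j j<m with ns-all j j<m
  ... | inj₁ j∈ = marked j j<m (∈P.∈-++⁺ʳ (map idx ps) j∈)
  ... | inj₂ sm = ∣-by-prime-powers (f j) L (f>0 j) powers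
    where
    powers : ∀ p b → Prime p → p ^ b ∣ f j → p ^ b ∣ L
    powers p zero    pr d = ℕ∣.1∣ L
    powers p (suc b) pr d = ℕ∣.∣-trans (proj₂ (idx-dom p pr) j j<m (suc b) d)
      (marked (idx p) (proj₁ (idx-dom p pr)) (∈P.∈-++⁺ˡ (∈P.∈-map⁺ idx
        (ps-all p pr (sm p pr (ℕ∣.∣-trans (ℕ∣.m∣m*n (p ^ b)) d))))))
  L>0 : 0 < L
  L>0 = ∏>0 _ (suc m) λ j → pos? (j ∈? S) j
    where
    pos? : ∀ {A : Set} (d : Dec A) j → 0 < choose d (f j) 1
    pos? (yes _) j = f>0 j
    pos? (no _)  j = s≤s z≤n
  rest≤ : rest ≤ δ ^ m * m !
  -- The whole product is L times `rest` and divides δ^m m! L by `window`; then L cancels.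
  rest≤ = ℕ∣.∣⇒≤ ⦃ ℕ.>-nonZero (*-mono-< (ℕP.m^n>0 δ ⦃ ℕ.>-nonZero 0<δ ⦄ m) (ℕ.>-nonZero⁻¹ (m !) ⦃ m ℕP.!≢0 ⦄)) ⦄
    (ℕ∣.*-cancelˡ-∣ L ⦃ ℕ.>-nonZero L>0 ⦄
      (subst₂ _∣_ (sym (∏-split S f (suc m))) (ℕP.*-comm (δ ^ m * m !) L) (window δ m a L all∣)))

-- Counting primes

T-true : ∀ {b} → T b → b ≡ true
T-true {true} _ = refl

true-T : ∀ {b} → b ≡ true → T b
true-T refl = _

sieve : List ℕ → ℕ → Bool
sieve []       c = true
sieve (q ∷ qs) c = (not (residue c q ℕ.≡ᵇ 0) ∨ (c ℕ.≡ᵇ q)) ∧ sieve qs c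

-- A superset of the primes up to k: composite numbers that pass the sieve only lengthen the list
-- and weaken the count.
candidates : List ℕ → ℕ → List ℕ
candidates qs zero    = []
candidates qs (suc k) = if (1 ℕ.<ᵇ suc k) ∧ sieve qs (suc k) then suc k ∷ candidates qs k else candidates qs k

prime-sieve : ∀ qs → All (1 <_) qs → ∀ p → Prime p → sieve qs p ≡ true
prime-sieve []       _            p pr = refl
prime-sieve (q ∷ qs) (1<q ∷ 1<qs) p pr = cong₂ _∧_ (single q 1<q) (prime-sieve qs 1<qs p pr)
  where
  ∨-introʳ : ∀ a {b} → b ≡ true → a ∨ b ≡ true
  ∨-introʳ true  _ = refl
  ∨-introʳ false h = h
  single : ∀ q → 1 < q → (not (residue p q ℕ.≡ᵇ 0) ∨ (p ℕ.≡ᵇ q)) ≡ true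
  single q@(suc (suc _)) 1<q with p % q in eq
  ... | suc _ = refl
  ... | zero with prime⇒irreducible pr (ℕ∣.m%n≡0⇒n∣m p q eq)
  ...   | inj₂ refl = T-true (ℕP.≡⇒≡ᵇ q q refl)
  single 1 (s≤s ()) 

candidates-complete : ∀ qs → All (1 <_) qs → ∀ k p → Prime p → p ≤ k → p ∈ candidates qs k
candidates-complete qs 1<qs zero    p pr p≤0 = contradiction (<-≤-trans (prime>0 pr) p≤0) λ ()
candidates-complete qs 1<qs (suc k) p pr p≤k with ℕP.m≤n⇒m<n∨m≡n p≤k
... | inj₁ p<k with (1 ℕ.<ᵇ suc k) ∧ sieve qs (suc k)
...   | true  = there (candidates-complete qs 1<qs k p pr (ℕP.≤-pred p<k))
...   | false = candidates-complete qs 1<qs k p pr (ℕP.≤-pred p<k)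
candidates-complete qs 1<qs (suc k) .(suc k) pr _ | inj₂ refl
  rewrite T-true (ℕP.<⇒<ᵇ (prime>1 pr)) | prime-sieve qs 1<qs (suc k) pr = here refl

-- The aim is a density below 1/4. With the primes 2, 3, 5 alone it is 8/30, slightly too much; with
-- 7 it is 48/210.
wheel : List ℕ
wheel = 2 ∷ 3 ∷ 5 ∷ 7 ∷ []

coprime-to : List ℕ → ℕ → Bool
coprime-to []       c = true
coprime-to (q ∷ qs) c = not (residue c q ℕ.≡ᵇ 0) ∧ coprime-to qs c

indicator : Bool → ℕ
indicator true  = 1
indicator false = 0

coprimes : ℕ → ℕ
coprimes zero    = 0
coprimes (suc k) = coprimes k + indicator (coprime-to wheel (suc k))

coprimes-periodic : ∀ k → coprimes (k + 210) ≡ coprimes k + 48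
coprimes-periodic zero    = refl
coprimes-periodic (suc k) = begin
  coprimes (k + 210) + indicator (coprime-to wheel (suc k + 210))
    ≡⟨ cong₂ (λ x b → x + indicator b) (coprimes-periodic k) periodic ⟩
  coprimes k + 48 + indicator (coprime-to wheel (suc k))
    ≡⟨ lem (coprimes k) (indicator (coprime-to wheel (suc k))) ⟩
  coprimes (suc k) + 48 ∎
  where
  open ≡-Reasoning
  lem : ∀ x y → x + 48 + y ≡ x + y + 48
  lem = solveℕ-∀
  c = suc k
  periodic : coprime-to wheel (c + 210) ≡ coprime-to wheel c
  periodic = cong₂ _∧_ (part 2 ([m+kn]%n≡m%n c 105 2)) (cong₂ _∧_ (part 3 ([m+kn]%n≡m%n c 70 3))
    (cong₂ _∧_ (part 5 ([m+kn]%n≡m%n c 42 5)) (cong₂ _∧_ (part 7 ([m+kn]%n≡m%n c 30 7)) refl)))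
    where
    part : ∀ q {x y : ℕ} → x ≡ y → not (x ℕ.≡ᵇ 0) ≡ not (y ℕ.≡ᵇ 0)
    part _ refl = refl

-- The candidates contain 2, 3, 5, 7, which are not prime to 210, and lack 1, which is: hence the 3.
candidates-coprimes : ∀ k → 7 ≤ k → length (candidates wheel k) ≤ coprimes k + 3
candidates-coprimes (suc k) 7≤c with ℕP.m≤n⇒m<n∨m≡n 7≤c
... | inj₂ refl = ≤-refl
... | inj₁ 7<c = subst (λ b → length (if b then suc k ∷ candidates wheel k else candidates wheel k) ≤ coprimes (suc k) + 3)
  (sym (cong (_∧ sieve wheel c) (T-true (ℕP.<⇒<ᵇ (≤-trans (s≤s (s≤s z≤n)) 7<c)))))
  (step (sieve wheel c) refl (candidates-coprimes k (ℕP.≤-pred 7<c)))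
  where
  c = suc k
  not-small : ∀ q → q < 8 → (c ℕ.≡ᵇ q) ≢ true
  not-small q q<8 e = <⇒≱ q<8 (subst (8 ≤_) (≡ᵇ-true c q e) 7<c)
  part : ∀ q → q < 8 → ∀ x {b} → (x ∨ (c ℕ.≡ᵇ q)) ∧ b ≡ true → x ≡ true × b ≡ true
  part q q<8 x {b} h with ∧-true (x ∨ (c ℕ.≡ᵇ q)) b h
  ... | h₁ , h₂ with ∨-true x _ h₁
  ...   | inj₁ h₃ = h₃ , h₂
  ...   | inj₂ h₃ = contradiction h₃ (not-small q q<8)
  coprime : ∀ qs → All (_< 8) qs → sieve qs c ≡ true → coprime-to qs c ≡ true
  coprime []       _            h = refl
  coprime (q ∷ qs) (q<8 ∷ qs<8) h with part q q<8 (not (residue c q ℕ.≡ᵇ 0)) h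
  ... | h₁ , h₂ = cong₂ _∧_ h₁ (coprime qs qs<8 h₂)
  wheel<8 : All (_< 8) wheel
  wheel<8 = m≤m+n 3 5 ∷ m≤m+n 4 4 ∷ m≤m+n 6 2 ∷ m≤m+n 8 0 ∷ []
  step : ∀ b → sieve wheel c ≡ b → length (candidates wheel k) ≤ coprimes k + 3 →
    length (if b then c ∷ candidates wheel k else candidates wheel k) ≤ coprimes c + 3
  step false e h = ≤-trans h (ℕP.+-monoˡ-≤ 3 (m≤m+n (coprimes k) _))
  step true  e h = subst (λ b → suc (length (candidates wheel k)) ≤ coprimes k + indicator b + 3)
    (sym (coprime wheel wheel<8 e)) (subst (suc (length (candidates wheel k)) ≤_) (lem (coprimes k)) (s≤s h))
    where
    lem : ∀ x → suc (x + 3) ≡ x + 1 + 3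
    lem = solveℕ-∀

coprimes-small : every 210 (λ j → 4 * (coprimes (300 + j) + 4) ℕ.≤ᵇ 300 + j) ≡ true
coprimes-small = refl

-- A further period adds 4 · 48 = 192 on the left and 210 on the right, so the period starting at
-- 300 settles all later ones.
coprimes-step : ∀ t → 4 * (coprimes t + 4) ≤ t → ∀ s → 4 * (coprimes (t + s * 210) + 4) ≤ t + s * 210
coprimes-step t h zero    = subst (λ i → 4 * (coprimes i + 4) ≤ i) (sym (+-identityʳ t)) h
coprimes-step t h (suc s) = subst (λ i → 4 * (coprimes i + 4) ≤ i) (sym (lem₁ t (s * 210)))
  (subst (_≤ t + s * 210 + 210)
    (sym (trans (cong (λ x → 4 * (x + 4)) (coprimes-periodic (t + s * 210))) (lem₂ (coprimes (t + s * 210)))))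
    (ℕP.+-mono-≤ (coprimes-step t h s) (m≤m+n 192 18)))
  where
  lem₁ : ∀ t x → t + (210 + x) ≡ t + x + 210
  lem₁ = solveℕ-∀
  lem₂ : ∀ x → 4 * (x + 48 + 4) ≡ 4 * (x + 4) + 192
  lem₂ = solveℕ-∀

coprimes-bound : ∀ k → 300 ≤ k → 4 * (coprimes k + 4) ≤ k
coprimes-bound k 300≤k = subst (λ i → 4 * (coprimes i + 4) ≤ i) eq
  (coprimes-step (300 + j % 210) (ℕP.≤ᵇ⇒≤ _ _ (true-T small)) (j /ℕ 210))
  where
  j = k ∸ 300
  small : (4 * (coprimes (300 + j % 210) + 4) ℕ.≤ᵇ 300 + j % 210) ≡ true
  small = every-true 210 (λ j → 4 * (coprimes (300 + j) + 4) ℕ.≤ᵇ 300 + j) coprimes-small (j % 210) (m%n<n j 210)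
  eq : 300 + j % 210 + j /ℕ 210 * 210 ≡ k
  eq = trans (ℕP.+-assoc 300 (j % 210) _) (trans (cong (300 +_) (sym (m≡m%n+[m/n]*n j 210))) (ℕP.m+[n∸m]≡n 300≤k))

candidates-bound : ∀ k → 300 ≤ k → 4 * (length (candidates wheel k) + 1) ≤ k
candidates-bound k 300≤k = ≤-trans
  (*-monoʳ-≤ 4 (subst (length (candidates wheel k) + 1 ≤_) (ℕP.+-assoc (coprimes k) 3 1)
    (ℕP.+-monoˡ-≤ 1 (candidates-coprimes k (≤-trans (m≤m+n 7 293) 300≤k))))) (coprimes-bound k 300≤k)

wheel>1 : All (1 <_) wheel
wheel>1 = s≤s (s≤s z≤n) ∷ s≤s (s≤s z≤n) ∷ s≤s (s≤s z≤n) ∷ s≤s (s≤s z≤n) ∷ []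

factorial≤^ : ∀ m → m ! ≤ m ^ m
factorial≤^ zero    = ≤-refl
factorial≤^ (suc m) = *-monoʳ-≤ (suc m) (≤-trans (factorial≤^ m) (ℕP.^-monoˡ-≤ m (ℕP.n≤1+n m)))

even≢odd : ∀ a b → a + a ≢ suc (b + b)
even≢odd zero    b       ()
even≢odd (suc a) zero    e = contradiction (trans (sym (+-suc a a)) (ℕP.suc-injective e)) λ ()
even≢odd (suc a) (suc b) e = even≢odd a b (ℕP.suc-injective (trans (sym (+-suc a a))
  (trans (ℕP.suc-injective e) (cong suc (+-suc b b)))))

degrees-swap : ∀ {n k d e} → Degrees n k d e → Degrees n k e d
degrees-swap {d = d} {e} D = record
  { 0<d = 0<e ; 0<e = 0<d ; d+e = trans (+-comm e d) d+e
  ; once = λ p i pr k<p i≤k h h′ → swap⊎ (once p i pr k<p i≤k h h′)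
  ; twice = λ p i pr k<p i≤k h h′ → permute (twice p i pr k<p i≤k h h′) }
  where
  open Degrees D
  swap⊎ : ∀ {A B : Set} → A ⊎ B → B ⊎ A
  swap⊎ (inj₁ x) = inj₂ x
  swap⊎ (inj₂ x) = inj₁ x
  permute : ∀ {i} → Position d e i → Position e d i
  permute (at-d x)       = at-e x
  permute (at-e x)       = at-d x
  permute (e-d x)        = d-e x
  permute (d-e x)        = e-d x
  permute (double-d x)   = double-e x
  permute (double-e x)   = double-d x
  permute (halves x s y) = halves (sym x) s y

-- The terms n, ..., n - k under hypothetical degrees d and e

module Windows {n k d e : ℕ} (D : Degrees n k d e) (2k≤n : 2 * k ≤ n) where
  open Degrees D

  k>0 : 0 < k
  k>0 = subst (0 <_) d+e (<-≤-trans 0<d (m≤m+n d e))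

  k+k≤n : k + k ≤ n
  k+k≤n = subst (_≤ n) (cong (k +_) (+-identityʳ k)) 2k≤n

  k≤n : k ≤ n
  k≤n = ≤-trans (m≤m+n k k) k+k≤n

  k≤n∸k : k ≤ n ∸ k
  k≤n∸k = ℕP.m+n≤o⇒m≤o∸n k k+k≤n

  term>0 : ∀ i → i ≤ k → 0 < n ∸ i
  term>0 i i≤k = <-≤-trans k>0 (≤-trans k≤n∸k (ℕP.∸-monoʳ-≤ n i≤k))

  no-power : ∀ {p q} i → i ≤ k → n < q → q ≤ p → p ∤ n ∸ i
  no-power i i≤k n<q q≤p h = <⇒≱ (<-≤-trans n<q q≤p)
    (≤-trans (ℕ∣.∣⇒≤ ⦃ ℕ.>-nonZero (term>0 i i≤k) ⦄ h) (ℕP.m∸n≤m n i))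

  term : ∀ i j → i + j ≡ k → n ∸ k + j ≡ n ∸ i
  term i j i+j = trans (cong (λ x → n ∸ x + j) (sym i+j))
    (trans (cong (_+ j) (sym (ℕP.∸-+-assoc n i j)))
      (ℕP.m∸n+n≡m (ℕP.m+n≤o⇒m≤o∸n j (subst (_≤ n) (trans (sym i+j) (+-comm i j)) k≤n))))

  large-term : ∀ i → i ≤ k → Smooth k (n ∸ i) ⊎ ∃ λ p → Prime p × k < p × p ∣ n ∸ i
  large-term i i≤k = smooth-or-large k (n ∸ i) (term>0 i i≤k)

  classify : n < suc k * (suc k * suc k) → ∀ i → i ≤ k → Smooth k (n ∸ i) ⊎ Position d e i
  classify n< i i≤k with large-term i i≤k
  ... | inj₁ sm = inj₁ sm
  ... | inj₂ (p , pr , k<p , p∣) with p * p ℕ∣.∣? n ∸ i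
  ...   | yes p² = inj₂ (twice p i pr k<p i≤k p²
            (no-power i i≤k n< (*-mono-≤ k<p (*-mono-≤ k<p k<p))))
  ...   | no ¬p² with once p i pr k<p i≤k p∣ ¬p²
  ...     | inj₁ x = inj₂ (at-d x)
  ...     | inj₂ x = inj₂ (at-e x)

  classify-once : n < suc k * suc k → ∀ i → i ≤ k → Smooth k (n ∸ i) ⊎ (i ≡ d ⊎ i ≡ e)
  classify-once n< i i≤k with large-term i i≤k
  ... | inj₁ sm = inj₁ sm
  ... | inj₂ (p , pr , k<p , p∣) =
    inj₂ (once p i pr k<p i≤k p∣ (no-power i i≤k n< (*-mono-≤ k<p k<p)))

  partner : ∀ {i j x y} → i + j ≡ k → i ≡ x → x + y ≡ k → j ≡ y
  partner {i} i+j refl x+y = ℕP.+-cancelˡ-≡ i _ _ (trans i+j (sym x+y))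

  private
    index : ∀ j → j < suc k → k ∸ j + j ≡ k
    index j j≤k = ℕP.m∸n+n≡m (ℕP.≤-pred j≤k)

    smooth-at : ∀ i j → i + j ≡ k → Smooth k (n ∸ i) → Smooth k (n ∸ k + j * 1)
    smooth-at i j i+j = subst (Smooth k)
      (sym (trans (cong (n ∸ k +_) (ℕP.*-identityʳ j)) (term i j i+j)))

  window-once : n < suc k * suc k → ∀ ps → (∀ p → Prime p → p ≤ k → p ∈ ps) →
    (n ∸ k) ^ (suc k ∸ (length ps + 2)) ≤ k !
  window-once n< ps all = subst ((n ∸ k) ^ (suc k ∸ (length ps + 2)) ≤_)
    (trans (cong (_* k !) (ℕP.^-zeroˡ k)) (ℕP.*-identityˡ (k !)))
    (erdős k 1 k (n ∸ k) (s≤s z≤n) (term>0 k ≤-refl) ps (d ∷ e ∷ []) all listed)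
    where
    listed : ∀ j → j < suc k → j ∈ d ∷ e ∷ [] ⊎ Smooth k (n ∸ k + j * 1)
    listed j j<k with classify-once n< (k ∸ j) (ℕP.m∸n≤m k j)
    ... | inj₁ sm       = inj₂ (smooth-at (k ∸ j) j (index j j<k) sm)
    ... | inj₂ (inj₁ x) = inj₁ (there (here (partner (index j j<k) x d+e)))
    ... | inj₂ (inj₂ x) = inj₁ (here (partner (index j j<k) x (trans (+-comm e d) d+e)))

  -- The progression runs upwards from n - k, so index i appears as j = k - i: the indices d, e, e -
  -- d, 2d become e, d, 2d, e - d. The positions d - e and 2e are out of range because d < e.
  window-twice : d < e → n < suc k * (suc k * suc k) → ∀ ps → (∀ p → Prime p → p ≤ k → p ∈ ps) →
    (n ∸ k) ^ (suc k ∸ (length ps + 4)) ≤ k !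
  window-twice d<e n< ps all = subst ((n ∸ k) ^ (suc k ∸ (length ps + 4)) ≤_)
    (trans (cong (_* k !) (ℕP.^-zeroˡ k)) (ℕP.*-identityˡ (k !)))
    (erdős k 1 k (n ∸ k) (s≤s z≤n) (term>0 k ≤-refl) ps (d ∷ e ∷ d + d ∷ e ∸ d ∷ []) all listed)
    where
    listed : ∀ j → j < suc k → j ∈ d ∷ e ∷ d + d ∷ e ∸ d ∷ [] ⊎ Smooth k (n ∸ k + j * 1)
    listed j j<k = go (classify n< i (ℕP.m∸n≤m k j))
      where
      i = k ∸ j
      i+j : i + j ≡ k
      i+j = index j j<k
      go : Smooth k (n ∸ i) ⊎ Position d e i → j ∈ d ∷ e ∷ d + d ∷ e ∸ d ∷ [] ⊎ Smooth k (n ∸ k + j * 1)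
      go (inj₁ sm) = inj₂ (smooth-at i j i+j sm)
      go (inj₂ (at-d x)) = inj₁ (there (here (partner i+j x d+e)))
      go (inj₂ (at-e x)) = inj₁ (here (partner i+j x (trans (+-comm e d) d+e)))
      go (inj₂ (e-d x)) = inj₁ (there (there (here (partner i+j refl
        (trans (sym (ℕP.+-assoc i d d)) (trans (cong (_+ d) x) (trans (+-comm e d) d+e)))))))
      go (inj₂ (d-e x)) =
        contradiction (subst (e ≤_) x (ℕP.m≤n+m e i)) (<⇒≱ d<e)
      go (inj₂ (double-d x)) = inj₁ (there (there (there (here (partner i+j x
        (trans (ℕP.+-assoc d d (e ∸ d)) (trans (cong (d +_) (ℕP.m+[n∸m]≡n (<⇒≤ d<e))) d+e)))))))
      go (inj₂ (double-e x)) = contradiction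
        (subst₂ _≤_ x (sym d+e) (ℕP.m∸n≤m k j)) (<⇒≱ (ℕP.+-monoˡ-< e d<e))
      go (inj₂ (halves x _ _)) = contradiction x (<⇒≢ d<e)

  -- When d = e the vertex n - i may be a small multiple of p² only for even i, so the
  -- terms with odd i are almost all smooth.
  window-odd : d ≡ e → n < suc k * (suc k * suc k) → ∀ ps → (∀ p → Prime p → p ≤ k → p ∈ ps) →
    (n ∸ k + 1) ^ (d ∸ (length ps + 1)) ≤ 2 ^ (d ∸ 1) * (d ∸ 1) !
  window-odd d≡e n< ps all = subst (λ x → (n ∸ k + 1) ^ (x ∸ (length ps + 1)) ≤ 2 ^ (d ∸ 1) * (d ∸ 1) !) d′
    (erdős k 2 (d ∸ 1) (n ∸ k + 1) (s≤s z≤n) (subst (0 <_) (+-comm 1 (n ∸ k)) (s≤s z≤n))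
      ps (ℕ.⌊ d ∸ 1 /2⌋ ∷ []) all listed)
    where
    d′ : suc (d ∸ 1) ≡ d
    d′ = ℕP.m+[n∸m]≡n 0<d
    k≡d+d : k ≡ d + d
    k≡d+d = trans (sym d+e) (cong (d +_) (sym d≡e))
    listed : ∀ j → j < suc (d ∸ 1) → j ∈ ℕ.⌊ d ∸ 1 /2⌋ ∷ [] ⊎ Smooth k (n ∸ k + 1 + j * 2)
    listed j j<d = go (classify n< i (ℕP.m∸n≤m k (suc (j + j))))
      where
      i = k ∸ suc (j + j)
      bound : suc (j + j) ≤ k
      bound = subst (suc (j + j) ≤_) (sym k≡d+d)
        (ℕP.+-mono-<-≤ (subst (j <_) d′ j<d) (<⇒≤ (subst (j <_) d′ j<d)))
      i+j : i + suc (j + j) ≡ k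
      i+j = ℕP.m∸n+n≡m bound
      at : n ∸ k + 1 + j * 2 ≡ n ∸ i
      at = trans (lem (n ∸ k) j) (term i (suc (j + j)) i+j)
        where
        lem : ∀ a j → a + 1 + j * 2 ≡ a + suc (j + j)
        lem = solveℕ-∀
      -- Among the odd i = k - (2 j + 1) only i = d can be exceptional, and k = 2 d then gives 2 j +
      -- 1 = d.
      middle : i ≡ d → j ≡ ℕ.⌊ d ∸ 1 /2⌋
      middle x = trans (ℕP.n≡⌊n+n/2⌋ j) (cong (λ y → ℕ.⌊ y ∸ 1 /2⌋) (partner i+j x (sym k≡d+d)))
      odd : ∀ s → i ≢ s + s
      odd s x = even≢odd d (s + j) (trans (sym k≡d+d) (trans (sym i+j)
        (trans (cong (_+ suc (j + j)) x) (lem s j))))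
        where
        lem : ∀ s j → s + s + suc (j + j) ≡ suc (s + j + (s + j))
        lem = solveℕ-∀
      zero? : ∀ {x} → i + x ≡ x → i ≡ 0
      zero? {x} h = ℕP.+-cancelʳ-≡ x i 0 h
      go : Smooth k (n ∸ i) ⊎ Position d e i → j ∈ ℕ.⌊ d ∸ 1 /2⌋ ∷ [] ⊎ Smooth k (n ∸ k + 1 + j * 2)
      go (inj₁ sm) = inj₂ (subst (Smooth k) (sym at) sm)
      go (inj₂ (at-d x)) = inj₁ (here (middle x))
      go (inj₂ (at-e x)) = inj₁ (here (middle (trans x (sym d≡e))))
      go (inj₂ (e-d x)) = contradiction (zero? (trans x (sym d≡e))) (odd 0)
      go (inj₂ (d-e x)) = contradiction (zero? (trans x d≡e)) (odd 0)
      go (inj₂ (double-d x)) = contradiction x (odd d)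
      go (inj₂ (double-e x)) = contradiction x (odd e)
      go (inj₂ (halves _ s x)) = contradiction x (odd s)

  -- Here 2k ≤ n enters: p > n - k ≥ k. The prime p is itself the term of index n - p, so it divides
  -- this term exactly once.
  near-prime : ∀ p → Prime p → p ≤ n → n < p + k → n ∸ p ≡ d ⊎ n ∸ p ≡ e
  near-prime p pr p≤n n<p+k = once p (n ∸ p) pr k<p (<⇒≤ n∸p<k) (ℕ∣.∣-reflexive (sym p≡)) p²∤
    where
    n∸p<k : n ∸ p < k
    n∸p<k = ℕP.+-cancelˡ-< p _ _ (subst (_< p + k) (sym (ℕP.m+[n∸m]≡n p≤n)) n<p+k)
    p≡ : n ∸ (n ∸ p) ≡ p
    p≡ = ℕP.m∸[m∸n]≡n p≤n
    k<p : k < p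
    k<p = ℕP.+-cancelʳ-< k k p (≤-<-trans k+k≤n n<p+k)
    p²∤ : p * p ∤ n ∸ (n ∸ p)
    p²∤ h = <⇒≱ (ℕP.m<m*n p p ⦃ prime⇒nonZero pr ⦄ (prime>1 pr))
      (ℕ∣.∣⇒≤ ⦃ prime⇒nonZero pr ⦄ (subst (p * p ∣_) p≡ h))

  three-primes : ∀ p q r → Prime p → Prime q → Prime r → p < q → q < r → r ≤ n → n < p + k → ⊥
  three-primes p q r pp pq pr p<q q<r r≤n n<p+k = pigeon
    (near-prime p pp p≤n n<p+k) (near-prime q pq q≤n (ℕP.<-trans n<p+k (ℕP.+-monoˡ-< k p<q)))
    (near-prime r pr r≤n (ℕP.<-trans n<p+k (ℕP.+-monoˡ-< k (ℕP.<-trans p<q q<r))))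
    where
    q≤n = ≤-trans (<⇒≤ q<r) r≤n
    p≤n = ≤-trans (<⇒≤ p<q) q≤n
    i>j = ℕP.∸-monoʳ-< p<q q≤n
    j>l = ℕP.∸-monoʳ-< q<r r≤n
    differ : ∀ {a b x : ℕ} → a < b → a ≡ x → b ≡ x → ⊥
    differ a<b refl refl = ℕP.<-irrefl refl a<b
    pigeon : n ∸ p ≡ d ⊎ n ∸ p ≡ e → n ∸ q ≡ d ⊎ n ∸ q ≡ e → n ∸ r ≡ d ⊎ n ∸ r ≡ e → ⊥
    pigeon (inj₁ x) (inj₁ y) _        = differ i>j y x
    pigeon (inj₂ x) (inj₂ y) _        = differ i>j y x
    pigeon _        (inj₁ y) (inj₁ z) = differ j>l z y
    pigeon _        (inj₂ y) (inj₂ z) = differ j>l z y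
    pigeon (inj₁ x) (inj₂ y) (inj₁ z) = differ (ℕP.<-trans j>l i>j) z x
    pigeon (inj₂ x) (inj₁ y) (inj₂ z) = differ (ℕP.<-trans j>l i>j) z x

-- Estimates against k!

complement-half : ∀ {q c k} → q + c ≡ suc k → 2 * c ≤ k + 2 → k ≤ 2 * q
complement-half {q} {c} {k} e h = ℕP.+-cancelʳ-≤ (2 * c) k (2 * q) (begin
  k + 2 * c ≤⟨ ℕP.+-monoʳ-≤ k h ⟩
  k + (k + 2) ≡⟨ lem₁ k ⟩
  2 * suc k ≡⟨ cong (2 *_) (sym e) ⟩
  2 * (q + c) ≡⟨ lem₂ q c ⟩
  2 * q + 2 * c ∎)
  where
  open ℕP.≤-Reasoning
  lem₁ : ∀ k → k + (k + 2) ≡ 2 * suc k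
  lem₁ = solveℕ-∀
  lem₂ : ∀ q c → 2 * (q + c) ≡ 2 * q + 2 * c
  lem₂ = solveℕ-∀

^-distribʳ-* : ∀ o m n → (m * n) ^ o ≡ m ^ o * n ^ o
^-distribʳ-* zero    m n = refl
^-distribʳ-* (suc o) m n = trans (cong (m * n *_) (^-distribʳ-* o m n)) (lem m n (m ^ o) (n ^ o))
  where
  lem : ∀ a b c d → a * b * (c * d) ≡ a * c * (b * d)
  lem = solveℕ-∀

square-^ : ∀ k q → (k * k) ^ q ≡ k ^ (2 * q)
square-^ k q = trans (cong (λ x → (k * x) ^ q) (sym (ℕP.*-identityʳ k))) (ℕP.^-*-assoc k 2 q)

square-<^ : ∀ {k q X} m → 0 < k → 0 < q → m ≤ 2 * q → k * k < X → k ^ m < X ^ q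
square-<^ {k} {q} {X} m 0<k 0<q m≤2q k²<X = begin-strict
  k ^ m ≤⟨ ℕP.^-monoʳ-≤ k ⦃ ℕ.>-nonZero 0<k ⦄ m≤2q ⟩
  k ^ (2 * q) ≡⟨ sym (square-^ k q) ⟩
  (k * k) ^ q <⟨ ℕP.^-monoˡ-< q ⦃ ℕ.>-nonZero 0<q ⦄ k²<X ⟩
  X ^ q ∎
  where open ℕP.≤-Reasoning

half>0 : ∀ {k q} → 0 < k → k ≤ 2 * q → 0 < q
half>0 {q = zero}  0<k k≤ = contradiction (<-≤-trans 0<k k≤) λ ()
half>0 {q = suc q} 0<k k≤ = s≤s z≤n

-- From k ≥ 8 on, discarding l + 4 terms leaves at least k/2 of them; as each exceeds k², the
-- product exceeds k^k ≥ k!.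
large-twice : ∀ {k X l} → 8 ≤ k → 4 * (l + 1) ≤ k → k * k < X → k ! < X ^ (suc k ∸ (l + 4))
large-twice {k} {X} {l} 8≤k 4l≤k k²<X =
  ≤-<-trans (factorial≤^ k) (square-<^ {k} {suc k ∸ (l + 4)} {X} k 0<k (half>0 {k} {suc k ∸ (l + 4)} 0<k half) half k²<X)
  where
  0<k : 0 < k
  0<k = <-≤-trans (s≤s z≤n) 8≤k
  quad : 2 * (2 * (l + 4)) ≤ 2 * (k + 2)
  quad = begin
    2 * (2 * (l + 4)) ≡⟨ lem₁ l ⟩
    4 * (l + 1) + 12 ≤⟨ ℕP.+-monoˡ-≤ 12 4l≤k ⟩
    k + (8 + 4) ≤⟨ ℕP.+-monoʳ-≤ k (ℕP.+-monoˡ-≤ 4 8≤k) ⟩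
    k + (k + 4) ≡⟨ lem₂ k ⟩
    2 * (k + 2) ∎
    where
    open ℕP.≤-Reasoning
    lem₁ : ∀ l → 2 * (2 * (l + 4)) ≡ 4 * (l + 1) + 12
    lem₁ = solveℕ-∀
    lem₂ : ∀ k → k + (k + 4) ≡ 2 * (k + 2)
    lem₂ = solveℕ-∀
  double : 2 * (l + 4) ≤ k + 2
  double = ℕP.*-cancelˡ-≤ 2 quad
  l≤k : l + 4 ≤ suc k
  l≤k = ℕP.*-cancelˡ-≤ 2 (≤-trans double (subst (k + 2 ≤_) (lem k) (m≤m+n (k + 2) k)))
    where
    lem : ∀ k → k + 2 + k ≡ 2 * suc k
    lem = solveℕ-∀
  half : k ≤ 2 * (suc k ∸ (l + 4))
  half = complement-half {suc k ∸ (l + 4)} {l + 4} {k} (ℕP.m∸n+n≡m l≤k) double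

-- With k = 2d the right-hand side of the window bound is at most (2 (d - 1))^(d - 1) ≤ k^d, and at
-- least d/2 of the d terms remain, each above k².
large-odd : ∀ {d X l} → 0 < d → 4 * (l + 1) ≤ d + d → (d + d) * (d + d) < X →
  2 ^ (d ∸ 1) * (d ∸ 1) ! < X ^ (d ∸ (l + 1))
large-odd {d} {X} {l} 0<d 4l≤k k²<X = ≤-<-trans (begin
  2 ^ c * c ! ≤⟨ *-monoʳ-≤ (2 ^ c) (factorial≤^ c) ⟩
  2 ^ c * c ^ c ≡⟨ sym (^-distribʳ-* c 2 c) ⟩
  (2 * c) ^ c ≤⟨ ℕP.^-monoˡ-≤ c (subst (_≤ d + d) (cong (c +_) (sym (+-identityʳ c))) (ℕP.+-mono-≤ c≤d c≤d)) ⟩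
  (d + d) ^ c ≤⟨ ℕP.^-monoʳ-≤ (d + d) ⦃ ℕ.>-nonZero 0<k ⦄ c≤d ⟩
  (d + d) ^ d ∎)
  (square-<^ {d + d} {d ∸ (l + 1)} {X} d 0<k (half>0 {d} {d ∸ (l + 1)} 0<d half) half k²<X)
  where
  open ℕP.≤-Reasoning
  c = d ∸ 1
  c≤d : c ≤ d
  c≤d = ℕP.m∸n≤m d 1
  0<k : 0 < d + d
  0<k = <-≤-trans 0<d (m≤m+n d d)
  double : 2 * (l + 1) ≤ d
  double = ℕP.*-cancelˡ-≤ 2 (subst₂ _≤_ (lem l) (cong (d +_) (sym (+-identityʳ d))) 4l≤k)
    where
    lem : ∀ l → 4 * (l + 1) ≡ 2 * (2 * (l + 1))
    lem = solveℕ-∀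
  half : d ≤ 2 * (d ∸ (l + 1))
  half = subst (d ≤_) (sym (ℕP.*-distribˡ-∸ 2 d (l + 1)))
    (ℕP.m+n≤o⇒m≤o∸n d (subst (d + 2 * (l + 1) ≤_) (cong (d +_) (sym (+-identityʳ d))) (ℕP.+-monoʳ-≤ d double)))

-- At least 3k/4 terms remain, and each is at least k t > k^(4/3). Fourth powers are compared in
-- order to avoid fractional exponents: 4 q ≥ 3 k and (k t)³ > k⁴.
large-once : ∀ {k X l t} → 0 < k → 4 * (l + 1) ≤ k → k < t * t * t → k * t ≤ X → k ! < X ^ (suc k ∸ (l + 2))
large-once {k} {X} {l} {t} 0<k 4l≤k k<t³ kt≤X = ≰⇒> λ h → ℕP.<-irrefl refl (begin-strict
  (k ^ 4) ^ k <⟨ ℕP.^-monoˡ-< k ⦃ ℕ.>-nonZero 0<k ⦄ quartic ⟩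
  ((k * t) ^ 3) ^ k ≡⟨ ℕP.^-*-assoc (k * t) 3 k ⟩
  (k * t) ^ (3 * k) ≤⟨ ℕP.^-monoʳ-≤ (k * t) ⦃ ℕ.>-nonZero kt>0 ⦄ 3k≤4q ⟩
  (k * t) ^ (q * 4) ≤⟨ ℕP.^-monoˡ-≤ (q * 4) kt≤X ⟩
  X ^ (q * 4) ≡⟨ sym (ℕP.^-*-assoc X q 4) ⟩
  (X ^ q) ^ 4 ≤⟨ ℕP.^-monoˡ-≤ 4 h ⟩
  (k !) ^ 4 ≤⟨ ℕP.^-monoˡ-≤ 4 (factorial≤^ k) ⟩
  (k ^ k) ^ 4 ≡⟨ ℕP.^-*-assoc k k 4 ⟩
  k ^ (k * 4) ≡⟨ cong (k ^_) (ℕP.*-comm k 4) ⟩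
  k ^ (4 * k) ≡⟨ sym (ℕP.^-*-assoc k 4 k) ⟩
  (k ^ 4) ^ k ∎)
  where
  open ℕP.≤-Reasoning
  q = suc k ∸ (l + 2)
  quartic : k ^ 4 < (k * t) ^ 3
  quartic = subst₂ _<_ (lem₁ k) (lem₂ k t)
    (ℕP.*-monoʳ-< (k * k * k) ⦃ ℕ.>-nonZero (*-mono-< (*-mono-< 0<k 0<k) 0<k) ⦄ k<t³)
    where
    lem₁ : ∀ k → k * k * k * k ≡ k * (k * (k * (k * 1)))
    lem₁ = solveℕ-∀
    lem₂ : ∀ k t → k * k * k * (t * t * t) ≡ k * t * (k * t * (k * t * 1))
    lem₂ = solveℕ-∀
  kt>0 : 0 < k * t
  kt>0 = go t k<t³
    where
    go : ∀ t → k < t * t * t → 0 < k * t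
    go zero    ()
    go (suc t) _ = *-mono-< 0<k (s≤s z≤n)
  l≤k : l + 2 ≤ suc k
  l≤k = subst (_≤ suc k) (sym (+-suc l 1)) (s≤s (≤-trans (m≤m+n (l + 1) (3 * (l + 1))) 4l≤k))
  3k≤4q : 3 * k ≤ q * 4
  3k≤4q = ℕP.+-cancelʳ-≤ (k + 4) (3 * k) (q * 4) (begin
    3 * k + (k + 4) ≡⟨ lem₁ k ⟩
    suc k * 4 ≡⟨ cong (_* 4) (sym (ℕP.m∸n+n≡m l≤k)) ⟩
    (q + (l + 2)) * 4 ≡⟨ lem₂ q l ⟩
    q * 4 + (4 * (l + 1) + 4) ≤⟨ ℕP.+-monoʳ-≤ (q * 4) (ℕP.+-monoˡ-≤ 4 4l≤k) ⟩
    q * 4 + (k + 4) ∎)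
    where
    lem₁ : ∀ k → 3 * k + (k + 4) ≡ suc k * 4
    lem₁ = solveℕ-∀
    lem₂ : ∀ q l → (q + (l + 2)) * 4 ≡ q * 4 + (4 * (l + 1) + 4)
    lem₂ = solveℕ-∀

-- These sieve out all composite numbers below 19².
small-sieve : List ℕ
small-sieve = 2 ∷ 3 ∷ 5 ∷ 7 ∷ 11 ∷ 13 ∷ 17 ∷ []

small-sieve>1 : All (1 <_) small-sieve
small-sieve>1 = ℕP.<ᵇ⇒< 1 2 _ ∷ ℕP.<ᵇ⇒< 1 3 _ ∷ ℕP.<ᵇ⇒< 1 5 _ ∷ ℕP.<ᵇ⇒< 1 7 _ ∷ ℕP.<ᵇ⇒< 1 11 _ ∷
  ℕP.<ᵇ⇒< 1 13 _ ∷ ℕP.<ᵇ⇒< 1 17 _ ∷ []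

-- A lower bound for n - k when n ≥ (k + 1)² and n is beyond the table of small cases.
base : ℕ → ℕ
base k = if k ℕ.<ᵇ 52 then 17500 else k * k

-- The bound 3 k for n - k in `onceᵇ` supposes n ≥ 4 k; below that, three primes close to n are used
-- instead.
onceᵇ twiceᵇ oddᵇ : ℕ → Bool
onceᵇ k  = k ! ℕ.<ᵇ (3 * k) ^ (suc k ∸ (length (candidates small-sieve k) + 2))
twiceᵇ k = k ! ℕ.<ᵇ base k ^ (suc k ∸ (length (candidates small-sieve k) + 4))
oddᵇ d   = 2 ^ (d ∸ 1) * (d ∸ 1) ! ℕ.<ᵇ base (d + d) ^ (d ∸ (length (candidates small-sieve (d + d)) + 1))

once-table : every (300 ∸ 52) (λ i → onceᵇ (52 + i)) ≡ true
once-table = refl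

twice-table : every (300 ∸ 26) (λ i → twiceᵇ (26 + i)) ≡ true
twice-table = refl

odd-table : every (150 ∸ 13) (λ i → oddᵇ (13 + i)) ≡ true
odd-table = refl

table-lookup : ∀ (f : ℕ → Bool) a b → every (b ∸ a) (λ i → f (a + i)) ≡ true → ∀ k → a ≤ k → k < b → f k ≡ true
table-lookup f a b h k a≤k k<b = subst (λ i → f i ≡ true) (ℕP.m+[n∸m]≡n a≤k)
  (every-true (b ∸ a) _ h (k ∸ a) (ℕP.∸-monoˡ-< k<b a≤k))

<ᵇ-true : ∀ {m n} → (m ℕ.<ᵇ n) ≡ true → m < n
<ᵇ-true {m} {n} h = ℕP.<ᵇ⇒< m n (true-T h)

once-true : ∀ k → 52 ≤ k → k < 300 → k ! < (3 * k) ^ (suc k ∸ (length (candidates small-sieve k) + 2))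
once-true k lo hi = <ᵇ-true {k !} {(3 * k) ^ (suc k ∸ (length (candidates small-sieve k) + 2))}
  (table-lookup onceᵇ 52 300 once-table k lo hi)

twice-true : ∀ k → 26 ≤ k → k < 300 → k ! < base k ^ (suc k ∸ (length (candidates small-sieve k) + 4))
twice-true k lo hi = <ᵇ-true {k !} {base k ^ (suc k ∸ (length (candidates small-sieve k) + 4))}
  (table-lookup twiceᵇ 26 300 twice-table k lo hi)

odd-true : ∀ d → 13 ≤ d → d < 150 →
  2 ^ (d ∸ 1) * (d ∸ 1) ! < base (d + d) ^ (d ∸ (length (candidates small-sieve (d + d)) + 1))
odd-true d lo hi =
  <ᵇ-true {2 ^ (d ∸ 1) * (d ∸ 1) !} {base (d + d) ^ (d ∸ (length (candidates small-sieve (d + d)) + 1))}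
    (table-lookup oddᵇ 13 150 odd-table d lo hi)

contradict-power : ∀ x X b e → x ≤ X → X ^ e ≤ b → b < x ^ e → ⊥
contradict-power x X b e x≤X hi lo = <⇒≱ lo (≤-trans (ℕP.^-monoˡ-≤ e x≤X) hi)

-- The range (k + 1)² ≤ n < (k + 1)³

module _ {n k d e : ℕ} (D : Degrees n k d e) (26≤k : 26 ≤ k) (far : k < 52 → 17576 ≤ n)
  (lower : suc k * suc k ≤ n) (upper : n < suc k * (suc k * suc k)) where

  private
    2k≤n : 2 * k ≤ n
    2k≤n = ≤-trans (subst (2 * k ≤_) (lem k) (m≤m+n (2 * k) (k * k + 1))) lower
      where
      lem : ∀ k → 2 * k + (k * k + 1) ≡ suc k * suc k
      lem = solveℕ-∀
    open Windows D 2k≤n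

    k²<n∸k : k * k < n ∸ k
    k²<n∸k = ℕP.m+n≤o⇒m≤o∸n (suc (k * k)) (≤-trans
      (subst (suc (k * k) + k ≤_) (lem k) (m≤m+n (suc (k * k) + k) k)) lower)
      where
      lem : ∀ k → suc (k * k) + k + k ≡ suc k * suc k
      lem = solveℕ-∀

    base≤ : base k ≤ n ∸ k
    base≤ with k ℕ.<ᵇ 52 in eq
    ... | false = <⇒≤ k²<n∸k
    ... | true  = subtract {17500} {52} {17576} (<⇒≤ (<ᵇ-true eq)) (ℕP.≤ᵇ⇒≤ 17552 17576 _) (far (<ᵇ-true eq))
      where
      subtract : ∀ {a b c} → k ≤ b → a + b ≤ c → c ≤ n → a ≤ n ∸ k
      subtract {a} k≤b a+b≤c c≤n = ℕP.m+n≤o⇒m≤o∸n a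
        (≤-trans (ℕP.+-monoʳ-≤ a k≤b) (≤-trans a+b≤c c≤n))

    base≤+1 : base k ≤ n ∸ k + 1
    base≤+1 = ≤-trans base≤ (m≤m+n _ 1)

  upper-unequal : d < e → ⊥
  upper-unequal d<e = cases (k <? 300)
    where
    cases : Dec (k < 300) → ⊥
    cases (yes k<300) = contradict-power (base k) (n ∸ k) (k !) (suc k ∸ (length (candidates small-sieve k) + 4))
      base≤ (window-twice d<e upper (candidates small-sieve k) (candidates-complete small-sieve small-sieve>1 k))
      (twice-true k 26≤k k<300)
    cases (no k≮300) = contradict-power (n ∸ k) (n ∸ k) (k !) (suc k ∸ (length (candidates wheel k) + 4)) ≤-refl
      (window-twice d<e upper (candidates wheel k) (candidates-complete wheel wheel>1 k))
      (large-twice {k} {n ∸ k} {length (candidates wheel k)}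
        (≤-trans (m≤m+n 8 18) 26≤k) (candidates-bound k (≮⇒≥ k≮300)) k²<n∸k)

  upper-equal : d ≡ e → ⊥
  upper-equal d≡e = cases (d <? 150)
    where
    k≡ : k ≡ d + d
    k≡ = trans (sym (Degrees.d+e D)) (cong (d +_) (sym d≡e))
    X = n ∸ k + 1
    b = 2 ^ (d ∸ 1) * (d ∸ 1) !
    cases : Dec (d < 150) → ⊥
    cases (yes d<150) = contradict-power (base (d + d)) X b (d ∸ (length (candidates small-sieve (d + d)) + 1))
      (subst (λ x → base x ≤ X) k≡ base≤+1)
      (subst (λ x → X ^ (d ∸ (length (candidates small-sieve x) + 1)) ≤ b) k≡
        (window-odd d≡e upper (candidates small-sieve k) (candidates-complete small-sieve small-sieve>1 k)))
      (odd-true d 13≤d d<150)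
      where
      13≤d : 13 ≤ d
      13≤d = ℕP.*-cancelˡ-≤ 2 (subst (26 ≤_) (trans k≡ (cong (d +_) (sym (+-identityʳ d)))) 26≤k)
    cases (no d≮150) = contradict-power X X b (d ∸ (length (candidates wheel k) + 1)) ≤-refl
      (window-odd d≡e upper (candidates wheel k) (candidates-complete wheel wheel>1 k))
      (large-odd {d} {X} {length (candidates wheel k)} (Degrees.0<d D)
        (subst (4 * (length (candidates wheel k) + 1) ≤_) k≡ (candidates-bound k 300≤k))
        (subst (λ x → x * x < X) k≡ (<-≤-trans k²<n∸k (m≤m+n _ 1))))
      where
      300≤k : 300 ≤ k
      300≤k = subst (300 ≤_) (sym k≡) (ℕP.+-mono-≤ (≮⇒≥ d≮150) (≮⇒≥ d≮150))

upper-range : ∀ {n k d e} → Degrees n k d e → 26 ≤ k → (k < 52 → 17576 ≤ n) →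
  suc k * suc k ≤ n → n < suc k * (suc k * suc k) → ⊥
upper-range {d = d} {e} D 26≤k far lower upper with ℕP.<-cmp d e
... | tri< d<e _ _ = upper-unequal D 26≤k far lower upper d<e
... | tri≈ _ d≡e _ = upper-equal D 26≤k far lower upper d≡e
... | tri> _ _ e<d = upper-unequal (degrees-swap D) 26≤k far lower upper e<d

-- Three primes just below n

-- Every window of length δ ends just after three of these numbers as soon as δ exceeds
-- both m and a c-th part of its upper end.
chain : ℕ → ℕ → List ℕ → Bool
chain c m (p ∷ ps@(q ∷ r ∷ s ∷ _)) =
  (p ℕ.<ᵇ q) ∧ (q ℕ.<ᵇ r) ∧ ((s ∸ p ℕ.≤ᵇ m) ∨ (c * (s ∸ p) ℕ.≤ᵇ r)) ∧ chain c m ps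
chain c m _ = true

-- The ends of the interval of n that a chain serves. The value 0 for short lists is a mere default,
-- as `chain-sound` asks for at least three entries.
third final : List ℕ → ℕ
third (_ ∷ _ ∷ r ∷ _) = r
third _               = 0
final []       = 0
final (p ∷ []) = p
final (p ∷ ps@(_ ∷ _)) = final ps

ThreePrimes : ℕ → ℕ → Set
ThreePrimes n k = ∃ λ p → ∃₂ λ q r → Prime p × Prime q × Prime r × p < q × q < r × r ≤ n × n < p + k

-- Slide along the chain to successive p, q, r, s with r ≤ n < s. Then s - p ≤ k, either because s -
-- p ≤ m or because c (s - p) ≤ r ≤ n < c k; hence n < s ≤ p + k.
chain-sound : ∀ c m ps → All Prime ps → chain c m ps ≡ true → ∀ n k → m ≤ k → n < c * k →
  third ps ≤ n → n < final ps → 2 < length ps → ThreePrimes n k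
chain-sound c m [] _ _ n k _ _ _ _ ()
chain-sound c m (p ∷ []) _ _ n k _ _ _ _ (s≤s ())
chain-sound c m (p ∷ q ∷ []) _ _ n k _ _ _ _ (s≤s (s≤s ()))
chain-sound c m (p ∷ q ∷ r ∷ []) _ _ n k _ _ r≤n n<r _ = contradiction n<r (ℕP.≤⇒≯ r≤n)
chain-sound c m (p ∷ ps@(q ∷ r ∷ s ∷ _)) (pp ∷ prs@(pq ∷ pr ∷ _)) h n k m≤k n<ck r≤n n< _ =
  cases (n <? s) λ n≮s →
    chain-sound c m ps prs (proj₂ h₃) n k m≤k n<ck (≮⇒≥ n≮s) n< (s≤s (s≤s (s≤s z≤n)))
  where
  h₁ = ∧-true (p ℕ.<ᵇ q) _ h
  h₂ = ∧-true (q ℕ.<ᵇ r) _ (proj₂ h₁)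
  h₃ = ∧-true ((s ∸ p ℕ.≤ᵇ m) ∨ (c * (s ∸ p) ℕ.≤ᵇ r)) _ (proj₂ h₂)
  δ≤k : (s ∸ p ℕ.≤ᵇ m) ≡ true ⊎ (c * (s ∸ p) ℕ.≤ᵇ r) ≡ true → s ∸ p ≤ k
  δ≤k (inj₁ x) = ≤-trans (ℕP.≤ᵇ⇒≤ _ _ (true-T x)) m≤k
  δ≤k (inj₂ x) = ≮⇒≥ λ k<δ → <⇒≱ n<ck (≤-trans (*-monoʳ-≤ c (<⇒≤ k<δ))
    (≤-trans (ℕP.≤ᵇ⇒≤ _ _ (true-T x)) r≤n))
  cases : Dec (n < s) → (¬ n < s → ThreePrimes n k) → ThreePrimes n k
  cases (no n≮s)  rec = rec n≮s
  cases (yes n<s) _   = p , q , r , pp , pq , pr , <ᵇ-true (proj₁ h₁) , <ᵇ-true (proj₁ h₂) , r≤n ,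
    <-≤-trans n<s (≤-trans (ℕP.m≤n+m∸n s p) (ℕP.+-monoʳ-≤ p (δ≤k (∨-true _ _ (proj₁ h₃)))))

-- Primes thinned out as far as the gap condition permits. The first chain is for 52 ≤ k < 300 and n
-- < 4 k < 1200, the second for 300 ≤ k < 4096 and n < 17 k < 69632; the third entries 103 and 599
-- lie below the least values 104 and 600 of 2 k.
chain₁ chain₂ : List ℕ
chain₁ =
  97 ∷ 101 ∷ 103 ∷ 113 ∷ 127 ∷ 139 ∷ 151 ∷ 167 ∷ 181 ∷ 197 ∷ 211 ∷ 227 ∷ 241 ∷ 257 ∷ 277 ∷
  293 ∷ 317 ∷ 337 ∷ 359 ∷ 383 ∷ 409 ∷ 443 ∷ 479 ∷ 509 ∷ 547 ∷ 587 ∷ 631 ∷ 683 ∷ 739 ∷ 797 ∷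
  863 ∷ 929 ∷ 997 ∷ 1069 ∷ 1153 ∷ 1249 ∷ []
chain₂ =
  587 ∷ 593 ∷ 599 ∷ 691 ∷ 787 ∷ 887 ∷ 983 ∷ 1069 ∷ 1163 ∷ 1259 ∷ 1327 ∷ 1427 ∷ 1523 ∷ 1621 ∷
  1721 ∷ 1811 ∷ 1907 ∷ 2003 ∷ 2099 ∷ 2179 ∷ 2273 ∷ 2371 ∷ 2467 ∷ 2557 ∷ 2657 ∷ 2753 ∷ 2851 ∷
  2939 ∷ 3037 ∷ 3137 ∷ 3229 ∷ 3329 ∷ 3413 ∷ 3511 ∷ 3607 ∷ 3701 ∷ 3797 ∷ 3889 ∷ 3989 ∷ 4079 ∷
  4177 ∷ 4273 ∷ 4373 ∷ 4463 ∷ 4561 ∷ 4657 ∷ 4751 ∷ 4831 ∷ 4931 ∷ 5023 ∷ 5119 ∷ 5209 ∷ 5309 ∷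
  5413 ∷ 5519 ∷ 5623 ∷ 5717 ∷ 5827 ∷ 5939 ∷ 6053 ∷ 6163 ∷ 6277 ∷ 6397 ∷ 6521 ∷ 6637 ∷ 6763 ∷
  6883 ∷ 7013 ∷ 7129 ∷ 7253 ∷ 7393 ∷ 7537 ∷ 7681 ∷ 7829 ∷ 7963 ∷ 8117 ∷ 8273 ∷ 8431 ∷ 8581 ∷
  8747 ∷ 8893 ∷ 9067 ∷ 9241 ∷ 9421 ∷ 9601 ∷ 9787 ∷ 9973 ∷ 10163 ∷ 10357 ∷ 10559 ∷ 10753 ∷
  10957 ∷ 11171 ∷ 11383 ∷ 11597 ∷ 11821 ∷ 12049 ∷ 12281 ∷ 12517 ∷ 12757 ∷ 13007 ∷ 13259 ∷
  13513 ∷ 13763 ∷ 14029 ∷ 14303 ∷ 14563 ∷ 14843 ∷ 15131 ∷ 15427 ∷ 15727 ∷ 16033 ∷ 16339 ∷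
  16657 ∷ 16981 ∷ 17299 ∷ 17627 ∷ 17971 ∷ 18313 ∷ 18671 ∷ 19037 ∷ 19403 ∷ 19777 ∷ 20161 ∷
  20551 ∷ 20947 ∷ 21347 ∷ 21757 ∷ 22171 ∷ 22573 ∷ 23011 ∷ 23459 ∷ 23917 ∷ 24379 ∷ 24851 ∷
  25321 ∷ 25801 ∷ 26297 ∷ 26801 ∷ 27299 ∷ 27827 ∷ 28351 ∷ 28901 ∷ 29453 ∷ 30029 ∷ 30593 ∷
  31189 ∷ 31799 ∷ 32413 ∷ 33037 ∷ 33679 ∷ 34337 ∷ 34981 ∷ 35617 ∷ 36313 ∷ 37021 ∷ 37717 ∷
  38453 ∷ 39199 ∷ 39953 ∷ 40709 ∷ 41507 ∷ 42307 ∷ 43133 ∷ 43973 ∷ 44819 ∷ 45697 ∷ 46591 ∷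
  47501 ∷ 48413 ∷ 49339 ∷ 50291 ∷ 51263 ∷ 52267 ∷ 53281 ∷ 54323 ∷ 55381 ∷ 56453 ∷ 57559 ∷
  58687 ∷ 59833 ∷ 61001 ∷ 62191 ∷ 63409 ∷ 64633 ∷ 65899 ∷ 67189 ∷ 68501 ∷ 69833 ∷ []

chain₁-prime : All Prime chain₁
chain₁-prime = allPrimeᵇ-sound chain₁ refl

chain₂-prime : All Prime chain₂
chain₂-prime = allPrimeᵇ-sound chain₂ refl

three-primes₁ : ∀ n k → 52 ≤ k → 104 ≤ n → n < 4 * k → n < 1200 → ThreePrimes n k
three-primes₁ n k 52≤k 104≤n n<4k n<1200 = chain-sound 4 52 chain₁ chain₁-prime refl n k 52≤k n<4k
  (≤-trans (ℕP.≤ᵇ⇒≤ (third chain₁) 104 _) 104≤n) (<-≤-trans n<1200 (ℕP.≤ᵇ⇒≤ 1200 (final chain₁) _)) (ℕP.<ᵇ⇒< 2 (length chain₁) _)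

three-primes₂ : ∀ n k → 300 ≤ k → 600 ≤ n → n < 17 * k → n < 69632 → ThreePrimes n k
three-primes₂ n k 300≤k 600≤n n<17k n<m = chain-sound 17 300 chain₂ chain₂-prime refl n k 300≤k n<17k
  (≤-trans (ℕP.≤ᵇ⇒≤ (third chain₂) 600 _) 600≤n) (<-≤-trans n<m (ℕP.≤ᵇ⇒≤ 69632 (final chain₂) _)) (ℕP.<ᵇ⇒< 2 (length chain₂) _)

module _ {n k d e : ℕ} (D : Degrees n k d e) (2k≤n : 2 * k ≤ n) where
  open Windows D 2k≤n

  refute-three : ThreePrimes n k → ⊥
  refute-three (p , q , r , pp , pq , pr , p<q , q<r , r≤n , n<) = three-primes p q r pp pq pr p<q q<r r≤n n<

  lower-large : ∀ t → n < suc k * suc k → 300 ≤ k → k < t * t * t → k * t ≤ n ∸ k → ⊥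
  lower-large t n< 300≤k k<t³ kt≤ =
    contradict-power (n ∸ k) (n ∸ k) (k !) (suc k ∸ (length (candidates wheel k) + 2)) ≤-refl
      (window-once n< (candidates wheel k) (candidates-complete wheel wheel>1 k))
      (large-once {k} {n ∸ k} {length (candidates wheel k)} {t} k>0 (candidates-bound k 300≤k) k<t³ kt≤)

  lower-small : n < suc k * suc k → 52 ≤ k → k < 300 → ⊥
  lower-small n< 52≤k k<300 = cases (n <? 4 * k)
    where
    cases : Dec (n < 4 * k) → ⊥
    cases (yes n<4k) = refute-three (three-primes₁ n k 52≤k (≤-trans (*-monoʳ-≤ 2 52≤k) 2k≤n) n<4k
      (<-≤-trans n<4k (*-monoʳ-≤ 4 (<⇒≤ k<300))))
    cases (no n≮4k) =
      contradict-power (3 * k) (n ∸ k) (k !) (suc k ∸ (length (candidates small-sieve k) + 2)) 3k≤n∸k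
        (window-once n< (candidates small-sieve k) (candidates-complete small-sieve small-sieve>1 k))
        (once-true k 52≤k k<300)
      where
      3k≤n∸k : 3 * k ≤ n ∸ k
      3k≤n∸k = ℕP.m+n≤o⇒m≤o∸n (3 * k) (subst (_≤ n) (+-comm k (3 * k)) (≮⇒≥ n≮4k))

  lower-middle : n < suc k * suc k → 300 ≤ k → k < 4096 → ⊥
  lower-middle n< 300≤k k<4096 = cases (n <? 17 * k)
    where
    cases : Dec (n < 17 * k) → ⊥
    cases (yes n<17k) = refute-three (three-primes₂ n k 300≤k (≤-trans (*-monoʳ-≤ 2 300≤k) 2k≤n) n<17k
      (<-≤-trans n<17k (*-monoʳ-≤ 17 (<⇒≤ k<4096))))
    -- Here t = 16 works: k < 16³ = 4096, and n ≥ 17 k means n - k ≥ 16 k.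
    cases (no n≮17k) = lower-large 16 n< 300≤k k<4096 (ℕP.m+n≤o⇒m≤o∸n (k * 16)
      (subst (_≤ n) (trans (+-comm k (16 * k)) (cong (_+ k) (ℕP.*-comm 16 k))) (≮⇒≥ n≮17k)))

-- Binomial coefficients and primorials

C-suc-suc : ∀ n k → suc k * (suc n C suc k) ≡ suc n * (n C k)
C-suc-suc n k = begin
  suc k * (suc n C suc k) ≡⟨ cong (suc k *_) (sym (nCk+nC[k+1]≡[n+1]C[k+1] n k)) ⟩
  suc k * (n C k + n C suc k) ≡⟨ lem k (n C k) (n C suc k) ⟩
  n C k + (suc k * (n C suc k) + k * (n C k)) ≡⟨ cong (n C k +_) (C-absorb n k) ⟩
  suc n * (n C k) ∎
  where
  open ≡-Reasoning
  lem : ∀ k x y → suc k * (x + y) ≡ x + (suc k * y + k * x)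
  lem = solveℕ-∀

C-suc : ∀ k l → suc l * (suc (k + l) C k) ≡ suc (k + l) * ((k + l) C k)
C-suc k l = ℕP.+-cancelʳ-≡ (k * (suc (k + l) C k)) _ _ (begin
  suc l * X + k * X ≡⟨ lem k l X ⟩
  suc (k + l) * X ≡⟨ sym (C-absorb (suc (k + l)) k) ⟩
  suc k * (suc (k + l) C suc k) + k * X ≡⟨ cong (_+ k * X) (C-suc-suc (k + l) k) ⟩
  suc (k + l) * ((k + l) C k) + k * X ∎)
  where
  open ≡-Reasoning
  X = suc (k + l) C k
  lem : ∀ k l x → suc l * x + k * x ≡ suc (k + l) * x
  lem = solveℕ-∀

C-mono : ∀ k {m n} → m ≤ n → m C k ≤ n C k
C-mono zero    m≤n = ≤-refl
C-mono (suc k) {m} m≤n = go (ℕP.≤⇒≤′ m≤n)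
  where
  go : ∀ {n} → m ℕ.≤′ n → m C suc k ≤ n C suc k
  go ℕ.≤′-refl = ≤-refl
  go (ℕ.≤′-step {n} h) = ≤-trans (go h)
    (subst (n C suc k ≤_) (nCk+nC[k+1]≡[n+1]C[k+1] n k) (ℕP.m≤n+m (n C suc k) (n C k)))

C-falling : ∀ c k → k ! * ((c + k) C k) ≡ ∏ (λ j → suc c + j) k
C-falling c zero    = refl
C-falling c (suc k) = begin
  suc k * k ! * ((c + suc k) C suc k) ≡⟨ cong (λ n → suc k * k ! * (n C suc k)) (+-suc c k) ⟩
  suc k * k ! * (suc (c + k) C suc k) ≡⟨ lem₁ (suc k) (k !) (suc (c + k) C suc k) ⟩
  k ! * (suc k * (suc (c + k) C suc k)) ≡⟨ cong (k ! *_) (C-suc-suc (c + k) k) ⟩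
  k ! * (suc (c + k) * ((c + k) C k)) ≡⟨ lem₂ (k !) (suc (c + k)) ((c + k) C k) ⟩
  k ! * ((c + k) C k) * suc (c + k) ≡⟨ cong (_* suc (c + k)) (C-falling c k) ⟩
  ∏ (λ j → suc c + j) k * (suc c + k) ∎
  where
  open ≡-Reasoning
  lem₁ : ∀ a b c → a * b * c ≡ b * (a * c)
  lem₁ = solveℕ-∀
  lem₂ : ∀ a b c → a * (b * c) ≡ a * c * b
  lem₂ = solveℕ-∀

-- Successive binomial coefficients have the quotient 2 (2m + 3) / (m + 2) < 4.
middle-≤ : ∀ m → (suc (m + m) C m) ≤ 4 ^ m
middle-≤ zero    = ≤-refl
middle-≤ (suc m) = ℕP.*-cancelˡ-≤ (suc (suc m)) (begin
  suc (suc m) * Z ≡⟨ ratio ⟩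
  2 * (3 + (m + m)) * X ≤⟨ *-monoˡ-≤ X (subst₂ _≤_ (lem₃ m) (lem₄ m) (m≤m+n (6 + 4 * m) 2)) ⟩
  suc (suc m) * 4 * X ≤⟨ *-monoʳ-≤ (suc (suc m) * 4) (middle-≤ m) ⟩
  suc (suc m) * 4 * 4 ^ m ≡⟨ ℕP.*-assoc (suc (suc m)) 4 (4 ^ m) ⟩
  suc (suc m) * 4 ^ suc m ∎)
  where
  open ℕP.≤-Reasoning
  X = suc (m + m) C m
  Y = suc (suc (m + m)) C m
  Z = suc (suc m + suc m) C suc m
  Z′ : Z ≡ suc (suc (suc (m + m))) C suc m
  Z′ = cong (λ n → suc (suc n) C suc m) (+-suc m m)
  upZ : suc m * Z ≡ (3 + (m + m)) * Y
  upZ = trans (cong (suc m *_) Z′) (C-suc-suc (suc (suc (m + m))) m)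
  upY : suc (suc m) * Y ≡ (2 + (m + m)) * X
  upY = subst (λ n → suc (suc m) * (suc n C m) ≡ suc n * (n C m)) (+-suc m m) (C-suc m (suc m))
  lem₁ : ∀ a b z → a * (b * z) ≡ b * (a * z)
  lem₁ = solveℕ-∀
  lem₂ : ∀ m x → (3 + (m + m)) * ((2 + (m + m)) * x) ≡ (1 + m) * (2 * (3 + (m + m)) * x)
  lem₂ = solveℕ-∀
  lem₃ : ∀ m → 6 + 4 * m ≡ 2 * (3 + (m + m))
  lem₃ = solveℕ-∀
  lem₄ : ∀ m → 6 + 4 * m + 2 ≡ (2 + m) * 4
  lem₄ = solveℕ-∀
  ratio : suc (suc m) * Z ≡ 2 * (3 + (m + m)) * X
  ratio = ℕP.*-cancelˡ-≡ _ _ (suc m) (begin-equality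
    suc m * (suc (suc m) * Z) ≡⟨ lem₁ (suc m) (suc (suc m)) Z ⟩
    suc (suc m) * (suc m * Z) ≡⟨ cong (suc (suc m) *_) upZ ⟩
    suc (suc m) * ((3 + (m + m)) * Y) ≡⟨ lem₁ (suc (suc m)) (3 + (m + m)) Y ⟩
    (3 + (m + m)) * (suc (suc m) * Y) ≡⟨ cong ((3 + (m + m)) *_) upY ⟩
    (3 + (m + m)) * ((2 + (m + m)) * X) ≡⟨ lem₂ m X ⟩
    suc m * (2 * (3 + (m + m)) * X) ∎)

-- Successive values of the right-hand side have the quotient 2 (2k + 3) / (k + 1) > 4.
central-≥ : ∀ k → 4 ^ k ≤ suc (k + k) * ((k + k) C k)
central-≥ zero    = ≤-refl
central-≥ (suc k) = ℕP.*-cancelˡ-≤ (suc k) (begin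
  suc k * (4 * 4 ^ k) ≤⟨ *-monoʳ-≤ (suc k) (*-monoʳ-≤ 4 (central-≥ k)) ⟩
  suc k * (4 * (suc (k + k) * X)) ≡⟨ lem₁ k (suc (k + k) * X) ⟩
  (4 + 4 * k) * (suc (k + k) * X) ≤⟨ *-monoˡ-≤ (suc (k + k) * X) (m≤m+n (4 + 4 * k) 2) ⟩
  (4 + 4 * k + 2) * (suc (k + k) * X) ≡⟨ lem₂ k X ⟩
  (3 + (k + k)) * (2 * (suc (k + k) * X)) ≡⟨ cong ((3 + (k + k)) *_) (sym ratio) ⟩
  (3 + (k + k)) * (suc k * Z) ≡⟨ lem₃ (3 + (k + k)) (suc k) Z ⟩
  suc k * ((3 + (k + k)) * Z) ≡⟨ cong (λ n → suc k * (suc (suc n) * Z)) (sym (+-suc k k)) ⟩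
  suc k * (suc (suc k + suc k) * Z) ∎)
  where
  open ℕP.≤-Reasoning
  X = (k + k) C k
  Y = suc (k + k) C k
  Z = (suc k + suc k) C suc k
  lem₁ : ∀ k x → suc k * (4 * x) ≡ (4 + 4 * k) * x
  lem₁ = solveℕ-∀
  lem₂ : ∀ k x → (4 + 4 * k + 2) * (suc (k + k) * x) ≡ (3 + (k + k)) * (2 * (suc (k + k) * x))
  lem₂ = solveℕ-∀
  lem₃ : ∀ a b z → a * (b * z) ≡ b * (a * z)
  lem₃ = solveℕ-∀
  lem₄ : ∀ k y → (2 + (k + k)) * y ≡ 2 * (suc k * y)
  lem₄ = solveℕ-∀
  ratio : suc k * Z ≡ 2 * (suc (k + k) * X)
  ratio = begin-equality
    suc k * Z ≡⟨ cong (λ n → suc k * (suc n C suc k)) (+-suc k k) ⟩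
    suc k * (suc (suc (k + k)) C suc k) ≡⟨ C-suc-suc (suc (k + k)) k ⟩
    (2 + (k + k)) * Y ≡⟨ lem₄ k Y ⟩
    2 * (suc k * Y) ≡⟨ cong (2 *_) (C-suc k k) ⟩
    2 * (suc (k + k) * X) ∎

-- Starting at C(2k,k), each increase of the upper index multiplies by (2k + r + 1) / (k + r + 1),
-- which is at least 3/2 as long as r < k.
C-lower : ∀ k r → r ≤ k → 4 ^ k * 3 ^ r ≤ suc (k + k) * 2 ^ r * ((k + (k + r)) C k)
C-lower k zero r≤k = begin
  4 ^ k * 1 ≡⟨ ℕP.*-identityʳ (4 ^ k) ⟩
  4 ^ k ≤⟨ central-≥ k ⟩
  suc (k + k) * ((k + k) C k) ≡⟨ cong₂ (λ x n → x * ((k + n) C k)) (sym (ℕP.*-identityʳ (suc (k + k)))) (sym (+-identityʳ k)) ⟩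
  suc (k + k) * 1 * ((k + (k + 0)) C k) ∎
  where open ℕP.≤-Reasoning
C-lower k (suc r) r<k = begin
  4 ^ k * (3 * 3 ^ r) ≡⟨ lem₁ (4 ^ k) (3 ^ r) ⟩
  3 * (4 ^ k * 3 ^ r) ≤⟨ *-monoʳ-≤ 3 (C-lower k r (<⇒≤ r<k)) ⟩
  3 * (suc (k + k) * 2 ^ r * X) ≡⟨ lem₂ (suc (k + k)) (2 ^ r) X ⟩
  suc (k + k) * 2 ^ r * (3 * X) ≤⟨ *-monoʳ-≤ (suc (k + k) * 2 ^ r) 3X≤2Y ⟩
  suc (k + k) * 2 ^ r * (2 * Y) ≡⟨ lem₃ (suc (k + k)) (2 ^ r) Y ⟩
  suc (k + k) * (2 * 2 ^ r) * Y ≡⟨ cong (λ n → suc (k + k) * (2 * 2 ^ r) * (n C k)) lem₄ ⟩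
  suc (k + k) * (2 * 2 ^ r) * ((k + (k + suc r)) C k) ∎
  where
  open ℕP.≤-Reasoning
  X = (k + (k + r)) C k
  Y = suc (k + (k + r)) C k
  lem₁ : ∀ a b → a * (3 * b) ≡ 3 * (a * b)
  lem₁ = solveℕ-∀
  lem₂ : ∀ a b c → 3 * (a * b * c) ≡ a * b * (3 * c)
  lem₂ = solveℕ-∀
  lem₃ : ∀ a b c → a * b * (2 * c) ≡ a * (2 * b) * c
  lem₃ = solveℕ-∀
  lem₄ : suc (k + (k + r)) ≡ k + (k + suc r)
  lem₄ = trans (sym (+-suc k (k + r))) (cong (k +_) (sym (+-suc k r)))
  lem₅ : ∀ k r → 2 * suc (k + (k + r)) ≡ k + (3 * k + 2 * r + 2)
  lem₅ = solveℕ-∀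
  lem₆ : ∀ k r → suc r + (3 * k + 2 * r + 2) ≡ suc (k + r) * 3
  lem₆ = solveℕ-∀
  3X≤2Y : 3 * X ≤ 2 * Y
  3X≤2Y = ℕP.*-cancelˡ-≤ (suc (k + r)) (begin
    suc (k + r) * (3 * X) ≡⟨ sym (ℕP.*-assoc (suc (k + r)) 3 X) ⟩
    suc (k + r) * 3 * X ≤⟨ *-monoˡ-≤ X (subst₂ _≤_ (lem₆ k r) (sym (lem₅ k r)) (ℕP.+-monoˡ-≤ (3 * k + 2 * r + 2) r<k)) ⟩
    2 * suc (k + (k + r)) * X ≡⟨ ℕP.*-assoc 2 (suc (k + (k + r))) X ⟩
    2 * (suc (k + (k + r)) * X) ≡⟨ cong (2 *_) (sym (C-suc k (k + r))) ⟩
    2 * (suc (k + r) * Y) ≡⟨ lem₇ (suc (k + r)) Y ⟩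
    suc (k + r) * (2 * Y) ∎)
    where
    lem₇ : ∀ a b → 2 * (a * b) ≡ a * (2 * b)
    lem₇ = solveℕ-∀

primorial : ℕ → ℕ
primorial zero    = 1
primorial (suc y) = choose (prime? (suc y)) (suc y) 1 * primorial y

primorial>0 : ∀ y → 0 < primorial y
primorial>0 zero    = s≤s z≤n
primorial>0 (suc y) = *-mono-< (pos? (prime? (suc y))) (primorial>0 y)
  where
  pos? : ∀ {A : Set} (d : Dec A) → 0 < choose d (suc y) 1
  pos? (yes _) = s≤s z≤n
  pos? (no _)  = s≤s z≤n

∣-primorial : ∀ {p} y → Prime p → p ≤ y → p ∣ primorial y
∣-primorial zero pr p≤0 = contradiction (<-≤-trans (prime>0 pr) p≤0) λ ()
∣-primorial {p} (suc y) pr p≤y with ℕP.m≤n⇒m<n∨m≡n p≤y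
... | inj₁ p<y  = ℕ∣.∣n⇒∣m*n (choose (prime? (suc y)) (suc y) 1) (∣-primorial y pr (ℕP.≤-pred p<y))
... | inj₂ refl = ℕ∣.∣m⇒∣m*n (primorial y) (self (prime? (suc y)))
  where
  self : (d : Dec (Prime (suc y))) → suc y ∣ choose d (suc y) 1
  self (yes _)  = ℕ∣.∣-refl
  self (no ¬pr) = contradiction pr ¬pr

∤-1 : ∀ {p} → Prime p → p ∤ 1
∤-1 pr h = <⇒≱ (prime>1 pr) (ℕ∣.∣⇒≤ h)

∤-primorial : ∀ {p} y → Prime p → y < p → p ∤ primorial y
∤-primorial zero    pr y<p h = ∤-1 pr h
∤-primorial {p} (suc y) pr y<p h = cases (prime? (suc y)) (euclidsLemma _ (primorial y) pr h)
  where
  cases : (d : Dec (Prime (suc y))) → p ∣ choose d (suc y) 1 ⊎ p ∣ primorial y → ⊥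
  cases _       (inj₂ h′) = ∤-primorial y pr (ℕP.<-trans (n<1+n y) y<p) h′
  cases (yes _) (inj₁ h′) = <⇒≱ y<p (ℕ∣.∣⇒≤ h′)
  cases (no _)  (inj₁ h′) = ∤-1 pr h′

∤-factorial : ∀ {p} m → Prime p → m < p → p ∤ m !
∤-factorial zero    pr m<p h = ∤-1 pr h
∤-factorial (suc m) pr m<p h with euclidsLemma (suc m) (m !) pr h
... | inj₁ h′ = <⇒≱ m<p (ℕ∣.∣⇒≤ h′)
... | inj₂ h′ = ∤-factorial m pr (ℕP.<-trans (n<1+n m) m<p) h′

∣-middle : ∀ {p} m → Prime p → suc m < p → p ≤ suc (m + m) → p ∣ (suc (m + m) C m)
∣-middle {p} m pr m<p p≤ with euclidsLemma (m !) (suc (m + m) C m) pr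
  (subst (p ∣_) (sym (C-falling (suc m) m)) (subst (_∣ ∏ (λ j → suc (suc m) + j) m) p≡
    (∣-∏ (λ j → suc (suc m) + j) m (p ∸ suc (suc m)) small)))
  where
  p≡ : suc (suc m) + (p ∸ suc (suc m)) ≡ p
  p≡ = ℕP.m+[n∸m]≡n m<p
  small : p ∸ suc (suc m) < m
  small = ℕP.+-cancelˡ-< (suc (suc m)) _ _ (subst (_< suc (suc m) + m) (sym p≡) (s≤s p≤))
... | inj₁ h = contradiction h (∤-factorial m pr (ℕP.<-trans (n<1+n m) m<p))
... | inj₂ h = h

-- A prime p with m + 1 < p ≤ 2m + 1 divides the binomial coefficient but not the primorial
-- collected below p, so it divides the quotient and can be moved over.
primorial-middle : ∀ m j → j ≤ m → primorial (suc m + j) ∣ primorial (suc m) * (suc (m + m) C m)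
primorial-middle m zero    _   = subst (λ i → primorial i ∣ primorial (suc m) * (suc (m + m) C m))
  (sym (+-identityʳ (suc m))) (ℕ∣.m∣m*n _)
primorial-middle m (suc j) j<m =
  subst (λ i → primorial i ∣ M) (sym (+-suc (suc m) j)) (step (prime? p) (primorial-middle m j (<⇒≤ j<m)))
  where
  p = suc (suc m + j)
  M = primorial (suc m) * (suc (m + m) C m)
  step : (d : Dec (Prime p)) → primorial (suc m + j) ∣ M → choose d p 1 * primorial (suc m + j) ∣ M
  step (no _)   h = subst (_∣ M) (sym (ℕP.*-identityˡ _)) h
  step (yes pr) (divides s eq) = subst (p * primorial (suc m + j) ∣_) (sym eq)
    (ℕ∣.*-monoˡ-∣ (primorial (suc m + j)) (p∣s (euclidsLemma s _ pr (subst (p ∣_) eq p∣M))))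
    where
    p∣M : p ∣ M
    p∣M = ℕ∣.∣n⇒∣m*n (primorial (suc m)) (∣-middle m pr (s≤s (s≤s (m≤m+n m j)))
      (s≤s (subst (_≤ m + m) (+-suc m j) (ℕP.+-monoʳ-≤ m j<m))))
    p∣s : p ∣ s ⊎ p ∣ primorial (suc m + j) → p ∣ s
    p∣s (inj₁ h) = h
    p∣s (inj₂ h) = contradiction h (∤-primorial (suc m + j) pr (n<1+n _))

parity : ∀ n → ∃ λ m → n ≡ m + m ⊎ n ≡ suc (m + m)
parity zero = 0 , inj₁ refl
parity (suc n) with parity n
... | m , inj₁ e = m , inj₂ (cong suc e)
... | m , inj₂ e = suc m , inj₁ (trans (cong suc e) (cong suc (sym (+-suc m m))))

-- Erdős's induction: an even n > 2 adds no prime; for n = 2m + 1 the primes up to m + 1 are bounded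
-- by induction, and the product of the others divides C(2m + 1, m) ≤ 4^m.
primorial-≤ : ∀ n → primorial n ≤ 4 ^ n
primorial-≤ n = go n n ≤-refl
  where
  go : ∀ b n → n ≤ b → primorial n ≤ 4 ^ n
  go b       0 _ = ≤-refl
  go b       1 _ = ℕP.≤ᵇ⇒≤ (primorial 1) 4 _
  go b       2 _ = ℕP.≤ᵇ⇒≤ (primorial 2) 16 _
  go (suc b) n@(suc n′@(suc (suc n″))) (s≤s n′≤b) with parity n
  ... | m , inj₁ e = step (prime? n)
    where
    step : (d : Dec (Prime n)) → choose d n 1 * primorial n′ ≤ 4 ^ n
    step (no _) = ≤-trans (ℕP.≤-reflexive (ℕP.*-identityˡ (primorial n′)))
      (≤-trans (go b n′ n′≤b) (ℕP.^-monoʳ-≤ 4 (ℕP.n≤1+n n′)))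
    step (yes pr) with prime⇒irreducible pr (divides m (trans e (lem m)))
      where
      lem : ∀ m → m + m ≡ m * 2
      lem = solveℕ-∀
    ... | inj₁ ()
    ... | inj₂ ()
  ... | zero , inj₂ ()
  ... | suc m , inj₂ e = subst (λ i → primorial i ≤ 4 ^ i) (sym e) (begin
    primorial (suc (M + M)) ≤⟨ ℕ∣.∣⇒≤ ⦃ ℕ.>-nonZero (*-mono-< (primorial>0 (suc M)) C>0′) ⦄ (primorial-middle M M ≤-refl) ⟩
    primorial (suc M) * (suc (M + M) C M) ≤⟨ *-mono-≤ (go b (suc M) (≤-trans (ℕP.≤-pred (subst (suc (suc M) ≤_) (sym e) (s≤s (s≤s (ℕP.m≤n+m M m))))) n′≤b)) (middle-≤ M) ⟩
    4 ^ suc M * 4 ^ M ≡⟨ sym (ℕP.^-distribˡ-+-* 4 (suc M) M) ⟩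
    4 ^ suc (M + M) ∎)
    where
    open ℕP.≤-Reasoning
    M = suc m
    C>0′ : 0 < suc (M + M) C M
    C>0′ = ≤-trans (s≤s z≤n) (≤-trans (ℕP.≤-reflexive (sym (C-self M))) (C-mono M (ℕP.m≤n⇒m≤1+n (m≤m+n M M))))
      where open import Data.Nat.Combinatorics using () renaming (nCn≡1 to C-self)

-- The p-part of a binomial coefficient divides a single term of its numerator: up to
-- factors prime to p, that term is a common multiple of all terms.
prime-power-C : ∀ {p} → Prime p → ∀ c m i → (∀ j → j < suc m → Dominates p (suc c + j) (suc c + i)) →
  Dominates p ((c + suc m) C suc m) (suc c + i)
prime-power-C {p} pr c m i dom a h = ^-cancel pr a R t p∤R (subst (p ^ a ∣_) (ℕP.*-comm t R) (ℕ∣.∣-trans h C∣))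
  where
  t = suc c + i
  val : ∀ j → PFree p (suc c + j)
  val j = valuation pr (suc c + j) (s≤s z≤n)
  r : ℕ → ℕ
  r j = proj₁ (proj₂ (val j))
  R = ∏ r (suc m)
  p∤R : p ∤ R
  p∤R = go (suc m)
    where
    go : ∀ l → p ∤ ∏ r l
    go zero    h = ∤-1 pr h
    go (suc l) h with euclidsLemma (∏ r l) (r l) pr h
    ... | inj₁ h′ = go l h′
    ... | inj₂ h′ = proj₂ (proj₂ (proj₂ (val l))) h′
  term∣ : ∀ j → j < suc m → suc c + j * 1 ∣ t * R
  term∣ j j<m = subst (λ x → suc c + x ∣ t * R) (sym (ℕP.*-identityʳ j))
    (subst (_∣ t * R) (sym eq) (ℕ∣.*-pres-∣ (dom j j<m v (divides (r j) (trans eq (ℕP.*-comm (p ^ v) (r j)))))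
      (∣-∏ r (suc m) j j<m)))
    where
    v = proj₁ (val j)
    eq : suc c + j ≡ p ^ v * r j
    eq = proj₁ (proj₂ (proj₂ (val j)))
  C∣ : (c + suc m) C suc m ∣ t * R
  C∣ = ℕ∣.∣-trans (ℕ∣.n∣m*n (suc m)) (ℕ∣.*-cancelˡ-∣ (m !) ⦃ m ℕP.!≢0 ⦄
    (subst₂ _∣_ left (cong (_* (t * R)) (trans (cong (_* m !) (ℕP.^-zeroˡ m)) (ℕP.*-identityˡ (m !))))
      (window 1 m (suc c) (t * R) term∣)))
    where
    lem : ∀ a b c → a * b * c ≡ b * (a * c)
    lem = solveℕ-∀
    left : ∏ (λ j → suc c + j * 1) (suc m) ≡ m ! * (suc m * ((c + suc m) C suc m))
    left = trans (∏-cong (suc m) λ j → cong (suc c +_) (ℕP.*-identityʳ j))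
      (trans (sym (C-falling c (suc m))) (lem (suc m) (m !) _))

-- For n/3 < p ≤ k the only multiple of p among n, …, n - k + 1 is 2p, so that p is
-- cancelled by the denominator k!.
middle-prime∤C : ∀ {p} → Prime p → ∀ c k → 2 < p → p ≤ k → k ≤ c → c + k < 3 * p → p ∤ ((c + k) C k)
middle-prime∤C {p} pr c k 2<p p≤k k≤c n<3p h = cases (go k ≤-refl)
  where
  f : ℕ → ℕ
  f j = suc c + j
  -- One factor p comes from k!, the other from the assumption that p divides the binomial
  -- coefficient.
  p²∣ : p * p ∣ ∏ f k
  p²∣ = subst (p * p ∣_) (C-falling c k) (ℕ∣.*-pres-∣ (∣-factorial k p≤k) h)
    where
    ∣-factorial : ∀ m → p ≤ m → p ∣ m !
    ∣-factorial zero    p≤0 = contradiction (<-≤-trans (prime>0 pr) p≤0) λ ()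
    ∣-factorial (suc m) p≤m with ℕP.m≤n⇒m<n∨m≡n p≤m
    ... | inj₁ p<m  = ℕ∣.∣n⇒∣m*n (suc m) (∣-factorial m (ℕP.≤-pred p<m))
    ... | inj₂ refl = ℕ∣.m∣m*n (m !)
  multiple : ∀ j → j < k → p ∣ f j → f j ≡ p + p
  multiple j j<k (divides q e) = quotient q e
    where
    p<f : p < f j
    p<f = ≤-<-trans p≤k (≤-<-trans k≤c (s≤s (m≤m+n c j)))
    f<3p : f j < 3 * p
    f<3p = ≤-<-trans (subst (_≤ c + k) (+-suc c j) (ℕP.+-monoʳ-≤ c j<k)) n<3p
    quotient : ∀ q → f j ≡ q * p → f j ≡ p + p
    quotient 0 e = contradiction e λ ()
    quotient 1 e = contradiction (sym (trans e (ℕP.*-identityˡ p))) (<⇒≢ p<f)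
    quotient 2 e = trans e (cong (p +_) (+-identityʳ p))
    quotient (suc (suc (suc q))) e = contradiction (subst (_< 3 * p) e f<3p)
      (ℕP.≤⇒≯ (*-monoˡ-≤ p (s≤s (s≤s (s≤s (z≤n {q}))))))
  square : ∀ x y → p ∤ x → p * p ∣ x * y → p * p ∣ y
  square x y p∤x = subst (λ z → z ∣ x * y → z ∣ y) (cong (p *_) (ℕP.*-identityʳ p)) (^-cancel pr 2 x y p∤x)
  p²∤2p : p * p ∤ p + p
  p²∤2p d = <⇒≱ 2<p (ℕ∣.∣⇒≤ (ℕ∣.*-cancelˡ-∣ p ⦃ prime⇒nonZero pr ⦄ (subst (p * p ∣_) (lem p) d)))
    where
    lem : ∀ p → p + p ≡ p * 2
    lem = solveℕ-∀
  -- While the numerator is scanned, either p has divided no factor yet, or its only multiple 2p has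
  -- been passed; since p > 2, it contributed a single p.
  go : ∀ m → m ≤ k → p ∤ ∏ f m ⊎ (p + p < f m × ¬ p * p ∣ ∏ f m)
  go zero    _   = inj₁ (∤-1 pr)
  go (suc m) m<k with go m (<⇒≤ m<k) | p ℕ∣.∣? f m
  ... | inj₁ p∤Π | no p∤f = inj₁ λ d → both (euclidsLemma (∏ f m) (f m) pr d)
    where
    both : p ∣ ∏ f m ⊎ p ∣ f m → ⊥
    both (inj₁ x) = p∤Π x
    both (inj₂ x) = p∤f x
  ... | inj₁ p∤Π | yes p∣f = inj₂ (ℕP.≤-reflexive (trans (cong suc (sym (multiple m m<k p∣f))) (sym (+-suc (suc c) m))) ,
    λ d → p²∤2p (subst (p * p ∣_) (multiple m m<k p∣f) (square (∏ f m) (f m) p∤Π d)))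
  ... | inj₂ (2p< , _) | yes p∣f = contradiction (multiple m m<k p∣f) (>⇒≢ 2p<)
  ... | inj₂ (2p< , p²∤) | no p∤f = inj₂ (<-≤-trans 2p< (ℕP.+-monoʳ-≤ (suc c) (ℕP.n≤1+n m)) ,
    λ d → p²∤ (square (f m) (∏ f m) p∤f (subst (p * p ∣_) (ℕP.*-comm (∏ f m) (f m)) d)))
  cases : p ∤ ∏ f k ⊎ (p + p < f k × ¬ p * p ∣ ∏ f k) → ⊥
  cases (inj₁ p∤)      = p∤ (ℕ∣.∣-trans (ℕ∣.m∣m*n p) p²∣)
  cases (inj₂ (_ , p²∤)) = p²∤ p²∣

-- The size of C(n,k) when n < (k + 1)²

product-≤ : ∀ b xs → (∀ x → x ∈ xs → x ≤ b) → product xs ≤ b ^ length xs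
product-≤ b []       h = ≤-refl
product-≤ b (x ∷ xs) h = *-mono-≤ (h x (here refl)) (product-≤ b xs λ y y∈ → h y (there y∈))

product>0 : ∀ xs → (∀ x → x ∈ xs → 0 < x) → 0 < product xs
product>0 []       h = s≤s z≤n
product>0 (x ∷ xs) h = *-mono-< (h x (here refl)) (product>0 xs λ y y∈ → h y (there y∈))

module Chebyshev {n k d e : ℕ} (D : Degrees n k d e) (2k≤n : 2 * k ≤ n) (n< : n < suc k * suc k) where
  open Degrees D
  open Windows D 2k≤n

  -- Primes up to s are charged to the largest power in the window, the others divide
  -- C(n,k) at most once.
  C-upper : ∀ s y ps → (∀ p → Prime p → p ≤ s → p ∈ ps) → n < s * s →
    (∀ p → Prime p → y < p → p ≤ k → s < p → p ∤ (n C k)) →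
    n C k ≤ primorial y * n ^ (length ps + 2)
  C-upper s y ps all n<s² none = ≤-trans
    (ℕ∣.∣⇒≤ ⦃ ℕ.>-nonZero (*-mono-< (primorial>0 y) (product>0 xs xs>0)) ⦄ C∣)
    (*-monoʳ-≤ (primorial y) (subst (λ l → product xs ≤ n ^ l) length≡ (product-≤ n xs xs≤)))
    where
    m = k ∸ 1
    c = n ∸ k
    k≡ : suc m ≡ k
    k≡ = ℕP.m+[n∸m]≡n k>0
    n≡ : c + suc m ≡ n
    n≡ = trans (cong (c +_) k≡) (ℕP.m∸n+n≡m k≤n)
    f : ℕ → ℕ
    f j = suc c + j
    best : ∀ p → ∃ λ i → i < suc m × (Prime p → ∀ j → j < suc m → Dominates p (f j) (f i))
    best p with prime? p
    ... | yes pr = proj₁ am , proj₁ (proj₂ am) , λ _ → proj₂ (proj₂ am)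
      where am = argmax pr f (λ _ → s≤s z≤n) m
    ... | no ¬pr = 0 , s≤s z≤n , λ pr → contradiction pr ¬pr
    idx : ℕ → ℕ
    idx p = proj₁ (best p)
    -- The last two entries take the primes above k, which by `once` divide no terms other than n -
    -- d and n - e.
    xs : List ℕ
    xs = map (f ∘ idx) ps ++ n ∸ d ∷ n ∸ e ∷ []
    length≡ : length xs ≡ length ps + 2
    length≡ = trans (ListP.length-++ (map (f ∘ idx) ps)) (cong (_+ 2) (ListP.length-map (f ∘ idx) ps))
    f≤n : ∀ j → j < suc m → f j ≤ n
    f≤n j j<m = subst (f j ≤_) n≡ (subst (_≤ c + suc m) (+-suc c j) (ℕP.+-monoʳ-≤ c j<m))
    bounds : ∀ x → x ∈ xs → 0 < x × x ≤ n
    bounds x x∈ with ∈P.∈-++⁻ (map (f ∘ idx) ps) x∈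
    ... | inj₂ (here refl) = term>0 d (subst (d ≤_) d+e (m≤m+n d e)) , ℕP.m∸n≤m n d
    ... | inj₂ (there (here refl)) = term>0 e (subst (e ≤_) d+e (ℕP.m≤n+m e d)) , ℕP.m∸n≤m n e
    ... | inj₁ x∈map with ∈P.∈-map⁻ (f ∘ idx) x∈map
    ...   | p , _ , refl = s≤s z≤n , f≤n (idx p) (proj₁ (proj₂ (best p)))
    xs>0 : ∀ x → x ∈ xs → 0 < x
    xs>0 x x∈ = proj₁ (bounds x x∈)
    xs≤ : ∀ x → x ∈ xs → x ≤ n
    xs≤ x x∈ = proj₂ (bounds x x∈)
    powers : ∀ p a → Prime p → p ^ a ∣ n C k → p ^ a ∣ primorial y * product xs
    powers p zero    pr h = ℕ∣.1∣ _
    powers p (suc a) pr h = cases (p ≤? k) (p ≤? s)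
      where
      i = idx p
      i<m : i < suc m
      i<m = proj₁ (proj₂ (best p))
      power : p ^ suc a ∣ f i
      power = prime-power-C pr c m i (proj₂ (proj₂ (best p)) pr) (suc a)
        (subst₂ (λ u v → p ^ suc a ∣ u C v) (sym n≡) (sym k≡) h)
      in-xs : ∀ {x} → x ∈ xs → p ^ suc a ∣ x → p ^ suc a ∣ primorial y * product xs
      in-xs x∈ d = ℕ∣.∣n⇒∣m*n (primorial y) (ℕ∣.∣-trans d (∈⇒∣product x∈))
      p∣C : p ∣ n C k
      p∣C = ℕ∣.∣-trans (ℕ∣.m∣m*n (p ^ a)) h
      cases : Dec (p ≤ k) → Dec (p ≤ s) → p ^ suc a ∣ primorial y * product xs
      cases _ (yes p≤s) = in-xs (∈P.∈-++⁺ˡ (∈P.∈-map⁺ (f ∘ idx) (all p pr p≤s))) power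
      cases (no p≰k) (no _) = large (once p (m ∸ i) pr (≰⇒> p≰k) (≤-trans (ℕP.m∸n≤m m i) m≤k) p∣term
          (no-power (m ∸ i) (≤-trans (ℕP.m∸n≤m m i) m≤k) n< (*-mono-≤ (≰⇒> p≰k) (≰⇒> p≰k))))
        where
        m≤k : m ≤ k
        m≤k = ℕP.m∸n≤m k 1
        f≡ : f i ≡ n ∸ (m ∸ i)
        f≡ = trans (sym (+-suc c i)) (term (m ∸ i) (suc i)
          (trans (+-suc (m ∸ i) i) (trans (cong suc (ℕP.m∸n+n≡m (ℕP.≤-pred i<m))) k≡)))
        p∣term : p ∣ n ∸ (m ∸ i)
        p∣term = subst (p ∣_) f≡ (ℕ∣.∣-trans (ℕ∣.m∣m*n (p ^ a)) power)
        large : m ∸ i ≡ d ⊎ m ∸ i ≡ e → p ^ suc a ∣ primorial y * product xs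
        large (inj₁ x) = in-xs (∈P.∈-++⁺ʳ (map (f ∘ idx) ps) (here refl))
          (subst (p ^ suc a ∣_) (trans f≡ (cong (n ∸_) x)) power)
        large (inj₂ x) = in-xs (∈P.∈-++⁺ʳ (map (f ∘ idx) ps) (there (here refl)))
          (subst (p ^ suc a ∣_) (trans f≡ (cong (n ∸_) x)) power)
      cases (yes p≤k) (no p≰s) = single a power (p ≤? y)
        where
        -- Since p > s, p² exceeds n and the exponent is 1; since p divides C(n,k), it is at most y
        -- and is accounted for by the primorial.
        single : ∀ b → p ^ suc b ∣ f i → Dec (p ≤ y) → p ^ suc b ∣ primorial y * product xs
        single zero    _ (yes p≤y) = ℕ∣.∣m⇒∣m*n (product xs)
          (subst (_∣ primorial y) (sym (ℕP.*-identityʳ p)) (∣-primorial y pr p≤y))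
        single b       _ (no p≰y) = contradiction p∣C (none p pr (≰⇒> p≰y) p≤k (≰⇒> p≰s))
        single (suc b) h _ = contradiction (f≤n i i<m) (<⇒≱ (<-≤-trans n<s²
          (≤-trans (*-mono-≤ (<⇒≤ (≰⇒> p≰s)) (<⇒≤ (≰⇒> p≰s)))
            (ℕ∣.∣⇒≤ (ℕ∣.∣-trans (ℕ∣.*-monoʳ-∣ p (ℕ∣.m∣m*n (p ^ b))) h)))))
    C∣ : n C k ∣ primorial y * product xs
    C∣ = ∣-by-prime-powers (n C k) (primorial y * product xs) C>0′ powers
      where
      C>0′ : 0 < n C k
      C>0′ = ≤-trans (subst (0 <_) (sym (C-self k)) (s≤s z≤n)) (C-mono k k≤n)
        where open import Data.Nat.Combinatorics using () renaming (nCn≡1 to C-self)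

  -- `C-lower` is played against `C-upper`. If n ≥ 3k, the primorial of k costs at most 4^k, and
  -- (3/2)^k is left. If n = 2k + r < 3k, no prime p > s between n/3 and k divides C(n,k), so the
  -- primorial costs only 4^(n/3). What is left is (3/2)^r 4^((k - r)/3), and 4 ≥ (3/2)³, i.e. 32 ≥
  -- 27, makes this at least (3/2)^k. Cubes are compared to avoid thirds in the exponent.
  growth : ∀ s ps → (∀ p → Prime p → p ≤ s → p ∈ ps) → n < s * s → 2 < s →
    3 ^ k ≤ 2 ^ k * (suc (k + k) * n ^ (length ps + 2))
  growth s ps all n<s² 2<s = cases (n <? 3 * k)
    where
    open ℕP.≤-Reasoning
    N = n ^ (length ps + 2)
    B = suc (k + k) * N
    cases : Dec (n < 3 * k) → 3 ^ k ≤ 2 ^ k * B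
    cases (no n≮3k) = ℕP.*-cancelˡ-≤ (4 ^ k) ⦃ ℕP.m^n≢0 4 k ⦄ (begin
      4 ^ k * 3 ^ k ≤⟨ C-lower k k ≤-refl ⟩
      suc (k + k) * 2 ^ k * ((k + (k + k)) C k) ≤⟨ *-monoʳ-≤ (suc (k + k) * 2 ^ k) (C-mono k 3k≤n) ⟩
      suc (k + k) * 2 ^ k * (n C k) ≤⟨ *-monoʳ-≤ (suc (k + k) * 2 ^ k) (C-upper s k ps all n<s²
                                                               (λ p _ k<p p≤k _ → contradiction p≤k (<⇒≱ k<p))) ⟩
      suc (k + k) * 2 ^ k * (primorial k * N) ≤⟨ *-monoʳ-≤ (suc (k + k) * 2 ^ k) (*-monoˡ-≤ N (primorial-≤ k)) ⟩
      suc (k + k) * 2 ^ k * (4 ^ k * N) ≡⟨ lem (suc (k + k)) (2 ^ k) (4 ^ k) N ⟩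
      4 ^ k * (2 ^ k * B) ∎)
      where
      lem : ∀ a b c d → a * b * (c * d) ≡ c * (b * (a * d))
      lem = solveℕ-∀
      3k≤n : k + (k + k) ≤ n
      3k≤n = subst (_≤ n) (cong (λ x → k + (k + x)) (+-identityʳ k)) (≮⇒≥ n≮3k)
    cases (yes n<3k) = ≮⇒≥ λ h → ℕP.<-irrefl refl (begin-strict
      c4 * (a3 * b3) ≡⟨ sym (ℕP.*-assoc c4 a3 b3) ⟩
      c4 * a3 * b3 ≤⟨ *-mono-≤ reduced (27≤32 z) ⟩
      d3 * 4 ^ r * B³ * (e3 * 4 ^ z) ≡⟨ lem₁ d3 (4 ^ r) B³ e3 (4 ^ z) ⟩
      4 ^ r * 4 ^ z * (d3 * e3 * B³) ≡⟨ cong₂ (λ x y → x * (y * B³)) (merge 4) (sym (split³ 2)) ⟩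
      c4 * (cube (2 ^ k) * B³) ≡⟨ cong (c4 *_) (sym (cube-* (2 ^ k) B)) ⟩
      c4 * cube (2 ^ k * B) <⟨ ℕP.*-monoʳ-< c4 ⦃ ℕP.m^n≢0 4 k ⦄ (cube-< h) ⟩
      c4 * cube (3 ^ k) ≡⟨ cong (c4 *_) (split³ 3) ⟩
      c4 * (a3 * b3) ∎)
      where
      cube : ℕ → ℕ
      cube x = x * x * x
      cube-* : ∀ x y → cube (x * y) ≡ cube x * cube y
      cube-* x y = lem x y
        where
        lem : ∀ x y → x * y * (x * y) * (x * y) ≡ x * x * x * (y * y * y)
        lem = solveℕ-∀
      cube-≤ : ∀ {x y} → x ≤ y → cube x ≤ cube y
      cube-≤ h = *-mono-≤ (*-mono-≤ h h) h
      cube-< : ∀ {x y} → x < y → cube x < cube y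
      cube-< h = *-mono-< (*-mono-< h h) h
      r = n ∸ (k + k)
      n≡ : k + (k + r) ≡ n
      n≡ = trans (sym (ℕP.+-assoc k k r)) (ℕP.m+[n∸m]≡n k+k≤n)
      r≤k : r ≤ k
      r≤k = ℕP.+-cancelˡ-≤ (k + k) r k (subst₂ _≤_ (sym (ℕP.m+[n∸m]≡n k+k≤n)) (lem k) (<⇒≤ n<3k))
        where
        lem : ∀ k → 3 * k ≡ k + k + k
        lem = solveℕ-∀
      z = k ∸ r
      y = n /ℕ 3
      merge : ∀ x → x ^ r * x ^ z ≡ x ^ k
      merge x = trans (sym (ℕP.^-distribˡ-+-* x r z)) (cong (x ^_) (ℕP.m+[n∸m]≡n r≤k))
      split³ : ∀ x → cube (x ^ k) ≡ cube (x ^ r) * cube (x ^ z)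
      split³ x = trans (cong cube (sym (merge x))) (cube-* (x ^ r) (x ^ z))
      c4 = 4 ^ k
      a3 = cube (3 ^ r)
      b3 = cube (3 ^ z)
      d3 = cube (2 ^ r)
      e3 = cube (2 ^ z)
      B³ = cube B
      lem₁ : ∀ d f b e g → d * f * b * (e * g) ≡ f * g * (d * e * b)
      lem₁ = solveℕ-∀
      27≤32 : ∀ z → cube (3 ^ z) ≤ cube (2 ^ z) * 4 ^ z
      27≤32 zero    = ≤-refl
      27≤32 (suc z) = subst₂ _≤_ (sym (cube-* 3 (3 ^ z))) (trans (lem (cube (2 ^ z)) (4 ^ z)) (cong (_* 4 ^ suc z) (sym (cube-* 2 (2 ^ z)))))
        (*-mono-≤ (ℕP.≤ᵇ⇒≤ 27 32 _) (27≤32 z))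
        where
        lem : ∀ x y → 32 * (x * y) ≡ 8 * x * (4 * y)
        lem = solveℕ-∀
      third≤ : 3 * y ≤ n
      third≤ = subst (_≤ n) (ℕP.*-comm y 3) (m/n*n≤m n 3)
      none : ∀ p → Prime p → y < p → p ≤ k → s < p → p ∤ (n C k)
      none p pr y<p p≤k s<p = subst (λ m → p ∤ (m C k)) (ℕP.m∸n+n≡m k≤n)
        (middle-prime∤C pr (n ∸ k) k (ℕP.<-trans 2<s s<p) p≤k k≤n∸k
          (subst (_< 3 * p) (sym (ℕP.m∸n+n≡m k≤n)) n<3p))
        where
        n<3p : n < 3 * p
        n<3p = subst (_< 3 * p) (sym (m≡m%n+[m/n]*n n 3)) (<-≤-trans
          (ℕP.+-monoˡ-< (y * 3) (m%n<n n 3))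
          (subst (suc y * 3 ≤_) (ℕP.*-comm p 3) (*-monoˡ-≤ 3 y<p)))
      first : 4 ^ k * 3 ^ r ≤ 2 ^ r * 4 ^ y * B
      first = begin
        4 ^ k * 3 ^ r ≤⟨ C-lower k r r≤k ⟩
        suc (k + k) * 2 ^ r * ((k + (k + r)) C k) ≡⟨ cong (λ m → suc (k + k) * 2 ^ r * (m C k)) n≡ ⟩
        suc (k + k) * 2 ^ r * (n C k) ≤⟨ *-monoʳ-≤ (suc (k + k) * 2 ^ r) (C-upper s y ps all n<s² none) ⟩
        suc (k + k) * 2 ^ r * (primorial y * N) ≤⟨ *-monoʳ-≤ (suc (k + k) * 2 ^ r) (*-monoˡ-≤ N (primorial-≤ y)) ⟩
        suc (k + k) * 2 ^ r * (4 ^ y * N) ≡⟨ lem (suc (k + k)) (2 ^ r) (4 ^ y) N ⟩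
        2 ^ r * 4 ^ y * B ∎
        where
        lem : ∀ a b c d → a * b * (c * d) ≡ b * c * (a * d)
        lem = solveℕ-∀
      third-power : cube (4 ^ y) ≤ 4 ^ k * (4 ^ k * 4 ^ r)
      third-power = begin
        cube (4 ^ y) ≡⟨ lem (4 ^ y) ⟩
        (4 ^ y) ^ 3 ≡⟨ ℕP.^-*-assoc 4 y 3 ⟩
        4 ^ (y * 3) ≤⟨ ℕP.^-monoʳ-≤ 4 (subst (_≤ n) (ℕP.*-comm 3 y) third≤) ⟩
        4 ^ n ≡⟨ cong (4 ^_) (sym n≡) ⟩
        4 ^ (k + (k + r)) ≡⟨ trans (ℕP.^-distribˡ-+-* 4 k (k + r)) (cong (4 ^ k *_) (ℕP.^-distribˡ-+-* 4 k r)) ⟩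
        4 ^ k * (4 ^ k * 4 ^ r) ∎
        where
        lem : ∀ x → x * x * x ≡ x * (x * (x * 1))
        lem = solveℕ-∀
      reduced : c4 * a3 ≤ d3 * 4 ^ r * B³
      reduced = ℕP.*-cancelˡ-≤ (c4 * c4) ⦃ ℕP.m*n≢0 c4 c4 ⦃ ℕP.m^n≢0 4 k ⦄ ⦃ ℕP.m^n≢0 4 k ⦄ ⦄ (begin
        c4 * c4 * (c4 * a3) ≡⟨ trans (sym (ℕP.*-assoc (c4 * c4) c4 a3)) (sym (cube-* c4 (3 ^ r))) ⟩
        cube (c4 * 3 ^ r) ≤⟨ cube-≤ first ⟩
        cube (2 ^ r * 4 ^ y * B) ≡⟨ trans (cube-* (2 ^ r * 4 ^ y) B) (cong (_* B³) (cube-* (2 ^ r) (4 ^ y))) ⟩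
        d3 * cube (4 ^ y) * B³ ≤⟨ *-monoˡ-≤ B³ (*-monoʳ-≤ d3 third-power) ⟩
        d3 * (c4 * (c4 * 4 ^ r)) * B³ ≡⟨ lem d3 c4 (4 ^ r) B³ ⟩
        c4 * c4 * (d3 * 4 ^ r * B³) ∎)
        where
        lem : ∀ d c f b → d * (c * (c * f)) * b ≡ c * c * (d * f * b)
        lem = solveℕ-∀

cube-root : ∀ k → ∃ λ u → u * u * u ≤ k × k < suc u * suc u * suc u
cube-root zero    = 0 , z≤n , s≤s z≤n
cube-root (suc k) with cube-root k
... | u , lo , hi with suc k <? suc u * suc u * suc u
...   | yes p = u , ℕP.m≤n⇒m≤1+n lo , p
...   | no np = suc u , ≮⇒≥ np ,
  ≤-<-trans hi (*-mono-< (*-mono-< (n<1+n (suc u)) (n<1+n (suc u))) (n<1+n (suc u)))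

-- This is (u + 2)² ≤ (3/2)^u. The induction needs 2 (u + 3)² ≤ 3 (u + 2)², true from u = 3 on; the
-- start at 16 fits the threshold k ≥ 4096 = 16³.
exponential : ∀ u → 16 ≤ u → suc (suc u) * suc (suc u) * 2 ^ u ≤ 3 ^ u
exponential u 16≤u = go (ℕP.≤⇒≤′ 16≤u)
  where
  go : ∀ {u} → 16 ℕ.≤′ u → suc (suc u) * suc (suc u) * 2 ^ u ≤ 3 ^ u
  go ℕ.≤′-refl = ℕP.≤ᵇ⇒≤ (18 * 18 * 2 ^ 16) (3 ^ 16) _
  go (ℕ.≤′-step {u} h) = begin
    (3 + u) * (3 + u) * (2 * 2 ^ u) ≡⟨ lem₁ (3 + u) (2 ^ u) ⟩
    2 * ((3 + u) * (3 + u)) * 2 ^ u ≤⟨ *-monoˡ-≤ (2 ^ u) (step (u ∸ 3) (ℕP.m∸n+n≡m 3≤u)) ⟩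
    3 * ((2 + u) * (2 + u)) * 2 ^ u ≡⟨ ℕP.*-assoc 3 ((2 + u) * (2 + u)) (2 ^ u) ⟩
    3 * ((2 + u) * (2 + u) * 2 ^ u) ≤⟨ *-monoʳ-≤ 3 (go h) ⟩
    3 * 3 ^ u ∎
    where
    open ℕP.≤-Reasoning
    lem₁ : ∀ a b → a * a * (2 * b) ≡ 2 * (a * a) * b
    lem₁ = solveℕ-∀
    3≤u : 3 ≤ u
    3≤u = ≤-trans (m≤m+n 3 13) (ℕP.≤′⇒≤ h)
    lem₂ : ∀ x → 2 * ((3 + (x + 3)) * (3 + (x + 3))) + (3 + 6 * x + x * x) ≡ 3 * ((2 + (x + 3)) * (2 + (x + 3)))
    lem₂ = solveℕ-∀
    step : ∀ x → x + 3 ≡ u → 2 * ((3 + u) * (3 + u)) ≤ 3 * ((2 + u) * (2 + u))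
    step x refl = subst (2 * ((3 + (x + 3)) * (3 + (x + 3))) ≤_) (lem₂ x) (m≤m+n _ (3 + 6 * x + x * x))

-- With u the integer cube root of k, either n - k ≥ k (u + 1) and there are too few primes
-- up to k for the window, or n < (u + 2)⁴ and C(n,k) is too large.
module _ {n k d e : ℕ} (D : Degrees n k d e) (2k≤n : 2 * k ≤ n) (n< : n < suc k * suc k) (4096≤k : 4096 ≤ k) where
  open Windows D 2k≤n
  open Chebyshev D 2k≤n n<

  lower-huge : ⊥
  lower-huge with cube-root k
  ... | u , u³≤k , k<t³ = cases (k * suc u ≤? n ∸ k)
    where
    open ℕP.≤-Reasoning
    t = suc u
    w = suc t
    S = w * w
    ps = candidates wheel S
    l = length ps
    -- An exponent for which (2k + 1) n^(l + 2) ≤ (w⁴)^(l + 3) ≤ w^E: the bound on candidates gives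
    -- 4 (l + 3) = 4 (l + 1) + 8 ≤ S + 8.
    E = S + 8
    16≤u : 16 ≤ u
    16≤u = ≮⇒≥ λ u<16 → <⇒≱ k<t³
      (≤-trans (*-mono-≤ (*-mono-≤ u<16 u<16) u<16) 4096≤k)
    18≤w : 18 ≤ w
    18≤w = s≤s (s≤s 16≤u)
    300≤S : 300 ≤ S
    300≤S = ≤-trans (ℕP.≤ᵇ⇒≤ 300 324 _) (*-mono-≤ 18≤w 18≤w)
    -- For u ≥ 16, u ((u + 2)² + 8) is below 2 u³, and u³ ≤ k; the identity is expanded at x = u -
    -- 16 so that all its coefficients are positive.
    uE<2k : u * E < k + k
    uE<2k = <-≤-trans (strictly (u ∸ 16) (ℕP.m∸n+n≡m 16≤u)) (ℕP.+-mono-≤ u³≤k u³≤k)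
      where
      lem : ∀ x → (x + 16) * ((2 + (x + 16)) * (2 + (x + 16)) + 8) + (x + 16) * (x * x + 28 * x + 180) ≡
        (x + 16) * (x + 16) * (x + 16) + (x + 16) * (x + 16) * (x + 16)
      lem = solveℕ-∀
      strictly : ∀ x → x + 16 ≡ u → u * E < u * u * u + u * u * u
      strictly x refl = subst (u * E <_) (lem x) (ℕP.m<m+n (u * E)
        (*-mono-< {0} {u} {0} (≤-trans (s≤s z≤n) 16≤u) (≤-trans (s≤s z≤n) (ℕP.m≤n+m 180 (x * x + 28 * x)))))
    cases : Dec (k * t ≤ n ∸ k) → ⊥
    cases (yes kt≤) = lower-large D 2k≤n t n< (≤-trans (ℕP.≤ᵇ⇒≤ 300 4096 _) 4096≤k) k<t³ kt≤
    -- Squaring `grown` gives (3/2)^(2k) ≤ w^(2E), and w² ≤ (3/2)^u makes this at most (3/2)^(u E),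
    -- although u E < 2k. The excess z of the exponents would satisfy 3^z ≤ 2^z.
    cases (no kt≰) = <⇒≱ (ℕP.^-monoˡ-< z ⦃ ℕ.>-nonZero z>0 ⦄ (n<1+n 2)) 3ᶻ≤2ᶻ
      where
      n<w⁴ : n < S * S
      n<w⁴ = begin-strict
        n ≡⟨ sym (ℕP.m∸n+n≡m k≤n) ⟩
        n ∸ k + k <⟨ ℕP.+-monoˡ-< k (≰⇒> kt≰) ⟩
        k * t + k ≡⟨ trans (+-comm (k * t) k) (sym (ℕP.*-suc k t)) ⟩
        k * w ≤⟨ *-monoˡ-≤ w (<⇒≤ k<t³) ⟩
        t * t * t * w ≤⟨ *-monoˡ-≤ w (*-mono-≤ (*-mono-≤ t≤w t≤w) t≤w) ⟩
        w * w * w * w ≡⟨ ℕP.*-assoc (w * w) w w ⟩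
        S * S ∎
        where
        t≤w = ℕP.n≤1+n t
      S²≡ : S * S ≡ w ^ 4
      S²≡ = lem w
        where
        lem : ∀ w → w * w * (w * w) ≡ w * (w * (w * (w * 1)))
        lem = solveℕ-∀
      bound : suc (k + k) * n ^ (l + 2) ≤ w ^ E
      bound = begin
        suc (k + k) * n ^ (l + 2) ≤⟨ *-mono-≤ (≤-trans (s≤s k+k≤n) n<w⁴) (ℕP.^-monoˡ-≤ (l + 2) (<⇒≤ n<w⁴)) ⟩
        S * S * (S * S) ^ (l + 2) ≡⟨ cong (λ x → x ^ suc (l + 2)) S²≡ ⟩
        (w ^ 4) ^ suc (l + 2) ≡⟨ ℕP.^-*-assoc w 4 (suc (l + 2)) ⟩
        w ^ (4 * suc (l + 2)) ≤⟨ ℕP.^-monoʳ-≤ w (subst (_≤ E) (lem l) (ℕP.+-monoˡ-≤ 8 (candidates-bound S 300≤S))) ⟩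
        w ^ E ∎
        where
        lem : ∀ l → 4 * (l + 1) + 8 ≡ 4 * suc (l + 2)
        lem = solveℕ-∀
      grown : 3 ^ k ≤ 2 ^ k * w ^ E
      grown = ≤-trans (growth S ps (candidates-complete wheel wheel>1 S) n<w⁴ (≤-trans (ℕP.≤ᵇ⇒≤ 3 300 _) 300≤S))
        (*-monoʳ-≤ (2 ^ k) bound)
      powered : w ^ E * w ^ E * 2 ^ (u * E) ≤ 3 ^ (u * E)
      powered = subst₂ _≤_ (trans (^-distribʳ-* E (w * w) (2 ^ u)) (cong₂ _*_ (^-distribʳ-* E w w) (ℕP.^-*-assoc 2 u E)))
        (ℕP.^-*-assoc 3 u E) (ℕP.^-monoˡ-≤ E (exponential u 16≤u))
      z = k + k ∸ u * E
      z>0 : 0 < z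
      z>0 = ℕP.m<n⇒0<n∸m uE<2k
      doubled : ∀ x → x ^ k * x ^ k ≡ x ^ (u * E) * x ^ z
      doubled x = trans (sym (ℕP.^-distribˡ-+-* x k k)) (trans (cong (x ^_) (sym (ℕP.m+[n∸m]≡n (<⇒≤ uE<2k))))
        (ℕP.^-distribˡ-+-* x (u * E) z))
      3ᶻ≤2ᶻ : 3 ^ z ≤ 2 ^ z
      3ᶻ≤2ᶻ = ℕP.*-cancelˡ-≤ (p3 * p2) ⦃ ℕP.m*n≢0 p3 p2 ⦃ ℕP.m^n≢0 3 (u * E) ⦄ ⦃ ℕP.m^n≢0 2 (u * E) ⦄ ⦄ (begin
        p3 * p2 * 3 ^ z ≡⟨ lem₁ p3 p2 (3 ^ z) ⟩
        p3 * 3 ^ z * p2 ≡⟨ cong (_* p2) (sym (doubled 3)) ⟩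
        3 ^ k * 3 ^ k * p2 ≤⟨ *-monoˡ-≤ p2 (*-mono-≤ grown grown) ⟩
        2 ^ k * w ^ E * (2 ^ k * w ^ E) * p2 ≡⟨ lem₂ (2 ^ k) (w ^ E) p2 ⟩
        2 ^ k * 2 ^ k * (w ^ E * w ^ E * p2) ≤⟨ *-monoʳ-≤ (2 ^ k * 2 ^ k) powered ⟩
        2 ^ k * 2 ^ k * p3 ≡⟨ cong (_* p3) (doubled 2) ⟩
        p2 * 2 ^ z * p3 ≡⟨ lem₃ p2 (2 ^ z) p3 ⟩
        p3 * p2 * 2 ^ z ∎)
        where
        p3 = 3 ^ (u * E)
        p2 = 2 ^ (u * E)
        lem₁ : ∀ a b c → a * b * c ≡ a * c * b
        lem₁ = solveℕ-∀
        lem₂ : ∀ a b c → a * b * (a * b) * c ≡ a * a * (b * b * c)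
        lem₂ = solveℕ-∀
        lem₃ : ∀ a b c → a * b * c ≡ c * a * b
        lem₃ = solveℕ-∀

-- Assembly of the ranges of k and n

no-factorisation : ∀ {n k} → 2 * k ≤ n → n < (k + 1) ^ 3 → ∀ d e → 0 < d → 0 < e → d + e ≡ k →
  ¬ Factorisation n k d e
no-factorisation {n} {k} 2k≤n n<[k+1]³ d e 0<d 0<e d+e φ = cases (k <? 52) (n <? 17576) (n <? suc k * suc k)
  where
  open Factorisation φ
  k≤n : k ≤ n
  k≤n = ≤-trans (m≤m+n k (k + 0)) 2k≤n
  D : Degrees n k d e
  D = degrees F G k≤n 0<d 0<e d+e lastF lastG FG
  n<cube : n < suc k * (suc k * suc k)
  n<cube = subst (n <_) (lem k) n<[k+1]³
    where
    lem : ∀ k → (k + 1) * ((k + 1) * ((k + 1) * 1)) ≡ suc k * (suc k * suc k)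
    lem = solveℕ-∀
  26≤k : 17576 ≤ n → 26 ≤ k
  26≤k 17576≤n = ≮⇒≥ λ k<26 → <⇒≱ n<cube
    (≤-trans (*-mono-≤ k<26 (*-mono-≤ k<26 k<26)) 17576≤n)
  near : n < suc k * suc k → 52 ≤ k → Dec (k < 300) → Dec (k < 4096) → ⊥
  near n< 52≤k (yes k<300) _           = lower-small D 2k≤n n< 52≤k k<300
  near n< 52≤k (no k≮300)  (yes k<4096) = lower-middle D 2k≤n n< (≮⇒≥ k≮300) k<4096
  near n< 52≤k (no k≮300)  (no k≮4096)  = lower-huge D 2k≤n n< (≮⇒≥ k≮4096)
  cases : Dec (k < 52) → Dec (n < 17576) → Dec (n < suc k * suc k) → ⊥
  cases (yes k<52) (yes n<) _ =
    small-case (subst (2 ≤_) d+e (ℕP.+-mono-≤ 0<d 0<e)) k<52 2k≤n (ℕP.⊓-pres-m< n<[k+1]³ n<) d+e D φ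
  -- This case is void: (k + 1)² ≤ 52² lies below 17576.
  cases (yes k<52) (no n≮) (yes n<) = <⇒≱ n<
    (≤-trans (*-mono-≤ k<52 k<52) (≤-trans (ℕP.≤ᵇ⇒≤ 2704 17576 _) (≮⇒≥ n≮)))
  cases (yes k<52) (no n≮) (no n≥) =
    upper-range D (26≤k (≮⇒≥ n≮)) (λ _ → ≮⇒≥ n≮) (≮⇒≥ n≥) n<cube
  cases (no k≮52) _ (no n≥) =
    upper-range D (≤-trans (ℕP.≤ᵇ⇒≤ 26 52 _) (≮⇒≥ k≮52)) (λ k<52 → contradiction k<52 k≮52) (≮⇒≥ n≥) n<cube
  cases (no k≮52) _ (yes n<) = near n< (≮⇒≥ k≮52) (k <? 300) (k <? 4096)

theorem1p1 : (k n : ℕ) → 1 ≤ k → 1 ≤ n → 2 * k ≤ n → n < (k + 1) ^ 3 →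
    Irreducible (P n k)
theorem1p1 k n 1≤k _ 2k≤n n<[k+1]³ = irreducible n k 1≤k
  (≤-trans (m≤m+n k (k + 0)) 2k≤n) (no-factorisation 2k≤n n<[k+1]³)
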